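{- Let $n\ge 3$ and $S=\{1,\ldots,n\}$. The cell-form map $$f:\mathcal{P}_{S\cup\{d\}}\longrightarrow H^{n-2}(\mathfrak{M}_{0,n+1})$$ is surjective with kernel equal to the subspace $I_S$.
   Context: $\mathcal{P}_{S\cup\{d\}}$ is the $\mathbb{Q}$-vector space with basis the cyclic orderings of the $(n+1)$-element set $S\cup\{d\}$ (viewed as oriented planar polygons with edges labelled by $S\cup\{d\}$, up to rotation). Every cyclic ordering is written uniquely as $(w,d)$ with $w$ a word using each letter of $S$ exactly once. $I_S\subset\mathcal{P}_{S\cup\{d\}}$ is the subspace spanned by the elements $(A\,\text{ш}\,B,d)$, where $A,B$ are nonempty words with distinct letters whose sets of letters are disjoint with union $S$, and $A\,\text{ш}\,B$ is the usual shuffle product (the sum of all interleavings). $\mathfrak{M}_{0,n+1}=\{(t_1,\ldots,t_{n-2}): t_i\neq 0,1,\infty,\ t_i\ne t_j \text{ for }i\ne j\}$ is the moduli space of genus $0$ curves with $n+1$ ordered marked points, put in the form $(0,t_1,\ldots,t_{n-2},1,\infty)$; $H^{n-2}(\mathfrak{M}_{0,n+1})$ is its algebraic de Rham cohomology over $\mathbb{Q}$. Let $\rho$ send $1,2,\ldots,n-1,n,d$ to $0,t_1,\ldots,t_{n-2},1,\infty$ respectively. The linear map $f$ sends $(i_1,\ldots,i_n,d)$ to the class of the cell-form $$[\rho(i_1),\ldots,\rho(i_n),\infty]=\frac{dt_1\cdots dt_{n-2}}{(\rho(i_2)-\rho(i_1))(\rho(i_3)-\rho(i_2))\cdots(\rho(i_n)-\rho(i_{n-1}))}.$$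 -}

module Defs where

open import Algebra.Bundles using (CommutativeRing; Semiring)
open import Algebra.Module.Bundles using (LeftModule)
open import Algebra.Module.Morphism.Structures using (module LeftModuleMorphisms)
import Algebra.Definitions.RawSemiring as RawSemiringDefinitions
import Algebra.Properties.AbelianGroup as AbelianGroupProperties
import Algebra.Properties.CommutativeSemigroup as CommutativeSemigroupProperties
import Algebra.Properties.Ring as RingProperties
import Algebra.Properties.Semiring.Sum as SemiringSum
open import Data.Bool.Base using (true; false; if_then_else_)
open import Data.Fin.Base using (Fin; zero; suc)
open import Data.Fin.Properties using () renaming (_≟_ to _≟ᶠ_)
open import Data.Fin.Relation.Unary.Top using (view; ‵fromℕ; ‵inject₁)
open import Data.Fin.Subset using (Subset; inside; outside; _-_; ∣_∣)
open import Data.Fin.Subset.Properties using (∣p∣≤n; x∈p⇒∣p-x∣<∣p∣)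
open import Data.List.Base using (List; []; _∷_; _++_; _∷ʳ_; map; foldr; catMaybes; allFin)
open import Data.List.Membership.Propositional using (_∈_; mapWith∈)
open import Data.List.Membership.Propositional.Properties using (∈-++⁻; ∈-map⁻)
import Data.List.Properties as List
open import Data.List.Relation.Binary.Permutation.Propositional using (_↭_; ↭-refl; ↭-sym; ↭-trans; ↭-reflexive; prep; ↭⇒↭ₛ)
open import Data.List.Relation.Binary.Permutation.Propositional.Properties using (catMaybes-↭; ∈-resp-↭; shift; map⁺; ++-comm; ∷↭∷ʳ)
import Data.List.Relation.Binary.Permutation.Setoid.Properties as ↭ₛ
open import Data.List.Relation.Unary.All as All using ()
open import Data.List.Relation.Unary.AllPairs as AllPairs using ()
open import Data.List.Relation.Unary.Any using (here; there)
open import Data.List.Relation.Unary.Linked using (Linked; []; [-]; _∷_)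
open import Data.List.Relation.Unary.Linked.Properties using (AllPairs⇒Linked)
open import Data.List.Relation.Unary.Unique.Propositional using (Unique)
open import Data.List.Relation.Unary.Unique.Propositional.Properties using (allFin⁺) renaming (map⁺ to Unique-map⁺)
open import Data.Maybe.Base using (Maybe; just; nothing)
open import Data.Maybe.Properties using (just-injective)
open import Data.Nat.Base using (ℕ; zero; suc; _∸_)
open import Data.Nat.Properties using (_≟_; <-≤-trans; <⇒≢)
open import Data.Product.Base using (∃; ∃₂; _×_; _,_; proj₁; proj₂)
open import Data.Rational.Base as ℚ using (ℚ; 0ℚ; 1ℚ)
open import Data.Rational.Properties using (+-*-ring)
open import Data.Sum.Base using (_⊎_; inj₁; inj₂)
open import Data.Vec.Base using (_∷_; lookup)
open import Data.Vec.Properties using (lookup⇒[]=)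
open import Function.Base using (_∘_)
open import Level using (0ℓ)
open import Relation.Binary.Bundles using (Setoid)
open import Relation.Binary.PropositionalEquality using (_≡_; _≢_; refl; sym; trans; cong; cong₂; subst; setoid; module ≡-Reasoning)
import Relation.Binary.Reasoning.Setoid as SetoidReasoning
open import Relation.Nullary.Decidable using (does; dec-false)
open import Relation.Nullary.Negation using (¬_; contradiction)
open import Relation.Unary using (Pred)

ℚ-VectorSpace : Set₁
ℚ-VectorSpace = LeftModule +-*-ring 0ℓ 0ℓ

------------------------------------------------------------------------

data Span (V : ℚ-VectorSpace) (X : Pred (LeftModule.Carrierᴹ V) 0ℓ) : Pred (LeftModule.Carrierᴹ V) 0ℓ where
  ⊆span : ∀ {x} → X x → Span V X x
  0∈    : Span V X (LeftModule.0ᴹ V)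
  +∈    : ∀ {x y} → Span V X x → Span V X y → Span V X (LeftModule._+ᴹ_ V x y)
  *∈    : ∀ q {x} → Span V X x → Span V X (LeftModule._*ₗ_ V q x)
  ≈∈    : ∀ {x y} → LeftModule._≈ᴹ_ V x y → Span V X x → Span V X y

module Free (B : Setoid 0ℓ 0ℓ) where

  private module B = Setoid B

  infixl 6 _+_
  infixr 7 _*_
  infix 4 _≈_

  data Combination : Set where
    basis : B.Carrier → Combination
    0#    : Combination
    _+_   : Combination → Combination → Combination
    _*_   : ℚ → Combination → Combination

  -- The least congruence containing the equality of B and the axioms of a
  -- ℚ-vector space.
  data _≈_ : Combination → Combination → Set where
    ≈-refl     : ∀ {x} → x ≈ x
    ≈-sym      : ∀ {x y} → x ≈ y → y ≈ x
    ≈-trans    : ∀ {x y z} → x ≈ y → y ≈ z → x ≈ z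
    basis-cong : ∀ {b c} → b B.≈ c → basis b ≈ basis c
    +-cong     : ∀ {x x′ y y′} → x ≈ x′ → y ≈ y′ → x + y ≈ x′ + y′
    *-cong     : ∀ {q x x′} → x ≈ x′ → q * x ≈ q * x′
    +-assoc    : ∀ x y z → (x + y) + z ≈ x + (y + z)
    +-comm     : ∀ x y → x + y ≈ y + x
    +-identity : ∀ x → 0# + x ≈ x
    *-distribˡ : ∀ q x y → q * (x + y) ≈ q * x + q * y
    *-distribʳ : ∀ x q r → (q ℚ.+ r) * x ≈ q * x + r * x
    *-assoc    : ∀ q r x → (q ℚ.* r) * x ≈ q * (r * x)
    *-identity : ∀ x → 1ℚ * x ≈ x
    *-zero     : ∀ x → 0ℚ * x ≈ 0#

  private
    *-zeroʳ : ∀ q → q * 0# ≈ 0#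
    *-zeroʳ q = ≈-trans (*-cong (≈-sym (*-zero 0#)))
      (≈-trans (≈-sym (*-assoc q 0ℚ 0#)) (subst (λ r → r * 0# ≈ 0#) (sym (ℚz q)) (*-zero 0#)))
      where open import Data.Rational.Properties using () renaming (*-zeroʳ to ℚz)

    inverseˡ : ∀ x → (ℚ.- 1ℚ) * x + x ≈ 0#
    inverseˡ x = ≈-trans (+-cong ≈-refl (≈-sym (*-identity x)))
      (≈-trans (≈-sym (*-distribʳ x (ℚ.- 1ℚ) 1ℚ)) (*-zero x))

  vectorSpace : ℚ-VectorSpace
  vectorSpace = record
    { Carrierᴹ = Combination
    ; _≈ᴹ_ = _≈_
    ; _+ᴹ_ = _+_
    ; _*ₗ_ = _*_
    ; 0ᴹ = 0#
    ; -ᴹ_ = (ℚ.- 1ℚ) *_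
    ; isLeftModule = record
      { isLeftSemimodule = record
        { +ᴹ-isCommutativeMonoid = record
          { isMonoid = record
            { isSemigroup = record
              { isMagma = record
                { isEquivalence = record { refl = ≈-refl ; sym = ≈-sym ; trans = ≈-trans }
                ; ∙-cong = +-cong
                }
              ; assoc = +-assoc
              }
            ; identity = +-identity , λ x → ≈-trans (+-comm x 0#) (+-identity x)
            }
          ; comm = +-comm
          }
        ; isPreleftSemimodule = record
          { *ₗ-cong = λ { refl → *-cong }
          ; *ₗ-zeroˡ = *-zero
          ; *ₗ-distribʳ = *-distribʳ
          ; *ₗ-identityˡ = *-identity
          ; *ₗ-assoc = *-assoc
          ; *ₗ-zeroʳ = *-zeroʳ
          ; *ₗ-distribˡ = *-distribˡ
          }
        }
      ; -ᴹ‿cong = *-cong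
      ; -ᴹ‿inverse = inverseˡ , λ x → ≈-trans (+-comm x _) (inverseˡ x)
      }
    }

  sum : List Combination → Combination
  sum = foldr _+_ 0#

  module LinearExtension (V : ℚ-VectorSpace) (g : B.Carrier → LeftModule.Carrierᴹ V) where

    private module V = LeftModule V

    extend : Combination → V.Carrierᴹ
    extend (basis b) = g b
    extend 0#        = V.0ᴹ
    extend (x + y)   = extend x V.+ᴹ extend y
    extend (q * x)   = q V.*ₗ extend x

    module _ (g-cong : ∀ {b c} → b B.≈ c → g b V.≈ᴹ g c) where

      extend-cong : ∀ {x y} → x ≈ y → extend x V.≈ᴹ extend y
      extend-cong ≈-refl             = V.≈ᴹ-refl
      extend-cong (≈-sym p)          = V.≈ᴹ-sym (extend-cong p)
      extend-cong (≈-trans p q)      = V.≈ᴹ-trans (extend-cong p) (extend-cong q)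
      extend-cong (basis-cong p)     = g-cong p
      extend-cong (+-cong p q)       = V.+ᴹ-cong (extend-cong p) (extend-cong q)
      extend-cong (*-cong p)         = V.*ₗ-cong refl (extend-cong p)
      extend-cong (+-assoc x y z)    = V.+ᴹ-assoc _ _ _
      extend-cong (+-comm x y)       = V.+ᴹ-comm _ _
      extend-cong (+-identity x)     = V.+ᴹ-identityˡ _
      extend-cong (*-distribˡ q x y) = V.*ₗ-distribˡ q _ _
      extend-cong (*-distribʳ x q r) = V.*ₗ-distribʳ _ q r
      extend-cong (*-assoc q r x)    = V.*ₗ-assoc q r _
      extend-cong (*-identity x)     = V.*ₗ-identityˡ _
      extend-cong (*-zero x)         = V.*ₗ-zeroˡ _

      extend-isHomomorphism : LeftModuleMorphisms.IsLeftModuleHomomorphism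
        (LeftModule.rawLeftModule vectorSpace) V.rawLeftModule extend
      extend-isHomomorphism = record
        { +ᴹ-isGroupHomomorphism = record
          { isMonoidHomomorphism = record
            { isMagmaHomomorphism = record
              { isRelHomomorphism = record { cong = extend-cong }
              ; homo = λ _ _ → V.≈ᴹ-refl
              }
            ; ε-homo = V.≈ᴹ-refl
            }
          ; ⁻¹-homo = λ x → V.≈ᴹ-trans (V.*ₗ-cong refl V.≈ᴹ-refl) (neg (extend x))
          }
        ; *ₗ-homo = λ _ _ → V.≈ᴹ-refl
        }
        where
        open AbelianGroupProperties V.+ᴹ-abelianGroup using (inverseˡ-unique)
        neg : ∀ v → (ℚ.- 1ℚ) V.*ₗ v V.≈ᴹ (V.-ᴹ v)
        neg v = inverseˡ-unique _ _ (V.≈ᴹ-trans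
          (V.+ᴹ-cong V.≈ᴹ-refl (V.≈ᴹ-sym (V.*ₗ-identityˡ v)))
          (V.≈ᴹ-trans (V.≈ᴹ-sym (V.*ₗ-distribʳ v (ℚ.- 1ℚ) 1ℚ)) (V.*ₗ-zeroˡ v)))

------------------------------------------------------------------------
-- Words in S = Fin n and cyclic orderings of S ∪ {d} = Maybe (Fin n).
-- The letter i of {1,…,n} is the element i - 1 of Fin n; d is nothing.

labels : ∀ n → List (Maybe (Fin n))
labels n = nothing ∷ map just (allFin n)

-- Being a permutation of allFin n, resp. of labels n, says that each
-- letter occurs exactly once.
record Word (n : ℕ) : Set where
  constructor ⟨_,_⟩
  field
    letters  : List (Fin n)
    complete : letters ↭ allFin n

record Polygon (n : ℕ) : Set where
  constructor ⟨_,_⟩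
  field
    edges    : List (Maybe (Fin n))
    complete : edges ↭ labels n

open Word using (letters)
open Polygon using (edges)

infix 4 _∼ʳ_

_∼ʳ_ : ∀ {n} → Polygon n → Polygon n → Set
c ∼ʳ c′ = ∃₂ λ u v → edges c ≡ u ++ v × edges c′ ≡ v ++ u

++-split : ∀ {A : Set} (u v x y : List A) → u ++ v ≡ x ++ y →
           (∃ λ w → x ≡ u ++ w × v ≡ w ++ y) ⊎ (∃ λ w → u ≡ x ++ w × y ≡ w ++ v)
++-split []      v x       y e = inj₁ (x , refl , e)
++-split (a ∷ u) v []      y e = inj₂ (a ∷ u , refl , sym e)
++-split (a ∷ u) v (b ∷ x) y e with List.∷-injective e
... | refl , e′ with ++-split u v x y e′
... | inj₁ (w , p , q) = inj₁ (w , cong (a ∷_) p , q)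
... | inj₂ (w , p , q) = inj₂ (w , cong (a ∷_) p , q)

∼ʳ-trans : ∀ {n} {a b c : Polygon n} → a ∼ʳ b → b ∼ʳ c → a ∼ʳ c
∼ʳ-trans (u , v , p , q) (x , y , r , s) with ++-split v u x y (trans (sym q) r)
... | inj₁ (w , refl , refl) = w , y ++ v , trans p (List.++-assoc w y v) , trans s (sym (List.++-assoc y v w))
... | inj₂ (w , refl , refl) = u ++ x , w , trans p (sym (List.++-assoc u x w)) , trans s (List.++-assoc w u x)

CyclicOrdering : ℕ → Setoid 0ℓ 0ℓ
CyclicOrdering n = record
  { Carrier = Polygon n
  ; _≈_ = _∼ʳ_
  ; isEquivalence = record
    { refl  = λ {c} → [] , edges c , refl , sym (List.++-identityʳ (edges c))
    ; sym   = λ { (u , v , p , q) → v , u , q , p }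
    ; trans = λ {a} {b} {c} → ∼ʳ-trans {a = a} {b} {c}
    }
  }

-- The cyclic ordering (w , d).
close : ∀ {n} → Word n → Polygon n
close ⟨ w , p ⟩ = ⟨ map just w ∷ʳ nothing , ↭-trans (↭-sym (∷↭∷ʳ nothing (map just w))) (prep nothing (map⁺ just p)) ⟩

before-d after-d : ∀ {A : Set} → List (Maybe A) → List A
before-d []            = []
before-d (nothing ∷ _) = []
before-d (just x ∷ xs) = x ∷ before-d xs
after-d []             = []
after-d (nothing ∷ xs) = catMaybes xs
after-d (just _ ∷ xs)  = after-d xs

catMaybes-before-after : ∀ {A : Set} (xs : List (Maybe A)) → catMaybes xs ≡ before-d xs ++ after-d xs
catMaybes-before-after []             = refl
catMaybes-before-after (nothing ∷ xs) = refl
catMaybes-before-after (just x ∷ xs)  = cong (x ∷_) (catMaybes-before-after xs)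

catMaybes-just : ∀ {A : Set} (xs : List A) → catMaybes (map just xs) ≡ xs
catMaybes-just []       = refl
catMaybes-just (x ∷ xs) = cong (x ∷_) (catMaybes-just xs)

catMaybes-++ : ∀ {A : Set} (xs ys : List (Maybe A)) → catMaybes (xs ++ ys) ≡ catMaybes xs ++ catMaybes ys
catMaybes-++ []             ys = refl
catMaybes-++ (nothing ∷ xs) ys = catMaybes-++ xs ys
catMaybes-++ (just x ∷ xs)  ys = cong (x ∷_) (catMaybes-++ xs ys)

before-∈ : ∀ {A : Set} {u : List (Maybe A)} v → nothing ∈ u → before-d (u ++ v) ≡ before-d u
before-∈ {u = nothing ∷ u} v m           = refl
before-∈ {u = just x ∷ u}  v (there m) = cong (x ∷_) (before-∈ v m)

after-∈ : ∀ {A : Set} {u : List (Maybe A)} v → nothing ∈ u → after-d (u ++ v) ≡ after-d u ++ catMaybes v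
after-∈ {u = nothing ∷ u} v m         = catMaybes-++ u v
after-∈ {u = just x ∷ u}  v (there m) = after-∈ v m

before-∉ : ∀ {A : Set} (v u : List (Maybe A)) → ¬ nothing ∈ v → before-d (v ++ u) ≡ catMaybes v ++ before-d u
before-∉ []            u m = refl
before-∉ (nothing ∷ v) u m = contradiction (here refl) m
before-∉ (just x ∷ v)  u m = cong (x ∷_) (before-∉ v u (m ∘ there))

after-∉ : ∀ {A : Set} (v u : List (Maybe A)) → ¬ nothing ∈ v → after-d (v ++ u) ≡ after-d u
after-∉ []            u m = refl
after-∉ (nothing ∷ v) u m = contradiction (here refl) m
after-∉ (just x ∷ v)  u m = after-∉ v u (m ∘ there)

map-just-catMaybes : ∀ {A : Set} (v : List (Maybe A)) → ¬ nothing ∈ v → map just (catMaybes v) ≡ v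
map-just-catMaybes []            m = refl
map-just-catMaybes (nothing ∷ v) m = contradiction (here refl) m
map-just-catMaybes (just x ∷ v)  m = cong (just x ∷_) (map-just-catMaybes v (m ∘ there))

Unique-disjoint : ∀ {A : Set} {x : A} u {v} → Unique (u ++ v) → x ∈ u → ¬ x ∈ v
Unique-disjoint (y ∷ u) (y∉ AllPairs.∷ _) (here refl) n = All.lookup y∉ (∈-++⁺ʳ u n) refl
  where open import Data.List.Membership.Propositional.Properties using (∈-++⁺ʳ)
Unique-disjoint (y ∷ u) (_ AllPairs.∷ un) (there m) n = Unique-disjoint u un m n

polygon-unique : ∀ {n} (c : Polygon n) → Unique (edges c)
polygon-unique {n} ⟨ w , p ⟩ = ↭ₛ.Unique-resp-↭ (setoid _) (↭⇒↭ₛ (↭-sym p))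
  (All.tabulate d∉ AllPairs.∷ Unique-map⁺ just-injective (allFin⁺ n))
  where
  d∉ : ∀ {x} → x ∈ map just (allFin n) → nothing ≢ x
  d∉ m refl with ∈-map⁻ just m
  ... | _ , _ , ()

d∈ : ∀ {n} (c : Polygon n) → nothing ∈ edges c
d∈ ⟨ w , p ⟩ = ∈-resp-↭ (↭-sym p) (here refl)

-- The word w with c = (w , d); it exists and is unique by close-open,
-- open-at-d-cong and open-close.
open-at-d : ∀ {n} → Polygon n → Word n
open-at-d {n} ⟨ c , p ⟩ = ⟨ after-d c ++ before-d c ,
  ↭-trans (++-comm (after-d c) (before-d c))
    (↭-trans (↭-reflexive (sym (catMaybes-before-after c)))
      (↭-trans (catMaybes-↭ p) (↭-reflexive (catMaybes-just (allFin n))))) ⟩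

rotate-∈ : ∀ {A : Set} (u v : List (Maybe A)) → nothing ∈ u → ¬ nothing ∈ v →
           after-d (u ++ v) ++ before-d (u ++ v) ≡ after-d (v ++ u) ++ before-d (v ++ u)
rotate-∈ u v m n = begin
  after-d (u ++ v) ++ before-d (u ++ v)        ≡⟨ cong₂ _++_ (after-∈ v m) (before-∈ v m) ⟩
  (after-d u ++ catMaybes v) ++ before-d u     ≡⟨ List.++-assoc (after-d u) _ _ ⟩
  after-d u ++ (catMaybes v ++ before-d u)     ≡⟨ cong₂ _++_ (after-∉ v u n) (before-∉ v u n) ⟨
  after-d (v ++ u) ++ before-d (v ++ u)        ∎
  where open ≡-Reasoning

open-at-d-cong : ∀ {n} {c c′ : Polygon n} → c ∼ʳ c′ → letters (open-at-d c) ≡ letters (open-at-d c′)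
open-at-d-cong {c = c@(⟨ _ , _ ⟩)} {c′ = c′@(⟨ _ , _ ⟩)} (u , v , refl , refl) with ∈-++⁻ u (d∈ c)
... | inj₁ m = rotate-∈ u v m (Unique-disjoint u (polygon-unique c) m)
... | inj₂ m = sym (rotate-∈ v u m (Unique-disjoint v (polygon-unique c′) m))

close-open : ∀ {n} (c : Polygon n) → c ∼ʳ close (open-at-d c)
close-open c@(⟨ w , _ ⟩) = go w (d∈ c) (polygon-unique c)
  where
  split : ∀ {A : Set} (w : List (Maybe A)) → nothing ∈ w → Unique w →
          w ≡ (map just (before-d w) ∷ʳ nothing) ++ map just (after-d w)
  split (nothing ∷ w) m (d∉ AllPairs.∷ _) =
    cong (nothing ∷_) (sym (map-just-catMaybes w λ n → All.lookup d∉ n refl))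
  split (just x ∷ w) (there m) (_ AllPairs.∷ un) = cong (just x ∷_) (split w m un)
  go : ∀ {A : Set} (w : List (Maybe A)) → nothing ∈ w → Unique w →
       ∃₂ λ u v → w ≡ u ++ v × map just (after-d w ++ before-d w) ∷ʳ nothing ≡ v ++ u
  go w m un = map just (before-d w) ∷ʳ nothing , map just (after-d w) , split w m un ,
    trans (cong (_∷ʳ nothing) (List.map-++ just (after-d w) (before-d w)))
      (List.++-assoc (map just (after-d w)) _ _)

open-close : ∀ {n} (w : Word n) → letters (open-at-d (close w)) ≡ letters w
open-close ⟨ w , _ ⟩ = go w
  where
  after≡[] : ∀ {A : Set} (w : List A) → after-d (map just w ∷ʳ nothing) ≡ []
  after≡[] []      = refl
  after≡[] (x ∷ w) = after≡[] w
  before≡ : ∀ {A : Set} (w : List A) → before-d (map just w ∷ʳ nothing) ≡ w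
  before≡ []      = refl
  before≡ (x ∷ w) = cong (x ∷_) (before≡ w)
  go : ∀ {A : Set} (w : List A) → after-d (map just w ∷ʳ nothing) ++ before-d (map just w ∷ʳ nothing) ≡ w
  go w rewrite after≡[] w = before≡ w

𝒫 : ℕ → ℚ-VectorSpace
𝒫 n = Free.vectorSpace (CyclicOrdering n)

------------------------------------------------------------------------

infixr 6 _ш_

_ш_ : ∀ {A : Set} → List A → List A → List (List A)
[]       ш ys       = ys ∷ []
(x ∷ xs) ш []       = (x ∷ xs) ∷ []
(x ∷ xs) ш (y ∷ ys) = map (x ∷_) (xs ш (y ∷ ys)) ++ map (y ∷_) ((x ∷ xs) ш ys)

ш-↭ : ∀ {A : Set} (xs ys : List A) {w} → w ∈ xs ш ys → w ↭ xs ++ ys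
ш-↭ []       ys       (here refl) = ↭-refl
ш-↭ (x ∷ xs) []       (here refl) = ↭-reflexive (cong (x ∷_) (sym (List.++-identityʳ xs)))
ш-↭ (x ∷ xs) (y ∷ ys) m with ∈-++⁻ (map (x ∷_) (xs ш (y ∷ ys))) m
... | inj₁ m₁ with ∈-map⁻ (x ∷_) m₁
...   | _ , m′ , refl = prep x (ш-↭ xs (y ∷ ys) m′)
ш-↭ (x ∷ xs) (y ∷ ys) m | inj₂ m₂ with ∈-map⁻ (y ∷_) m₂
...   | _ , m′ , refl = ↭-trans (prep y (ш-↭ (x ∷ xs) ys m′)) (↭-sym (shift y (x ∷ xs) ys))

-- The sum of all (w , d) with w an interleaving of A and B.
shuffle : ∀ {n} (A B : List (Fin n)) → A ++ B ↭ allFin n → LeftModule.Carrierᴹ (𝒫 n)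
shuffle {n} A B p = sum (mapWith∈ (A ш B) λ m → basis (close ⟨ _ , ↭-trans (ш-↭ A B m) p ⟩))
  where open Free (CyclicOrdering n) using (sum; basis)

-- A ++ B ↭ allFin n says that A and B have distinct letters, and that their
-- sets of letters are disjoint with union S.
data IsShuffle {n : ℕ} : Pred (LeftModule.Carrierᴹ (𝒫 n)) 0ℓ where
  isShuffle : ∀ {A B} → A ≢ [] → B ≢ [] → (p : A ++ B ↭ allFin n) → IsShuffle (shuffle A B p)

I : ∀ n → Pred (LeftModule.Carrierᴹ (𝒫 n)) 0ℓ
I n = Span (𝒫 n) IsShuffle

------------------------------------------------------------------------
-- The coordinate ring of 𝔐_{0,m+3}, the complement in affine m-space of the
-- hyperplanes t_i = 0, t_i = 1 and t_i = t_j.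

-- The marked points other than ∞.
data Point (m : ℕ) : Set where
  𝟎 𝟏 : Point m
  𝒕   : Fin m → Point m

infixl 6 _+_
infixl 7 _*_
infix  8 -_
infix  4 _≈_

-- inv p q is 1 / (q - p).  Its index is irrelevant, so that it depends only
-- on p and q.
data 𝒪 (m : ℕ) : Set where
  const : ℚ → 𝒪 m
  t     : Fin m → 𝒪 m
  _+_   : 𝒪 m → 𝒪 m → 𝒪 m
  _*_   : 𝒪 m → 𝒪 m → 𝒪 m
  -_    : 𝒪 m → 𝒪 m
  inv   : (p q : Point m) → .(p ≢ q) → 𝒪 m

val : ∀ {m} → Point m → 𝒪 m
val 𝟎     = const 0ℚ
val 𝟏     = const 1ℚ
val (𝒕 i) = t i

-- Together with its equality 𝒪 m is the commutative ℚ-algebra generated by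
-- the t_i and the inv p q, subject to (q - p) · inv p q = 1 : the localization
-- of ℚ[t_1,…,t_m] at the differences of distinct marked points.
data _≈_ {m : ℕ} : 𝒪 m → 𝒪 m → Set where
  ≈-refl      : ∀ {x} → x ≈ x
  ≈-sym       : ∀ {x y} → x ≈ y → y ≈ x
  ≈-trans     : ∀ {x y z} → x ≈ y → y ≈ z → x ≈ z
  +-cong      : ∀ {x x′ y y′} → x ≈ x′ → y ≈ y′ → x + y ≈ x′ + y′
  *-cong      : ∀ {x x′ y y′} → x ≈ x′ → y ≈ y′ → x * y ≈ x′ * y′
  -‿cong      : ∀ {x x′} → x ≈ x′ → - x ≈ - x′
  +-assoc     : ∀ x y z → (x + y) + z ≈ x + (y + z)
  +-comm      : ∀ x y → x + y ≈ y + x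
  +-identityˡ : ∀ x → const 0ℚ + x ≈ x
  -‿inverseˡ  : ∀ x → - x + x ≈ const 0ℚ
  *-assoc     : ∀ x y z → (x * y) * z ≈ x * (y * z)
  *-comm      : ∀ x y → x * y ≈ y * x
  *-identityˡ : ∀ x → const 1ℚ * x ≈ x
  distribˡ    : ∀ x y z → x * (y + z) ≈ x * y + x * z
  const-+     : ∀ q r → const (q ℚ.+ r) ≈ const q + const r
  const-*     : ∀ q r → const (q ℚ.* r) ≈ const q * const r
  inv-inverse : ∀ p q .(p≢q : p ≢ q) → (val q + - val p) * inv p q p≢q ≈ const 1ℚ

𝒪-commutativeRing : ℕ → CommutativeRing 0ℓ 0ℓ
𝒪-commutativeRing m = record
  { Carrier = 𝒪 m
  ; _≈_ = _≈_
  ; _+_ = _+_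
  ; _*_ = _*_
  ; -_ = -_
  ; 0# = const 0ℚ
  ; 1# = const 1ℚ
  ; isCommutativeRing = record
    { isRing = record
      { +-isAbelianGroup = record
        { isGroup = record
          { isMonoid = record
            { isSemigroup = record
              { isMagma = record
                { isEquivalence = record { refl = ≈-refl ; sym = ≈-sym ; trans = ≈-trans }
                ; ∙-cong = +-cong
                }
              ; assoc = +-assoc
              }
            ; identity = +-identityˡ , λ x → ≈-trans (+-comm x _) (+-identityˡ x)
            }
          ; inverse = -‿inverseˡ , λ x → ≈-trans (+-comm x _) (-‿inverseˡ x)
          ; ⁻¹-cong = -‿cong
          }
        ; comm = +-comm
        }
      ; *-cong = *-cong
      ; *-assoc = *-assoc
      ; *-identity = *-identityˡ , λ x → ≈-trans (*-comm x _) (*-identityˡ x)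
      ; distrib = distribˡ , λ x y z → ≈-trans (*-comm _ x) (≈-trans (distribˡ x y z) (+-cong (*-comm x y) (*-comm x z)))
      }
    ; *-comm = *-comm
    }
  }

-- ∂-val k p is the derivative of val p with respect to t_k.
∂-val : ∀ {m} → Fin m → Point m → 𝒪 m
∂-val k 𝟎     = const 0ℚ
∂-val k 𝟏     = const 0ℚ
∂-val k (𝒕 i) = if does (k ≟ᶠ i) then const 1ℚ else const 0ℚ

∂ : ∀ {m} → Fin m → 𝒪 m → 𝒪 m
∂ k (const _)     = const 0ℚ
∂ k (t i)         = ∂-val k (𝒕 i)
∂ k (x + y)       = ∂ k x + ∂ k y
∂ k (x * y)       = ∂ k x * y + x * ∂ k y
∂ k (- x)         = - ∂ k x
∂ k (inv p q p≢q) = - ((∂-val k q + - ∂-val k p) * (inv p q p≢q * inv p q p≢q))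

module _ {m : ℕ} where

  private
    module R = CommutativeRing (𝒪-commutativeRing m)
    module RP = RingProperties R.ring
    module +S = CommutativeSemigroupProperties R.+-commutativeSemigroup
    open SetoidReasoning R.setoid

    ∂-val≡ : ∀ (k : Fin m) p → ∂ k (val p) ≡ ∂-val k p
    ∂-val≡ k 𝟎     = refl
    ∂-val≡ k 𝟏     = refl
    ∂-val≡ k (𝒕 i) = refl

    inv-∂ : ∀ (a b c : 𝒪 m) → b * c ≈ const 1ℚ → a * c + b * (- (a * (c * c))) ≈ const 0ℚ
    inv-∂ a b c e = begin
      a * c + b * (- (a * (c * c)))   ≈⟨ R.+-congˡ (RP.-‿distribʳ-* b _) ⟨
      a * c + - (b * (a * (c * c)))   ≈⟨ R.+-congˡ (-‿cong lem) ⟩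
      a * c + - (a * c)               ≈⟨ R.-‿inverseʳ _ ⟩
      const 0ℚ                        ∎
      where
      lem : b * (a * (c * c)) ≈ a * c
      lem = begin
        b * (a * (c * c))   ≈⟨ *-assoc b a _ ⟨
        (b * a) * (c * c)   ≈⟨ R.*-congʳ (*-comm b a) ⟩
        (a * b) * (c * c)   ≈⟨ *-assoc a b _ ⟩
        a * (b * (c * c))   ≈⟨ R.*-congˡ (*-assoc b c c) ⟨
        a * ((b * c) * c)   ≈⟨ R.*-congˡ (≈-trans (R.*-congʳ e) (*-identityˡ c)) ⟩
        a * c               ∎

  ∂-cong : ∀ (k : Fin m) {x y : 𝒪 m} → x ≈ y → ∂ k x ≈ ∂ k y
  ∂-cong k ≈-refl          = ≈-refl
  ∂-cong k (≈-sym e)       = ≈-sym (∂-cong k e)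
  ∂-cong k (≈-trans e f)   = ≈-trans (∂-cong k e) (∂-cong k f)
  ∂-cong k (+-cong e f)    = +-cong (∂-cong k e) (∂-cong k f)
  ∂-cong k (*-cong e f)    = +-cong (*-cong (∂-cong k e) f) (*-cong e (∂-cong k f))
  ∂-cong k (-‿cong e)      = -‿cong (∂-cong k e)
  ∂-cong k (+-assoc x y z) = +-assoc _ _ _
  ∂-cong k (+-comm x y)    = +-comm _ _
  ∂-cong k (+-identityˡ x) = +-identityˡ _
  ∂-cong k (-‿inverseˡ x)  = -‿inverseˡ _
  ∂-cong k (*-assoc x y z) = begin
    (∂ k x * y + x * ∂ k y) * z + (x * y) * ∂ k z
      ≈⟨ R.+-congʳ (R.distribʳ z _ _) ⟩
    ((∂ k x * y) * z + (x * ∂ k y) * z) + (x * y) * ∂ k z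
      ≈⟨ +-assoc _ _ _ ⟩
    (∂ k x * y) * z + ((x * ∂ k y) * z + (x * y) * ∂ k z)
      ≈⟨ +-cong (*-assoc _ _ _) (+-cong (*-assoc _ _ _) (*-assoc _ _ _)) ⟩
    ∂ k x * (y * z) + (x * (∂ k y * z) + x * (y * ∂ k z))
      ≈⟨ R.+-congˡ (distribˡ x _ _) ⟨
    ∂ k x * (y * z) + x * (∂ k y * z + y * ∂ k z) ∎
  ∂-cong k (*-comm x y)    = ≈-trans (+-comm _ _) (+-cong (*-comm _ _) (*-comm _ _))
  ∂-cong k (*-identityˡ x) = ≈-trans (+-cong (R.zeroˡ x) (*-identityˡ _)) (+-identityˡ _)
  ∂-cong k (distribˡ x y z) = ≈-trans (+-cong (distribˡ _ _ _) (distribˡ _ _ _)) (+S.interchange _ _ _ _)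
  ∂-cong k (const-+ q r)   = ≈-sym (+-identityˡ _)
  ∂-cong k (const-* q r)   = ≈-sym (≈-trans (+-cong (R.zeroˡ _) (R.zeroʳ _)) (+-identityˡ _))
  ∂-cong k (inv-inverse p q p≢q) rewrite ∂-val≡ k p | ∂-val≡ k q = inv-∂ _ _ _ (inv-inverse p q p≢q)

------------------------------------------------------------------------
-- Algebraic de Rham cohomology of 𝔐_{0,m+3}.  This is an affine open in affine
-- space, so its module of k-forms is free over 𝒪 m on the
-- dt_{i₁} ∧ … ∧ dt_{i_k} with i₁ < … < i_k, and its cohomology is that of the
-- complex of global forms.

-- The coefficient at a subset {i₁ < … < i_k} is that of dt_{i₁} ∧ … ∧ dt_{i_k}.
Form : ℕ → Set
Form m = Subset m → 𝒪 m

below : ∀ {m} → Subset m → Fin m → ℕ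
below (_       ∷ _) zero    = 0
below (inside  ∷ s) (suc i) = suc (below s i)
below (outside ∷ s) (suc i) = below s i

infix 4 _≋_

_≋_ : ∀ {m} → Form m → Form m → Set
ω ≋ η = ∀ s → ω s ≈ η s

0ᶠ : ∀ {m} → Form m
0ᶠ _ = const 0ℚ

infixl 6 _+ᶠ_
infixr 7 _*ᶠ_
infix  8 -ᶠ_

_+ᶠ_ : ∀ {m} → Form m → Form m → Form m
(ω +ᶠ η) s = ω s + η s

_*ᶠ_ : ∀ {m} → ℚ → Form m → Form m
(q *ᶠ ω) s = const q * ω s

-ᶠ_ : ∀ {m} → Form m → Form m
(-ᶠ ω) s = - ω s

module _ {m : ℕ} where

  private
    module R = CommutativeRing (𝒪-commutativeRing m)
    module RP = RingProperties R.ring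
    module +S = CommutativeSemigroupProperties R.+-commutativeSemigroup
    module *S = CommutativeSemigroupProperties R.*-commutativeSemigroup
    open RawSemiringDefinitions (Semiring.rawSemiring R.semiring) using (_^_)
    open SemiringSum R.semiring using (sum; sum-cong-≋; ∑-distrib-+; *-distribˡ-sum; sum-replicate-zero)
    open SetoidReasoning R.setoid

  -- The coefficient at s of Σ_i dt_i ∧ ∂_i ω : the basis form of s - i, when
  -- multiplied by dt_i on the left, is (-1)^(below s i) times that of s.
  d : Form m → Form m
  d ω s = sum λ i → if lookup s i then (- const 1ℚ) ^ below s i * ∂ i (ω (s - i)) else const 0ℚ

  HasDegree : ℕ → Form m → Set
  HasDegree k ω = ∀ s → ∣ s ∣ ≢ k → ω s ≈ const 0ℚ

  Closed : Form m → Set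
  Closed ω = d ω ≋ 0ᶠ

  -- ω is the differential of a form of degree k - 1.  (There is no nonzero such
  -- form when k = 0.)
  Exact : ℕ → Form m → Set
  Exact k ω = ∃ λ η → (∀ s → suc ∣ s ∣ ≢ k → η s ≈ const 0ℚ) × ω ≋ d η

  term : Form m → Subset m → Fin m → 𝒪 m
  term ω s i = if lookup s i then (- const 1ℚ) ^ below s i * ∂ i (ω (s - i)) else const 0ℚ

  term-vanish : ∀ ω s i → (lookup s i ≡ true → ω (s - i) ≡ const 0ℚ) → term ω s i ≈ const 0ℚ
  term-vanish ω s i h with lookup s i
  ... | false = ≈-refl
  ... | true rewrite h refl = R.zeroʳ _

  d-vanish : ∀ ω s → (∀ i → lookup s i ≡ true → ω (s - i) ≡ const 0ℚ) → d ω s ≈ const 0ℚ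
  d-vanish ω s h = ≈-trans (sum-cong-≋ (λ i → term-vanish ω s i (h i))) (sum-replicate-zero m)

  d-0 : d 0ᶠ ≋ 0ᶠ
  d-0 s = d-vanish 0ᶠ s (λ _ _ → refl)

  d-+ : ∀ ω η → d (ω +ᶠ η) ≋ d ω +ᶠ d η
  d-+ ω η s = ≈-trans (sum-cong-≋ lem) (∑-distrib-+ (term ω s) (term η s))
    where
    lem : ∀ i → term (ω +ᶠ η) s i ≈ term ω s i + term η s i
    lem i with lookup s i
    ... | false = ≈-sym (+-identityˡ _)
    ... | true  = distribˡ _ _ _

  d-* : ∀ q ω → d (q *ᶠ ω) ≋ q *ᶠ d ω
  d-* q ω s = ≈-trans (sum-cong-≋ lem) (≈-sym (*-distribˡ-sum (const q) (term ω s)))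
    where
    lem : ∀ i → term (q *ᶠ ω) s i ≈ const q * term ω s i
    lem i with lookup s i
    ... | false = ≈-sym (R.zeroʳ _)
    ... | true  = ≈-trans (R.*-congˡ (≈-trans (R.+-congʳ (R.zeroˡ _)) (+-identityˡ _))) (*S.x∙yz≈y∙xz _ _ _)

  const-neg : ∀ (x : 𝒪 m) → const (ℚ.- 1ℚ) * x ≈ - x
  const-neg x = RP.+-inverseˡ-unique _ _ (begin
    const (ℚ.- 1ℚ) * x + x             ≈⟨ R.+-congˡ (*-identityˡ x) ⟨
    const (ℚ.- 1ℚ) * x + const 1ℚ * x  ≈⟨ R.distribʳ x _ _ ⟨
    (const (ℚ.- 1ℚ) + const 1ℚ) * x    ≈⟨ R.*-congʳ (const-+ (ℚ.- 1ℚ) 1ℚ) ⟨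
    const 0ℚ * x                       ≈⟨ R.zeroˡ x ⟩
    const 0ℚ                           ∎)

  d-neg : ∀ ω → d (-ᶠ ω) ≋ -ᶠ d ω
  d-neg ω s = RP.+-inverseˡ-unique _ _ (begin
    d (-ᶠ ω) s + d ω s     ≈⟨ d-+ (-ᶠ ω) ω s ⟨
    d (-ᶠ ω +ᶠ ω) s        ≈⟨ sum-cong-≋ lem ⟩
    d 0ᶠ s                 ≈⟨ d-0 s ⟩
    const 0ℚ               ∎)
    where
    lem : ∀ i → term (-ᶠ ω +ᶠ ω) s i ≈ term 0ᶠ s i
    lem i with lookup s i
    ... | false = ≈-refl
    ... | true  = R.*-congˡ (-‿inverseˡ _)

  record Cocycle (k : ℕ) : Set where
    field
      form   : Form m
      degree : HasDegree k form
      closed : Closed form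

  open Cocycle

  infix 4 _∼_

  _∼_ : ∀ {k} → Cocycle k → Cocycle k → Set
  _∼_ {k} ω ω′ = Exact k (form ω +ᶠ -ᶠ form ω′)

  ≋⇒∼ : ∀ {k} (ω ω′ : Cocycle k) → form ω ≋ form ω′ → ω ∼ ω′
  ≋⇒∼ ω ω′ e = 0ᶠ , (λ _ _ → ≈-refl) , λ s →
    ≈-trans (≈-trans (R.+-congʳ (e s)) (R.-‿inverseʳ _)) (≈-sym (d-0 s))

  ∼-sym : ∀ {k} {ω ω′ : Cocycle k} → ω ∼ ω′ → ω′ ∼ ω
  ∼-sym {_} {ω} {ω′} (η , h , e) = -ᶠ η , (λ s n → ≈-trans (-‿cong (h s n)) RP.-0#≈0#) , λ s → begin
    form ω′ s + - form ω s       ≈⟨ +-comm _ _ ⟩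
    - form ω s + form ω′ s       ≈⟨ R.+-congˡ (RP.-‿involutive _) ⟨
    - form ω s + - - form ω′ s   ≈⟨ RP.-‿+-comm _ _ ⟩
    - (form ω s + - form ω′ s)   ≈⟨ -‿cong (e s) ⟩
    - d η s                      ≈⟨ d-neg η s ⟨
    d (-ᶠ η) s                   ∎

  ∼-trans : ∀ {k} {ω ω′ ω″ : Cocycle k} → ω ∼ ω′ → ω′ ∼ ω″ → ω ∼ ω″
  ∼-trans {_} {ω} {ω′} {ω″} (η , h , e) (ζ , h′ , e′) =
    η +ᶠ ζ , (λ s n → ≈-trans (+-cong (h s n) (h′ s n)) (+-identityˡ _)) , λ s → begin
    form ω s + - form ω″ s                                   ≈⟨ R.+-congʳ (R.+-identityʳ _) ⟨
    (form ω s + const 0ℚ) + - form ω″ s                      ≈⟨ R.+-congʳ (R.+-congˡ (-‿inverseˡ _)) ⟨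
    (form ω s + (- form ω′ s + form ω′ s)) + - form ω″ s     ≈⟨ R.+-congʳ (+-assoc _ _ _) ⟨
    ((form ω s + - form ω′ s) + form ω′ s) + - form ω″ s     ≈⟨ +-assoc _ _ _ ⟩
    (form ω s + - form ω′ s) + (form ω′ s + - form ω″ s)     ≈⟨ +-cong (e s) (e′ s) ⟩
    d η s + d ζ s                                            ≈⟨ d-+ η ζ s ⟨
    d (η +ᶠ ζ) s                                             ∎

  _+ᶜ_ : ∀ {k} → Cocycle k → Cocycle k → Cocycle k
  ω +ᶜ η = record
    { form   = form ω +ᶠ form η
    ; degree = λ s n → ≈-trans (+-cong (degree ω s n) (degree η s n)) (+-identityˡ _)
    ; closed = λ s → ≈-trans (d-+ (form ω) (form η) s) (≈-trans (+-cong (closed ω s) (closed η s)) (+-identityˡ _))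
    }

  _*ᶜ_ : ∀ {k} → ℚ → Cocycle k → Cocycle k
  q *ᶜ ω = record
    { form   = q *ᶠ form ω
    ; degree = λ s n → ≈-trans (R.*-congˡ (degree ω s n)) (R.zeroʳ _)
    ; closed = λ s → ≈-trans (d-* q (form ω) s) (≈-trans (R.*-congˡ (closed ω s)) (R.zeroʳ _))
    }

  -ᶜ_ : ∀ {k} → Cocycle k → Cocycle k
  -ᶜ ω = record
    { form   = -ᶠ form ω
    ; degree = λ s n → ≈-trans (-‿cong (degree ω s n)) RP.-0#≈0#
    ; closed = λ s → ≈-trans (d-neg (form ω) s) (≈-trans (-‿cong (closed ω s)) RP.-0#≈0#)
    }

  0ᶜ : ∀ {k} → Cocycle k
  0ᶜ = record { form = 0ᶠ ; degree = λ _ _ → ≈-refl ; closed = d-0 }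

  +ᶜ-cong : ∀ {k} {ω ω′ η η′ : Cocycle k} → ω ∼ ω′ → η ∼ η′ → (ω +ᶜ η) ∼ (ω′ +ᶜ η′)
  +ᶜ-cong {_} {ω} {ω′} {η} {η′} (α , h , e) (β , h′ , e′) =
    α +ᶠ β , (λ s n → ≈-trans (+-cong (h s n) (h′ s n)) (+-identityˡ _)) , λ s → begin
    (form ω s + form η s) + - (form ω′ s + form η′ s)      ≈⟨ R.+-congˡ (RP.-‿+-comm _ _) ⟨
    (form ω s + form η s) + (- form ω′ s + - form η′ s)    ≈⟨ +S.interchange _ _ _ _ ⟩
    (form ω s + - form ω′ s) + (form η s + - form η′ s)    ≈⟨ +-cong (e s) (e′ s) ⟩
    d α s + d β s                                          ≈⟨ d-+ α β s ⟨
    d (α +ᶠ β) s                                           ∎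

  *ᶜ-cong : ∀ {k} {q r} {ω ω′ : Cocycle k} → q ≡ r → ω ∼ ω′ → (q *ᶜ ω) ∼ (r *ᶜ ω′)
  *ᶜ-cong {_} {q} {_} {ω} {ω′} refl (α , h , e) = q *ᶠ α , (λ s n → ≈-trans (R.*-congˡ (h s n)) (R.zeroʳ _)) , λ s → begin
    const q * form ω s + - (const q * form ω′ s)   ≈⟨ R.+-congˡ (RP.-‿distribʳ-* _ _) ⟩
    const q * form ω s + const q * - form ω′ s     ≈⟨ distribˡ _ _ _ ⟨
    const q * (form ω s + - form ω′ s)             ≈⟨ R.*-congˡ (e s) ⟩
    const q * d α s                                ≈⟨ d-* q α s ⟨
    d (q *ᶠ α) s                                   ∎

  -ᶜ-cong : ∀ {k} {ω ω′ : Cocycle k} → ω ∼ ω′ → (-ᶜ ω) ∼ (-ᶜ ω′)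
  -ᶜ-cong {_} {ω} {ω′} (α , h , e) = -ᶠ α , (λ s n → ≈-trans (-‿cong (h s n)) RP.-0#≈0#) , λ s → begin
    - form ω s + - - form ω′ s   ≈⟨ RP.-‿+-comm _ _ ⟩
    - (form ω s + - form ω′ s)   ≈⟨ -‿cong (e s) ⟩
    - d α s                      ≈⟨ d-neg α s ⟨
    d (-ᶠ α) s                   ∎

  cohomology : ℕ → ℚ-VectorSpace
  cohomology k = record
    { Carrierᴹ = Cocycle k
    ; _≈ᴹ_ = _∼_
    ; _+ᴹ_ = _+ᶜ_
    ; _*ₗ_ = _*ᶜ_
    ; 0ᴹ = 0ᶜ
    ; -ᴹ_ = -ᶜ_
    ; isLeftModule = record
      { isLeftSemimodule = record
        { +ᴹ-isCommutativeMonoid = record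
          { isMonoid = record
            { isSemigroup = record
              { isMagma = record
                { isEquivalence = record
                  { refl  = λ {ω} → ≋⇒∼ ω ω (λ _ → ≈-refl)
                  ; sym   = λ {ω} {ω′} → ∼-sym {_} {ω} {ω′}
                  ; trans = λ {ω} {ω′} {ω″} → ∼-trans {_} {ω} {ω′} {ω″}
                  }
                ; ∙-cong = λ {ω} {ω′} {η} {η′} → +ᶜ-cong {_} {ω} {ω′} {η} {η′}
                }
              ; assoc = λ ω η ζ → ≋⇒∼ ((ω +ᶜ η) +ᶜ ζ) (ω +ᶜ (η +ᶜ ζ)) (λ _ → +-assoc _ _ _)
              }
            ; identity = (λ ω → ≋⇒∼ (0ᶜ +ᶜ ω) ω (λ _ → +-identityˡ _))
                       , (λ ω → ≋⇒∼ (ω +ᶜ 0ᶜ) ω (λ _ → R.+-identityʳ _))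
            }
          ; comm = λ ω η → ≋⇒∼ (ω +ᶜ η) (η +ᶜ ω) (λ _ → +-comm _ _)
          }
        ; isPreleftSemimodule = record
          { *ₗ-cong = λ {q} {r} {ω} {ω′} → *ᶜ-cong {_} {q} {r} {ω} {ω′}
          ; *ₗ-zeroˡ = λ ω → ≋⇒∼ (0ℚ *ᶜ ω) 0ᶜ (λ _ → R.zeroˡ _)
          ; *ₗ-distribʳ = λ ω q r → ≋⇒∼ ((q ℚ.+ r) *ᶜ ω) ((q *ᶜ ω) +ᶜ (r *ᶜ ω))
              (λ _ → ≈-trans (R.*-congʳ (const-+ q r)) (R.distribʳ _ _ _))
          ; *ₗ-identityˡ = λ ω → ≋⇒∼ (1ℚ *ᶜ ω) ω (λ _ → *-identityˡ _)
          ; *ₗ-assoc = λ q r ω → ≋⇒∼ ((q ℚ.* r) *ᶜ ω) (q *ᶜ (r *ᶜ ω))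
              (λ _ → ≈-trans (R.*-congʳ (const-* q r)) (*-assoc _ _ _))
          ; *ₗ-zeroʳ = λ q → ≋⇒∼ (q *ᶜ 0ᶜ) 0ᶜ (λ _ → R.zeroʳ _)
          ; *ₗ-distribˡ = λ q ω η → ≋⇒∼ (q *ᶜ (ω +ᶜ η)) ((q *ᶜ ω) +ᶜ (q *ᶜ η)) (λ _ → distribˡ _ _ _)
          }
        }
      ; -ᴹ‿cong = λ {ω} {ω′} → -ᶜ-cong {_} {ω} {ω′}
      ; -ᴹ‿inverse = (λ ω → ≋⇒∼ ((-ᶜ ω) +ᶜ ω) 0ᶜ (λ _ → -‿inverseˡ _))
                   , (λ ω → ≋⇒∼ (ω +ᶜ (-ᶜ ω)) 0ᶜ (λ _ → R.-‿inverseʳ _))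
      }
    }

  -- g dt_1 ∧ … ∧ dt_m : only the full subset has m elements.
  volume : 𝒪 m → Form m
  volume g s = if does (∣ s ∣ ≟ m) then g else const 0ℚ

  volume-off : ∀ g s → ∣ s ∣ ≢ m → volume g s ≡ const 0ℚ
  volume-off g s n = cong (λ b → if b then g else const 0ℚ) (dec-false (∣ s ∣ ≟ m) n)

  volume-cong : ∀ {g h} → g ≈ h → volume g ≋ volume h
  volume-cong e s with does (∣ s ∣ ≟ m)
  ... | true  = e
  ... | false = ≈-refl

  topForm : 𝒪 m → Cocycle m
  topForm g = record
    { form   = volume g
    ; degree = λ s n → R.reflexive (volume-off g s n)
    ; closed = λ s → d-vanish (volume g) s λ i i∈s →
        volume-off g (s - i) (<⇒≢ (<-≤-trans (x∈p⇒∣p-x∣<∣p∣ (lookup⇒[]= i s i∈s)) (∣p∣≤n s)))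
    }

  topForm-cong : ∀ {g h} → g ≈ h → topForm g ∼ topForm h
  topForm-cong {g} {h} e = ≋⇒∼ (topForm g) (topForm h) (volume-cong e)

-- H n k is the k-th cohomology group of 𝔐_{0,n+1}.
H : ℕ → ℕ → ℚ-VectorSpace
H n k = cohomology {n ∸ 2} k

------------------------------------------------------------------------

-- ρ sends 1, 2, …, n-1, n to 0, t_1, …, t_{n-2}, 1 (for n ≥ 2).
ρ : ∀ {n} → Fin n → Point (n ∸ 2)
ρ zero = 𝟎
ρ {suc (suc m)} (suc i) with view i
... | ‵fromℕ     = 𝟏
... | ‵inject₁ j = 𝒕 j

ρ-injective : ∀ {n} {i j : Fin n} → ρ i ≡ ρ j → i ≡ j
ρ-injective {i = zero} {zero} _ = refl
ρ-injective {suc (suc m)} {zero} {suc j} e with view j | e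
... | ‵fromℕ     | ()
... | ‵inject₁ _ | ()
ρ-injective {suc (suc m)} {suc i} {zero} e with view i | e
... | ‵fromℕ     | ()
... | ‵inject₁ _ | ()
ρ-injective {suc (suc m)} {suc i} {suc j} e with view i | view j | e
... | ‵fromℕ     | ‵fromℕ     | _    = refl
... | ‵inject₁ _ | ‵inject₁ _ | refl = refl
... | ‵fromℕ     | ‵inject₁ _ | ()
... | ‵inject₁ _ | ‵fromℕ     | ()

-- ∏ 1 / (ρ(i_{k+1}) - ρ(i_k)) over the consecutive letters of a word.
cellCoefficient : ∀ {n} {w : List (Fin n)} → Linked _≢_ w → 𝒪 (n ∸ 2)
cellCoefficient []                         = const 1ℚ
cellCoefficient [-]                        = const 1ℚ
cellCoefficient (_∷_ {x = i} {y = j} i≢j l) = inv (ρ i) (ρ j) (i≢j ∘ ρ-injective) * cellCoefficient l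

linked : ∀ {n} (w : Word n) → Linked _≢_ (letters w)
linked {n} ⟨ _ , p ⟩ = AllPairs⇒Linked (↭ₛ.Unique-resp-↭ (setoid _) (↭⇒↭ₛ (↭-sym p)) (allFin⁺ n))

cellForm : ∀ {n} → Polygon n → LeftModule.Carrierᴹ (H n (n ∸ 2))
cellForm c = topForm (cellCoefficient (linked (open-at-d c)))

cellForm-cong : ∀ {n} {c c′ : Polygon n} → c ∼ʳ c′ → LeftModule._≈ᴹ_ (H n (n ∸ 2)) (cellForm c) (cellForm c′)
cellForm-cong {n} {c} {c′} r =
  topForm-cong (reflexive (irrelevant (open-at-d-cong {c = c} {c′} r) (linked (open-at-d c)) (linked (open-at-d c′))))
  where
  open CommutativeRing (𝒪-commutativeRing (n ∸ 2)) using (reflexive)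
  irrelevant : ∀ {w w′ : List (Fin n)} → w ≡ w′ → (l : Linked _≢_ w) (l′ : Linked _≢_ w′) →
               cellCoefficient l ≡ cellCoefficient l′
  irrelevant refl []      []       = refl
  irrelevant refl [-]     [-]      = refl
  irrelevant refl (_ ∷ l) (_ ∷ l′) = cong (_ *_) (irrelevant refl l l′)

f : ∀ n → LeftModule.Carrierᴹ (𝒫 n) → LeftModule.Carrierᴹ (H n (n ∸ 2))
f n = Free.LinearExtension.extend (CyclicOrdering n) (H n (n ∸ 2)) cellForm

f-isHomomorphism : ∀ n → LeftModuleMorphisms.IsLeftModuleHomomorphism
  (LeftModule.rawLeftModule (𝒫 n)) (LeftModule.rawLeftModule (H n (n ∸ 2))) (f n)
f-isHomomorphism n = Free.LinearExtension.extend-isHomomorphism (CyclicOrdering n) (H n (n ∸ 2)) cellForm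
  (λ {c} {c′} → cellForm-cong {n} {c} {c′})

ker-f : ∀ n → Pred (LeftModule.Carrierᴹ (𝒫 n)) 0ℓ
ker-f n x = LeftModule._≈ᴹ_ (H n (n ∸ 2)) (f n x) (LeftModule.0ᴹ (H n (n ∸ 2)))

{-# OPTIONS --safe #-}

-- Eliminate t = t_1.  Partial fractions over 𝒪 m show that the class of a top
-- form on 𝔐_{0,m+4} is determined by its residues along t = p, for p the m + 2
-- other finite points, and these residues are well defined on cohomology.
-- Residues exist because 𝒪 (suc m) acts on Laurent series at t = p.  If w is a
-- word beginning with the point 0, then the cell form of w divided by t - p is
-- the sum of the cell forms of the words obtained by inserting t somewhere after
-- p.  By induction on m, the cell forms of the words beginning with 0 are thus a
-- basis of top cohomology, and each linear map on it is given freely by its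
-- values on them.  Finally cell forms satisfy the shuffle relations already as
-- functions, and modulo shuffles every word is a combination of words beginning
-- with a given letter.
module Submission where

open import Defs
open import Algebra.Bundles using (CommutativeRing; CommutativeMonoid; Semiring)
import Algebra.Definitions.RawSemiring as RawSemiringDefinitions
open import Algebra.Module.Bundles using (module LeftModule)
import Algebra.Properties.CommutativeMonoid.Sum as CommutativeMonoidSum
import Algebra.Properties.CommutativeSemigroup as CommutativeSemigroupProperties
import Algebra.Properties.Group as GroupProperties
import Algebra.Properties.Ring as RingProperties
import Algebra.Solver.Ring as RingSolver
open import Algebra.Solver.Ring.AlmostCommutativeRing using (_-Raw-AlmostCommutative⟶_; fromCommutativeRing)
open import Data.Bool.Base using (true; false; if_then_else_)
open import Data.Bool.Properties using () renaming (_≟_ to _≟ᵇ_)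
open import Data.Empty using (⊥-elim-irr)
open import Data.Fin.Base as Fin using (Fin; zero; suc; punchIn; inject₁)
open import Data.Fin.Properties using (punchInᵢ≢i) renaming (_≟_ to _≟ᶠ_)
open import Data.Fin.Relation.Unary.Top using (view-fromℕ; view-inject₁)
open import Data.Fin.Subset using (Subset; ⊤; ⁅_⁆; _-_; ∣_∣) renaming (_∈_ to _∈ˢ_)
open import Data.Fin.Subset.Properties using (∈⊤; ∣⊤∣≡n; ∣p∣≤n; ∣p∣≡n⇒p≡⊤; p─⊥≡p; p─q─q≡p─q; x∈p⇒∣p-x∣<∣p∣; x∈p∧x≢y⇒x∈p-y)
open import Data.Integer.Base using (ℤ; +_; -[1+_])
open import Data.List.Base using (List; []; _∷_; _++_; map; allFin; tabulate; length)
open import Data.List.Membership.Propositional using (_∈_; mapWith∈)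
open import Data.List.Membership.Propositional.Properties using (∈-∃++; ∈-map⁺; ∈-map⁻; ∈-allFin; ∈-++⁺ˡ; ∈-++⁺ʳ)
import Data.List.Membership.DecPropositional as DecMembership
import Data.List.Properties as List
open import Data.List.Relation.Binary.Permutation.Propositional using (_↭_; ↭-refl; ↭-sym; ↭-trans; ↭-reflexive; prep; swap; ↭⇒↭ₛ)
open import Data.List.Relation.Binary.Permutation.Propositional.Properties using (∈-resp-↭; shift; drop-∷; ¬x∷xs↭[]; ↭-map-inv; ↭-singleton-inv) renaming (map⁺ to ↭-map⁺)
import Data.List.Relation.Binary.Permutation.Setoid.Properties as ↭ₛ
open import Data.List.Relation.Unary.All as All using ([]; _∷_)
open import Data.List.Relation.Unary.AllPairs using ([]; _∷_)
open import Data.List.Relation.Unary.Any using (here; there)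
open import Data.List.Relation.Unary.Linked using (Linked; []; [-]; _∷_)
open import Data.List.Relation.Unary.Unique.Propositional using (Unique)
open import Data.List.Relation.Unary.Unique.Propositional.Properties using (allFin⁺) renaming (map⁺ to Unique-map⁺)
import Data.Maybe.Base as Maybe
open import Data.Nat.Base as ℕ using (ℕ; zero; suc; _≤_; _<_; _≥_; _∸_; z≤n; s≤s)
import Data.Nat.Properties as ℕ
open import Data.Product.Base using (_×_; _,_; proj₁; proj₂; ∃; ∃₂)
open import Data.Rational.Base as ℚ using (ℚ; 0ℚ; 1ℚ)
import Data.Rational.Properties as ℚ
open import Data.Vec.Base using (lookup)
open import Data.Vec.Properties using (lookup-replicate; lookup⇒[]=; ≡-dec)
open import Function.Base using (_∘_; id)
open import Function.Definitions using (Surjective)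
open import Level using (0ℓ)
open import Relation.Binary.Bundles using (Setoid)
open import Relation.Binary.Consequences using (dec⇒weaklyDec)
open import Relation.Binary.Definitions using (DecidableEquality)
open import Relation.Binary.PropositionalEquality using (_≡_; _≢_; refl; sym; trans; cong; cong₂; subst; module ≡-Reasoning) renaming (setoid to ≡-setoid)
import Relation.Binary.Reasoning.Setoid as SetoidReasoning
open import Relation.Nullary.Decidable using (Dec; yes; no; does; dec-true; dec-false)
open import Relation.Nullary.Negation using (¬_; contradiction)
open import Relation.Unary using (_≐_)

-- Both claims come from one map. Functionals may take values in any vector space, so the target can
-- be `𝒫 n` itself: interpolation there produces `Φ`, which sends the cell form of a word beginning
-- with 0 to that word. Then `f ∘ Φ` is the identity on top cohomology, which gives surjectivity,
-- and `Φ ∘ f` is the identity modulo `I n`, so that an element killed by `f` lies in `I n`. The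
-- obstacle is that `𝒪 m` is given by generators and relations, without a normal form. A partial
-- fraction expansion therefore defines nothing by itself, and a residue has to be defined on
-- expressions and checked on every relation. Operators on Laurent series make this possible: 1 / (t
-- - q) becomes the inverse of some ε - c, and is unique because ε - c is injective. Expansions
-- serve only to verify identities between maps already known to be well defined.

-- Reciprocals of differences of marked points.

module 𝒪-Ring (m : ℕ) where

  open CommutativeRing (𝒪-commutativeRing m) public
    using (ring; semiring; setoid; +-congʳ; +-congˡ; *-congʳ; *-congˡ; reflexive; zeroˡ; zeroʳ; +-identityʳ; *-identityʳ;
           -‿inverseʳ; distribʳ; +-commutativeMonoid)
  open RingProperties ring public using (+-inverseˡ-unique; -0#≈0#)
  open RawSemiringDefinitions (Semiring.rawSemiring semiring) public using (_^_)
  open SetoidReasoning setoid public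

  0𝒪 1𝒪 : 𝒪 m
  0𝒪 = const 0ℚ
  1𝒪 = const 1ℚ

  const-- : ∀ q → const (ℚ.- q) ≈ - const q
  const-- q = +-inverseˡ-unique _ _
    (≈-trans (≈-sym (const-+ _ _)) (reflexive (cong const (ℚ.+-inverseˡ q))))

  const-homomorphism : ℚ.+-*-rawRing -Raw-AlmostCommutative⟶ fromCommutativeRing (𝒪-commutativeRing m)
  const-homomorphism = record
    { ⟦_⟧ = const
    ; +-homo = const-+
    ; *-homo = const-*
    ; -‿homo = const--
    ; 0-homo = ≈-refl
    ; 1-homo = ≈-refl
    }

  open RingSolver ℚ.+-*-rawRing (fromCommutativeRing (𝒪-commutativeRing m)) const-homomorphism
    (λ p q → Maybe.map (λ e → reflexive (cong const e)) (dec⇒weaklyDec ℚ._≟_ p q)) public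
    using (solve; con; _:+_; _:*_; :-_; _:=_)

_≟ᴾ_ : ∀ {m} → DecidableEquality (Point m)
𝟎 ≟ᴾ 𝟎   = yes refl
𝟎 ≟ᴾ 𝟏   = no λ ()
𝟎 ≟ᴾ 𝒕 j = no λ ()
𝟏 ≟ᴾ 𝟎   = no λ ()
𝟏 ≟ᴾ 𝟏   = yes refl
𝟏 ≟ᴾ 𝒕 j = no λ ()
𝒕 i ≟ᴾ 𝟎   = no λ ()
𝒕 i ≟ᴾ 𝟏   = no λ ()
𝒕 i ≟ᴾ 𝒕 j with i ≟ᶠ j
... | yes refl = yes refl
... | no i≢j   = no λ { refl → i≢j refl }

-- 1 / (q - p), and the junk value 0 when p = q.
recip : ∀ {m} → Point m → Point m → 𝒪 m
recip p q with p ≟ᴾ q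
... | yes _  = const 0ℚ
... | no p≢q = inv p q p≢q

recip-≢ : ∀ {m} {p q : Point m} .(p≢q : p ≢ q) → recip p q ≡ inv p q p≢q
recip-≢ {p = p} {q} p≢q with p ≟ᴾ q
... | yes e = ⊥-elim-irr (p≢q e)
... | no _  = refl

recip-inverse : ∀ {m} {p q : Point m} → p ≢ q → (val q + - val p) * recip p q ≈ const 1ℚ
recip-inverse {m} {p} {q} p≢q = ≈-trans (*-congˡ (reflexive (recip-≢ p≢q))) (inv-inverse p q p≢q)
  where open 𝒪-Ring m

recip-refl : ∀ {m} (p : Point m) → recip p p ≡ const 0ℚ
recip-refl p with p ≟ᴾ p
... | yes _  = refl
... | no p≢p = contradiction refl p≢p

-- At `p ≡ q` both sides are the junk value 0; otherwise both are inverse to `val p + - val q`.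
recip-antisym : ∀ {m} (p q : Point m) → recip q p ≈ - recip p q
recip-antisym {m} p q = go (p ≟ᴾ q)
  where
  open 𝒪-Ring m
  go : Dec (p ≡ q) → recip q p ≈ - recip p q
  go (yes refl) rewrite recip-refl p = ≈-sym -0#≈0#
  go (no p≢q)   = begin
    y                                ≈⟨ *-identityʳ y ⟨
    y * 1𝒪                           ≈⟨ *-congˡ (recip-inverse p≢q) ⟨
    y * ((val q + - val p) * x)
      ≈⟨ solve 4 (λ a b x y → y :* ((b :+ :- a) :* x) := :- ((a :+ :- b) :* y :* x)) ≈-refl (val p) (val q) x y ⟩
    - ((val p + - val q) * y * x)    ≈⟨ -‿cong (≈-trans (*-congʳ (recip-inverse (p≢q ∘ sym))) (*-identityˡ x)) ⟩
    - x                              ∎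
    where
    x y : 𝒪 m
    x = recip p q
    y = recip q p

-- 1 / ((q - p) (r - p)) = 1 / ((q - p) (r - q)) + 1 / ((r - p) (q - r)).
recip-shuffle : ∀ {m} {p q r : Point m} → p ≢ q → p ≢ r → q ≢ r →
                recip p q * recip p r ≈ recip p q * recip q r + recip p r * recip r q
recip-shuffle {m} {p} {q} {r} p≢q p≢r q≢r = begin
  x * y                                         ≈⟨ *-identityʳ _ ⟨
  x * y * 1𝒪                                    ≈⟨ *-congˡ (recip-inverse q≢r) ⟨
  x * y * ((val r + - val q) * z)
    ≈⟨ solve 6 (λ p q r x y z → x :* y :* ((r :+ :- q) :* z) := x :* z :* ((r :+ :- p) :* y) :+ :- (y :* z :* ((q :+ :- p) :* x)))
         ≈-refl (val p) (val q) (val r) x y z ⟩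
  x * z * ((val r + - val p) * y) + - (y * z * ((val q + - val p) * x))
    ≈⟨ +-cong (*-congˡ (recip-inverse p≢r)) (-‿cong (*-congˡ (recip-inverse p≢q))) ⟩
  x * z * 1𝒪 + - (y * z * 1𝒪)
    ≈⟨ solve 3 (λ x y z → x :* z :* con 1ℚ :+ :- (y :* z :* con 1ℚ) := x :* z :+ y :* (:- z)) ≈-refl x y z ⟩
  x * z + y * (- z)                             ≈⟨ +-congˡ (*-congˡ (recip-antisym q r)) ⟨
  x * z + y * recip r q                         ∎
  where
  open 𝒪-Ring m
  x y z : 𝒪 m
  x = recip p q
  y = recip p r
  z = recip q r

-- The points of 𝔐_{0,m+4} other than the eliminated 𝒕 zero.
↑ : ∀ {m} → Point m → Point (suc m)
↑ 𝟎     = 𝟎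
↑ 𝟏     = 𝟏
↑ (𝒕 i) = 𝒕 (suc i)

data OldOrNew {m : ℕ} : Point (suc m) → Set where
  old : (p : Point m) → OldOrNew (↑ p)
  new : OldOrNew (𝒕 zero)

oldOrNew : ∀ {m} (p : Point (suc m)) → OldOrNew p
oldOrNew 𝟎           = old 𝟎
oldOrNew 𝟏           = old 𝟏
oldOrNew (𝒕 zero)    = new
oldOrNew (𝒕 (suc i)) = old (𝒕 i)

oldOrNew-↑ : ∀ {m} (p : Point m) → oldOrNew (↑ p) ≡ old p
oldOrNew-↑ 𝟎     = refl
oldOrNew-↑ 𝟏     = refl
oldOrNew-↑ (𝒕 i) = refl

-- Laurent series and division by ε - c.

-- Laurent series Σ_i (coeff i) ε^i with finite principal part, where ε = t - p.
module LaurentSeries (m : ℕ) where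

  open 𝒪-Ring m

  record Laurent : Set where
    no-eta-equality
    field
      coeff  : ℤ → 𝒪 m
      order  : ℕ
      vanish : ∀ {k} → order ≤ k → coeff -[1+ k ] ≈ 0𝒪

  open Laurent public

  infix 4 _≃_

  -- A record rather than a function type, so that the two series can be inferred from a proof.
  record _≃_ (u v : Laurent) : Set where
    constructor coeffwise
    field _at_ : ∀ i → coeff u i ≈ coeff v i
  open _≃_ public

  ≃-setoid : Setoid 0ℓ 0ℓ
  ≃-setoid = record
    { Carrier = Laurent
    ; _≈_ = _≃_
    ; isEquivalence = record
      { refl  = coeffwise λ _ → ≈-refl
      ; sym   = λ e → coeffwise λ i → ≈-sym (e at i)
      ; trans = λ e e′ → coeffwise λ i → ≈-trans (e at i) (e′ at i)
      }
    }

  open Setoid ≃-setoid public using () renaming (refl to ≃-refl; sym to ≃-sym; trans to ≃-trans)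

  infixl 6 _⊞_
  infixr 7 _•_

  _⊞_ : Laurent → Laurent → Laurent
  coeff  (u ⊞ v) i  = coeff u i + coeff v i
  order  (u ⊞ v)    = order u ℕ.⊔ order v
  vanish (u ⊞ v) k≥ = ≈-trans
    (+-cong (vanish u (ℕ.m⊔n≤o⇒m≤o (order u) (order v) k≥)) (vanish v (ℕ.m⊔n≤o⇒n≤o (order u) (order v) k≥)))
    (+-identityˡ _)

  _•_ : 𝒪 m → Laurent → Laurent
  coeff  (a • u) i  = a * coeff u i
  order  (a • u)    = order u
  vanish (a • u) k≥ = ≈-trans (*-congˡ (vanish u k≥)) (zeroʳ a)

  prev next : ℤ → ℤ
  prev (+ zero)     = -[1+ 0 ]
  prev (+ suc k)    = + k
  prev -[1+ k ]     = -[1+ suc k ]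
  next (+ k)        = + suc k
  next -[1+ zero ]  = + 0
  next -[1+ suc k ] = -[1+ k ]

  prev-next : ∀ i → prev (next i) ≡ i
  prev-next (+ k)        = refl
  prev-next -[1+ zero ]  = refl
  prev-next -[1+ suc k ] = refl

  ε· ε⁻¹· : Laurent → Laurent
  coeff  (ε· u) i  = coeff u (prev i)
  order  (ε· u)    = order u
  vanish (ε· u) k≥ = vanish u (ℕ.m≤n⇒m≤1+n k≥)
  coeff  (ε⁻¹· u) i        = coeff u (next i)
  order  (ε⁻¹· u)          = suc (order u)
  vanish (ε⁻¹· u) (s≤s k≥) = vanish u k≥

  1ᴸ : Laurent
  coeff  1ᴸ (+ zero)  = 1𝒪
  coeff  1ᴸ (+ suc _) = 0𝒪
  coeff  1ᴸ -[1+ _ ]  = 0𝒪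
  order  1ᴸ           = 0
  vanish 1ᴸ _         = ≈-refl

  ⊞-cong : ∀ {u u′ v v′} → u ≃ u′ → v ≃ v′ → u ⊞ v ≃ u′ ⊞ v′
  ⊞-cong e e′ = coeffwise λ i → +-cong (e at i) (e′ at i)

  •-cong : ∀ {a b u v} → a ≈ b → u ≃ v → a • u ≃ b • v
  •-cong e e′ = coeffwise λ i → *-cong e (e′ at i)

  ε-cong : ∀ {u v} → u ≃ v → ε· u ≃ ε· v
  ε-cong e = coeffwise λ i → e at prev i

  -- Linearity over polynomials in ε. Such maps commute with ε - c, hence with its inverse; this is
  -- the source of commutativity for the action of `𝒪 (suc m)`.
  record Linear (φ : Laurent → Laurent) : Set where
    field
      ≃-cong : ∀ {u v} → u ≃ v → φ u ≃ φ v
      ⊞-homo : ∀ u v → φ (u ⊞ v) ≃ φ u ⊞ φ v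
      •-homo : ∀ a u → φ (a • u) ≃ a • φ u
      ε-homo : ∀ u → φ (ε· u) ≃ ε· (φ u)

  open Linear public

  •-linear : ∀ a → Linear (a •_)
  •-linear a = record
    { ≃-cong = •-cong ≈-refl
    ; ⊞-homo = λ u v → coeffwise λ i → distribˡ a _ _
    ; •-homo = λ b u → coeffwise λ i →
        solve 3 (λ a b x → a :* (b :* x) := b :* (a :* x)) ≈-refl a b (coeff u i)
    ; ε-homo = λ u → coeffwise λ _ → ≈-refl
    }

  ε-linear : Linear ε·
  ε-linear = record
    { ≃-cong = ε-cong
    ; ⊞-homo = λ u v → coeffwise λ _ → ≈-refl
    ; •-homo = λ b u → coeffwise λ _ → ≈-refl
    ; ε-homo = λ u → coeffwise λ _ → ≈-refl
    }

  ⊞-linear : ∀ {φ ψ} → Linear φ → Linear ψ → Linear (λ u → φ u ⊞ ψ u)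
  ⊞-linear {φ} {ψ} P Q = record
    { ≃-cong = λ e → ⊞-cong (≃-cong P e) (≃-cong Q e)
    ; ⊞-homo = λ u v → ≃-trans (⊞-cong (⊞-homo P u v) (⊞-homo Q u v)) (coeffwise λ i →
        solve 4 (λ a b c d → (a :+ b) :+ (c :+ d) := (a :+ c) :+ (b :+ d)) ≈-refl
          (coeff (φ u) i) (coeff (φ v) i) (coeff (ψ u) i) (coeff (ψ v) i))
    ; •-homo = λ a u → ≃-trans (⊞-cong (•-homo P a u) (•-homo Q a u)) (coeffwise λ i → ≈-sym (distribˡ a _ _))
    ; ε-homo = λ u → coeffwise λ i → +-cong (ε-homo P u at i) (ε-homo Q u at i)
    }

  ∘-linear : ∀ {φ ψ} → Linear φ → Linear ψ → Linear (φ ∘ ψ)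
  ∘-linear P Q = record
    { ≃-cong = λ e → ≃-cong P (≃-cong Q e)
    ; ⊞-homo = λ u v → ≃-trans (≃-cong P (⊞-homo Q u v)) (⊞-homo P _ _)
    ; •-homo = λ a u → ≃-trans (≃-cong P (•-homo Q a u)) (•-homo P a _)
    ; ε-homo = λ u → ≃-trans (≃-cong P (ε-homo Q u)) (ε-homo P _)
    }

  ε-[_]· : 𝒪 m → Laurent → Laurent
  ε-[ c ]· u = ε· u ⊞ (- c) • u

  ε-[_]-linear : ∀ c → Linear (ε-[ c ]·)
  ε-[ c ]-linear = ⊞-linear ε-linear (•-linear (- c))

  Linear-commutes-ε- : ∀ {φ} → Linear φ → ∀ c u → φ (ε-[ c ]· u) ≃ ε-[ c ]· (φ u)
  Linear-commutes-ε- P c u = ≃-trans (⊞-homo P _ _) (⊞-cong (ε-homo P u) (•-homo P (- c) u))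

  -- With injectivity of ε - c as a field, linearity and commutation of `apply` follow by cancelling
  -- ε - c, however `apply` was constructed.
  record Inverse (c : 𝒪 m) : Set where
    field
      apply     : Laurent → Laurent
      inverseʳ  : ∀ u → ε-[ c ]· (apply u) ≃ u
      injective : ∀ {u v} → ε-[ c ]· u ≃ ε-[ c ]· v → u ≃ v

    commutes : ∀ {φ} → Linear φ → ∀ u → φ (apply u) ≃ apply (φ u)
    commutes P u = injective (≃-trans (≃-sym (Linear-commutes-ε- P c _))
      (≃-trans (≃-cong P (inverseʳ u)) (≃-sym (inverseʳ _))))

    linear : Linear apply
    linear = record
      { ≃-cong = λ {u} {v} e → injective (≃-trans (inverseʳ u) (≃-trans e (≃-sym (inverseʳ v))))
      ; ⊞-homo = λ u v → injective (≃-trans (inverseʳ _) (≃-sym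
          (≃-trans (⊞-homo ε-[ c ]-linear _ _) (⊞-cong (inverseʳ u) (inverseʳ v)))))
      ; •-homo = λ a u → injective (≃-trans (inverseʳ _) (≃-sym
          (≃-trans (•-homo ε-[ c ]-linear a _) (•-cong ≈-refl (inverseʳ u)))))
      ; ε-homo = λ u → ≃-sym (commutes ε-linear u)
      }

  injective-from-kernel : ∀ c → (∀ u → (∀ i → coeff u (prev i) ≈ c * coeff u i) → ∀ i → coeff u i ≈ 0𝒪) →
                          ∀ {u v} → ε-[ c ]· u ≃ ε-[ c ]· v → u ≃ v
  injective-from-kernel c kernel {u} {v} e = coeffwise λ i → begin
    coeff u i                                      ≈⟨ solve 2 (λ x y → x := (x :+ (:- con 1ℚ) :* y) :+ y) ≈-refl (coeff u i) (coeff v i) ⟩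
    (coeff u i + (- 1𝒪) * coeff v i) + coeff v i   ≈⟨ +-congʳ (kernel (u ⊞ (- 1𝒪) • v) difference i) ⟩
    0𝒪 + coeff v i                                 ≈⟨ +-identityˡ _ ⟩
    coeff v i                                      ∎
    where
    difference : ∀ i → coeff u (prev i) + (- 1𝒪) * coeff v (prev i) ≈ c * (coeff u i + (- 1𝒪) * coeff v i)
    difference i = begin
      coeff u (prev i) + (- 1𝒪) * coeff v (prev i)
        ≈⟨ solve 4 (λ c x x′ y → x′ :+ (:- con 1ℚ) :* y := (x′ :+ (:- c) :* x) :+ c :* x :+ :- y) ≈-refl
             c (coeff u i) (coeff u (prev i)) (coeff v (prev i)) ⟩
      (coeff u (prev i) + (- c) * coeff u i) + c * coeff u i + - coeff v (prev i)
        ≈⟨ +-congʳ (+-congʳ (e at i)) ⟩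
      (coeff v (prev i) + (- c) * coeff v i) + c * coeff u i + - coeff v (prev i)
        ≈⟨ solve 4 (λ c x y y′ → (y′ :+ (:- c) :* y) :+ c :* x :+ :- y′ := c :* (x :+ (:- con 1ℚ) :* y)) ≈-refl
             c (coeff u i) (coeff v i) (coeff v (prev i)) ⟩
      c * (coeff u i + (- 1𝒪) * coeff v i)  ∎

  inverse-of-ε : ∀ {c} → c ≈ 0𝒪 → Inverse c
  inverse-of-ε {c} c≈0 = record
    { apply     = ε⁻¹·
    ; inverseʳ  = λ u → coeffwise λ i → begin
        coeff u (next (prev i)) + (- c) * coeff u (next i)
          ≈⟨ +-cong (reflexive (cong (coeff u) (next-prev i))) (*-congʳ (≈-trans (-‿cong c≈0) -0#≈0#)) ⟩
        coeff u i + 0𝒪 * coeff u (next i)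
          ≈⟨ solve 2 (λ x y → x :+ con 0ℚ :* y := x) ≈-refl (coeff u i) (coeff u (next i)) ⟩
        coeff u i ∎
    ; injective = injective-from-kernel c λ u h i → begin
        coeff u i                   ≈⟨ reflexive (cong (coeff u) (prev-next i)) ⟨
        coeff u (prev (next i))     ≈⟨ h (next i) ⟩
        c * coeff u (next i)        ≈⟨ ≈-trans (*-congʳ c≈0) (zeroˡ _) ⟩
        0𝒪                          ∎
    }
    where
    next-prev : ∀ i → next (prev i) ≡ i
    next-prev (+ zero)  = refl
    next-prev (+ suc k) = refl
    next-prev -[1+ k ]  = refl

  Regular : Laurent → Set
  Regular u = ∀ k → coeff u -[1+ k ] ≈ 0𝒪

  unit-cancel : ∀ {c c⁻¹ x} → c * c⁻¹ ≈ 1𝒪 → c * x ≈ 0𝒪 → x ≈ 0𝒪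
  unit-cancel {c} {c⁻¹} {x} c·c⁻¹≈1 e = begin
    x               ≈⟨ *-identityˡ x ⟨
    1𝒪 * x          ≈⟨ *-congʳ c·c⁻¹≈1 ⟨
    c * c⁻¹ * x     ≈⟨ solve 3 (λ c d x → c :* d :* x := d :* (c :* x)) ≈-refl c c⁻¹ x ⟩
    c⁻¹ * (c * x)   ≈⟨ ≈-trans (*-congˡ e) (zeroʳ c⁻¹) ⟩
    0𝒪              ∎

  -- Far enough out the coefficients are 0 by `vanish`, and cancelling the unit `c` carries this
  -- back towards ε⁻¹ step by step. The finite principal part is essential: the infinite series of
  -- all c^k ε^(-k-1) satisfies the same relation.
  geometric⇒regular : ∀ {c c⁻¹} → c * c⁻¹ ≈ 1𝒪 → ∀ u →
                      (∀ k → coeff u -[1+ suc k ] ≈ c * coeff u -[1+ k ]) → Regular u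
  geometric⇒regular c·c⁻¹≈1 u h k = descend (order u) (ℕ.m≤m+n (order u) k)
    where
    descend : ∀ {k} j → order u ≤ j ℕ.+ k → coeff u -[1+ k ] ≈ 0𝒪
    descend     zero    k≥ = vanish u k≥
    descend {k} (suc j) k≥ = unit-cancel c·c⁻¹≈1 (≈-trans (≈-sym (h k))
      (descend j (subst (order u ≤_) (sym (ℕ.+-suc j k)) k≥)))

  -- The coefficients b of u / (ε - c) are determined, from the lowest one
  -- upwards, by b_{i-1} - c b_i = u_i.
  inverse-of-unit : ∀ {c} c⁻¹ → c * c⁻¹ ≈ 1𝒪 → Inverse c
  inverse-of-unit {c} c⁻¹ c·c⁻¹≈1 = record
    { apply     = λ u → record
        { coeff  = b u
        ; order  = order u
        ; vanish = λ {k} k≥ → reflexive (cong (λ j → polar u j k) (ℕ.m≤n⇒m∸n≡0 k≥))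
        }
    ; inverseʳ  = λ u → coeffwise (recurrence u)
    ; injective = injective-from-kernel c kernel
    }
    where
    -- The second argument is `order u ∸ k`, the number of recursion steps from exponent -(k+1) down
    -- to where the series has become zero.
    polar : Laurent → ℕ → ℕ → 𝒪 m
    polar u zero    k = 0𝒪
    polar u (suc j) k = (polar u j (suc k) + - coeff u -[1+ k ]) * c⁻¹

    b : Laurent → ℤ → 𝒪 m
    b u -[1+ k ]    = polar u (order u ∸ k) k
    b u (+ zero)    = (b u -[1+ 0 ] + - coeff u (+ 0)) * c⁻¹
    b u (+ (suc k)) = (b u (+ k) + - coeff u (+ suc k)) * c⁻¹

    step : ∀ x y → x + (- c) * ((x + - y) * c⁻¹) ≈ y
    step x y = begin
      x + (- c) * ((x + - y) * c⁻¹)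
        ≈⟨ solve 4 (λ x y c d → x :+ (:- c) :* ((x :+ :- y) :* d) := x :+ (:- (c :* d)) :* (x :+ :- y)) ≈-refl x y c c⁻¹ ⟩
      x + (- (c * c⁻¹)) * (x + - y)   ≈⟨ +-congˡ (*-congʳ (-‿cong c·c⁻¹≈1)) ⟩
      x + (- 1𝒪) * (x + - y)          ≈⟨ solve 2 (λ x y → x :+ (:- con 1ℚ) :* (x :+ :- y) := y) ≈-refl x y ⟩
      y                               ∎

    recurrence : ∀ u i → b u (prev i) + (- c) * b u i ≈ coeff u i
    recurrence u (+ zero)  = step _ _
    recurrence u (+ suc k) = step _ _
    -- The rewriting turns `order u ∸ suc k` into the predecessor of `order u ∸ k`, so that a single
    -- case distinction computes both neighbouring coefficients.
    recurrence u -[1+ k ] rewrite sym (ℕ.pred[m∸n]≡m∸[1+n] (order u) k) with order u ∸ k in eq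
    ... | suc j = step _ _
    ... | zero  = begin
      0𝒪 + (- c) * 0𝒪    ≈⟨ solve 1 (λ c → con 0ℚ :+ (:- c) :* con 0ℚ := con 0ℚ) ≈-refl c ⟩
      0𝒪                 ≈⟨ vanish u (ℕ.m∸n≡0⇒m≤n eq) ⟨
      coeff u -[1+ k ]   ∎

    kernel : ∀ u → (∀ i → coeff u (prev i) ≈ c * coeff u i) → ∀ i → coeff u i ≈ 0𝒪
    kernel u h -[1+ k ]    = geometric⇒regular c·c⁻¹≈1 u (λ k → h -[1+ k ]) k
    kernel u h (+ zero)    = unit-cancel c·c⁻¹≈1 (≈-trans (≈-sym (h (+ 0))) (kernel u h -[1+ 0 ]))
    kernel u h (+ (suc k)) = unit-cancel c·c⁻¹≈1 (≈-trans (≈-sym (h (+ suc k))) (kernel u h (+ k)))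

-- The action of `𝒪 (suc m)` on Laurent series, and residues.

↑-injective : ∀ {m} {p q : Point m} → ↑ p ≡ ↑ q → p ≡ q
↑-injective {p = 𝟎}   {𝟎}    _    = refl
↑-injective {p = 𝟏}   {𝟏}    _    = refl
↑-injective {p = 𝒕 _} {𝒕 _}  refl = refl

ι : ∀ {m} → 𝒪 m → 𝒪 (suc m)
ι (const q)     = const q
ι (t i)         = t (suc i)
ι (x + y)       = ι x + ι y
ι (x * y)       = ι x * ι y
ι (- x)         = - ι x
ι (inv p q p≢q) = inv (↑ p) (↑ q) (p≢q ∘ ↑-injective)

ι-val : ∀ {m} (p : Point m) → ι (val p) ≡ val (↑ p)
ι-val 𝟎     = refl
ι-val 𝟏     = refl
ι-val (𝒕 i) = refl

ι-cong : ∀ {m} {x y : 𝒪 m} → x ≈ y → ι x ≈ ι y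
ι-cong ≈-refl            = ≈-refl
ι-cong (≈-sym e)         = ≈-sym (ι-cong e)
ι-cong (≈-trans e e′)    = ≈-trans (ι-cong e) (ι-cong e′)
ι-cong (+-cong e e′)     = +-cong (ι-cong e) (ι-cong e′)
ι-cong (*-cong e e′)     = *-cong (ι-cong e) (ι-cong e′)
ι-cong (-‿cong e)        = -‿cong (ι-cong e)
ι-cong (+-assoc x y z)   = +-assoc _ _ _
ι-cong (+-comm x y)      = +-comm _ _
ι-cong (+-identityˡ x)   = +-identityˡ _
ι-cong (-‿inverseˡ x)    = -‿inverseˡ _
ι-cong (*-assoc x y z)   = *-assoc _ _ _
ι-cong (*-comm x y)      = *-comm _ _
ι-cong (*-identityˡ x)   = *-identityˡ _
ι-cong (distribˡ x y z)  = distribˡ _ _ _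
ι-cong (const-+ q r)     = const-+ q r
ι-cong (const-* q r)     = const-* q r
ι-cong (inv-inverse p q p≢q) rewrite ι-val p | ι-val q = inv-inverse (↑ p) (↑ q) (p≢q ∘ ↑-injective)

-- 𝒪 (suc m) acts on Laurent series at t = p: it is generated over 𝒪 m by t
-- and the 1 / (t - q), and the inverses of commuting operators commute.
module Residue {m : ℕ} (p : Point m) where

  open 𝒪-Ring m
  open LaurentSeries m

  -- As ε = t - p, the factor t - q is ε - (q - p), where q - p is either 0 or a unit.
  inverse : (q : Point m) → Inverse (val q + - val p)
  inverse q with p ≟ᴾ q
  ... | yes refl = inverse-of-ε (-‿inverseʳ _)
  ... | no p≢q   = inverse-of-unit (recip p q) (recip-inverse p≢q)

  module 1/t- q = Inverse (inverse q)

  actInv : ∀ {a b : Point (suc m)} → OldOrNew a → OldOrNew b → Laurent → Laurent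
  actInv (old a) (old b) u = recip a b • u
  actInv (old a) new     u = 1/t-.apply a u
  -- This is 1 / (b - t), hence the sign.
  actInv new     (old b) u = (- 1𝒪) • 1/t-.apply b u
  -- A default for a pair that `inv` excludes; being linear, it keeps linearity and commutation true
  -- for all pairs.
  actInv new     new     u = u

  act : 𝒪 (suc m) → Laurent → Laurent
  act (const q)     u = const q • u
  act (t zero)      u = ε· u ⊞ val p • u
  act (t (suc i))   u = t i • u
  act (x + y)       u = act x u ⊞ act y u
  act (x * y)       u = act x (act y u)
  act (- x)         u = (- 1𝒪) • act x u
  act (inv a b _)   u = actInv (oldOrNew a) (oldOrNew b) u

  id-linear : Linear id
  id-linear = record { ≃-cong = id ; ⊞-homo = λ _ _ → ≃-refl ; •-homo = λ _ _ → ≃-refl ; ε-homo = λ _ → ≃-refl }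

  act-linear : ∀ x → Linear (act x)
  act-linear (const q)    = •-linear _
  act-linear (t zero)     = ⊞-linear ε-linear (•-linear _)
  act-linear (t (suc i))  = •-linear _
  act-linear (x + y)      = ⊞-linear (act-linear x) (act-linear y)
  act-linear (x * y)      = ∘-linear (act-linear x) (act-linear y)
  act-linear (- x)        = ∘-linear (•-linear _) (act-linear x)
  act-linear (inv a b _)  = go (oldOrNew a) (oldOrNew b)
    where
    go : ∀ {a b : Point (suc m)} (a? : OldOrNew a) (b? : OldOrNew b) → Linear (actInv a? b?)
    go (old a) (old b) = •-linear _
    go (old a) new     = 1/t-.linear a
    go new     (old b) = ∘-linear (•-linear _) (1/t-.linear b)
    go new     new     = id-linear

  -- Taken at `φ = act y`, this is what the relation `*-comm` demands of the action.
  act-commutes : ∀ {φ} → Linear φ → ∀ x u → φ (act x u) ≃ act x (φ u)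
  act-commutes P (const q)   u = •-homo P _ u
  act-commutes P (t zero)    u = ≃-trans (⊞-homo P _ _) (⊞-cong (ε-homo P u) (•-homo P _ u))
  act-commutes P (t (suc i)) u = •-homo P _ u
  act-commutes P (x + y)     u = ≃-trans (⊞-homo P _ _) (⊞-cong (act-commutes P x u) (act-commutes P y u))
  act-commutes P (x * y)     u = ≃-trans (act-commutes P x _) (≃-cong (act-linear x) (act-commutes P y u))
  act-commutes P (- x)       u = ≃-trans (•-homo P _ _) (•-cong ≈-refl (act-commutes P x u))
  act-commutes {φ} P (inv a b _) u = go (oldOrNew a) (oldOrNew b)
    where
    go : ∀ {a b : Point (suc m)} (a? : OldOrNew a) (b? : OldOrNew b) → φ (actInv a? b? u) ≃ actInv a? b? (φ u)
    go (old a) (old b) = •-homo P _ u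
    go (old a) new     = 1/t-.commutes a P u
    go new     (old b) = ≃-trans (•-homo P _ _) (•-cong ≈-refl (1/t-.commutes b P u))
    go new     new     = ≃-refl

  act-val-↑ : ∀ q u → act (val (↑ q)) u ≃ val q • u
  act-val-↑ 𝟎     u = ≃-refl
  act-val-↑ 𝟏     u = ≃-refl
  act-val-↑ (𝒕 i) u = ≃-refl

  act-t- : ∀ q u → act (t zero + - val (↑ q)) u ≃ ε-[ val q + - val p ]· u
  act-t- q u = coeffwise λ i → begin
    (coeff u (prev i) + val p * coeff u i) + (- 1𝒪) * coeff (act (val (↑ q)) u) i
      ≈⟨ +-congˡ (*-congˡ (act-val-↑ q u at i)) ⟩
    (coeff u (prev i) + val p * coeff u i) + (- 1𝒪) * (val q * coeff u i)
      ≈⟨ solve 4 (λ x y p q → (x :+ p :* y) :+ (:- con 1ℚ) :* (q :* y) := x :+ (:- (q :+ :- p)) :* y) ≈-refl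
           (coeff u (prev i)) (coeff u i) (val p) (val q) ⟩
    coeff u (prev i) + (- (val q + - val p)) * coeff u i ∎

  act-inv-inverse : ∀ {a b : Point (suc m)} (a? : OldOrNew a) (b? : OldOrNew b) → .(a ≢ b) → ∀ u →
                    act (val b + - val a) (actInv a? b? u) ≃ 1𝒪 • u
  act-inv-inverse (old a) (old b) a≢b u = coeffwise λ i → begin
    coeff (act (val (↑ b)) (recip a b • u)) i + (- 1𝒪) * coeff (act (val (↑ a)) (recip a b • u)) i
      ≈⟨ +-cong (act-val-↑ b _ at i) (*-congˡ (act-val-↑ a _ at i)) ⟩
    val b * (recip a b * coeff u i) + (- 1𝒪) * (val a * (recip a b * coeff u i))
      ≈⟨ solve 4 (λ a b r x → b :* (r :* x) :+ (:- con 1ℚ) :* (a :* (r :* x)) := (b :+ :- a) :* r :* x) ≈-refl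
           (val a) (val b) (recip a b) (coeff u i) ⟩
    (val b + - val a) * recip a b * coeff u i
      ≈⟨ *-congʳ (≈-trans (*-congˡ (reflexive (recip-≢ (λ e → a≢b (cong ↑ e))))) (inv-inverse a b _)) ⟩
    1𝒪 * coeff u i ∎
  act-inv-inverse (old a) new a≢b u = ≃-trans (act-t- a _)
    (≃-trans (1/t-.inverseʳ a u) (coeffwise λ i → ≈-sym (*-identityˡ _)))
  act-inv-inverse new (old b) a≢b u = coeffwise λ i → begin
    coeff (act (val (↑ b)) ((- 1𝒪) • v)) i + (- 1𝒪) * (coeff ((- 1𝒪) • v) (prev i) + val p * coeff ((- 1𝒪) • v) i)
      ≈⟨ +-congʳ (act-val-↑ b _ at i) ⟩
    val b * ((- 1𝒪) * coeff v i) + (- 1𝒪) * ((- 1𝒪) * coeff v (prev i) + val p * ((- 1𝒪) * coeff v i))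
      ≈⟨ solve 4 (λ x y p q → q :* ((:- con 1ℚ) :* y) :+ (:- con 1ℚ) :* ((:- con 1ℚ) :* x :+ p :* ((:- con 1ℚ) :* y))
                   := x :+ (:- (q :+ :- p)) :* y) ≈-refl
           (coeff v (prev i)) (coeff v i) (val p) (val b) ⟩
    coeff v (prev i) + (- (val b + - val p)) * coeff v i
      ≈⟨ 1/t-.inverseʳ b u at i ⟩
    coeff u i
      ≈⟨ *-identityˡ _ ⟨
    1𝒪 * coeff u i ∎
    where
    v = 1/t-.apply b u
  act-inv-inverse new new a≢b u = ⊥-elim-irr (a≢b refl)

  act-cong : ∀ {x y} → x ≈ y → ∀ u → act x u ≃ act y u
  act-cong ≈-refl               u = ≃-refl
  act-cong (≈-sym e)            u = ≃-sym (act-cong e u)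
  act-cong (≈-trans e e′)       u = ≃-trans (act-cong e u) (act-cong e′ u)
  act-cong (+-cong e e′)        u = ⊞-cong (act-cong e u) (act-cong e′ u)
  act-cong (*-cong {x} e e′)    u = ≃-trans (≃-cong (act-linear x) (act-cong e′ u)) (act-cong e _)
  act-cong (-‿cong e)           u = •-cong ≈-refl (act-cong e u)
  act-cong (+-assoc x y z)      u = coeffwise λ i → +-assoc _ _ _
  act-cong (+-comm x y)         u = coeffwise λ i → +-comm _ _
  act-cong (+-identityˡ x)      u = coeffwise λ i → ≈-trans (+-congʳ (zeroˡ _)) (+-identityˡ _)
  act-cong (-‿inverseˡ x)       u = coeffwise λ i →
    solve 2 (λ a b → (:- con 1ℚ) :* a :+ a := con 0ℚ :* b) ≈-refl (coeff (act x u) i) (coeff u i)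
  act-cong (*-assoc x y z)      u = ≃-refl
  act-cong (*-comm x y)         u = act-commutes (act-linear x) y u
  act-cong (*-identityˡ x)      u = coeffwise λ i → *-identityˡ _
  act-cong (distribˡ x y z)     u = ⊞-homo (act-linear x) _ _
  act-cong (const-+ q r)        u = coeffwise λ i → ≈-trans (*-congʳ (const-+ q r)) (distribʳ _ _ _)
  act-cong (const-* q r)        u = coeffwise λ i → ≈-trans (*-congʳ (const-* q r)) (*-assoc _ _ _)
  act-cong (inv-inverse a b ne) u = act-inv-inverse (oldOrNew a) (oldOrNew b) ne u

  -- Functions free of t act as scalars, which makes `residue` linear over `𝒪 m`.
  act-ι : ∀ a u → act (ι a) u ≃ a • u
  act-ι (const q)   u = ≃-refl
  act-ι (t i)       u = ≃-refl
  act-ι (x + y)     u = ≃-trans (⊞-cong (act-ι x u) (act-ι y u)) (coeffwise λ i → ≈-sym (distribʳ _ _ _))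
  act-ι (x * y)     u = ≃-trans (act-ι x _) (≃-trans (•-cong ≈-refl (act-ι y u)) (coeffwise λ i → ≈-sym (*-assoc _ _ _)))
  act-ι (- x)       u = ≃-trans (•-cong ≈-refl (act-ι x u)) (coeffwise λ i →
    solve 2 (λ a b → (:- con 1ℚ) :* (a :* b) := (:- a) :* b) ≈-refl x (coeff u i))
  act-ι (inv a b a≢b) u = go (oldOrNew-↑ a) (oldOrNew-↑ b)
    where
    go : ∀ {a? : OldOrNew (↑ a)} {b? : OldOrNew (↑ b)} → a? ≡ old a → b? ≡ old b → actInv a? b? u ≃ inv a b a≢b • u
    go refl refl = •-cong (reflexive (recip-≢ a≢b)) ≃-refl

  residue : 𝒪 (suc m) → 𝒪 m
  residue x = coeff (act x 1ᴸ) -[1+ 0 ]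

  residue-cong : ∀ {x y} → x ≈ y → residue x ≈ residue y
  residue-cong e = act-cong e 1ᴸ at -[1+ 0 ]

  residue-* : ∀ a x → residue (ι a * x) ≈ a * residue x
  residue-* a x = act-ι a _ at -[1+ 0 ]

-- Partial fractions in t over `𝒪 m`.

↑≢𝒕₀ : ∀ {m} (q : Point m) → ↑ q ≢ 𝒕 zero
↑≢𝒕₀ 𝟎     ()
↑≢𝒕₀ 𝟏     ()
↑≢𝒕₀ (𝒕 i) ()

-- 1 / (t - q).
pole : ∀ {m} → Point m → 𝒪 (suc m)
pole q = inv (↑ q) (𝒕 zero) (↑≢𝒕₀ q)

pole-recip : ∀ {m} (q : Point m) → recip (↑ q) (𝒕 zero) ≡ pole q
pole-recip q = recip-≢ (↑≢𝒕₀ q)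

ι-recip : ∀ {m} (p q : Point m) → ι (recip p q) ≡ recip (↑ p) (↑ q)
ι-recip p q = go (p ≟ᴾ q)
  where
  go : Dec (p ≡ q) → ι (recip p q) ≡ recip (↑ p) (↑ q)
  go (yes refl) = trans (cong ι (recip-refl p)) (sym (recip-refl (↑ p)))
  go (no p≢q)   = trans (cong ι (recip-≢ p≢q)) (sym (recip-≢ (p≢q ∘ ↑-injective)))

module PartialFractions (m : ℕ) where

  open 𝒪-Ring (suc m)

  pole-inverse : ∀ q → (t zero + - ι (val q)) * pole q ≈ 1𝒪
  pole-inverse q = ≈-trans (*-congʳ (+-congˡ (-‿cong (reflexive (ι-val q))))) (inv-inverse _ _ _)

  t*pole : ∀ q → t zero * pole q ≈ 1𝒪 + ι (val q) * pole q
  t*pole q = begin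
    t zero * pole q
      ≈⟨ solve 3 (λ t v x → t :* x := (t :+ :- v) :* x :+ v :* x) ≈-refl (t zero) (ι (val q)) (pole q) ⟩
    (t zero + - ι (val q)) * pole q + ι (val q) * pole q   ≈⟨ +-congʳ (pole-inverse q) ⟩
    1𝒪 + ι (val q) * pole q                                ∎

  pole*pole : ∀ {q r} → q ≢ r → pole q * pole r ≈ ι (recip q r) * (pole r + - pole q)
  pole*pole {q} {r} q≢r = begin
    pole q * pole r
      ≈⟨ *-cong (antisym q) (antisym r) ⟩
    - x * - y
      ≈⟨ solve 2 (λ x y → :- x :* :- y := x :* y) ≈-refl x y ⟩
    x * y
      ≈⟨ recip-shuffle (↑≢𝒕₀ q ∘ sym) (↑≢𝒕₀ r ∘ sym) (q≢r ∘ ↑-injective) ⟩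
    x * z + y * recip (↑ r) (↑ q)
      ≈⟨ +-congˡ (*-congˡ (recip-antisym (↑ q) (↑ r))) ⟩
    x * z + y * - z
      ≈⟨ solve 3 (λ x y z → x :* z :+ y :* :- z := z :* (:- y :+ :- (:- x))) ≈-refl x y z ⟩
    z * (- y + - - x)
      ≈⟨ *-cong (reflexive (ι-recip q r)) (+-cong (antisym r) (-‿cong (antisym q))) ⟨
    ι (recip q r) * (pole r + - pole q) ∎
    where
    x y z : 𝒪 (suc m)
    x = recip (𝒕 zero) (↑ q)
    y = recip (𝒕 zero) (↑ r)
    z = recip (↑ q) (↑ r)
    antisym : ∀ q → pole q ≈ - recip (𝒕 zero) (↑ q)
    antisym q = ≈-trans (reflexive (sym (pole-recip q))) (recip-antisym (𝒕 zero) (↑ q))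

  data PartialFraction : 𝒪 (suc m) → Set where
    polynomial : ∀ a k → PartialFraction (ι a * t zero ^ k)
    fraction   : ∀ a q k → PartialFraction (ι a * pole q ^ suc k)
    add        : ∀ {x y} → PartialFraction x → PartialFraction y → PartialFraction (x + y)
    resp       : ∀ {x y} → x ≈ y → PartialFraction x → PartialFraction y

  -- The stable elements form a subring containing all generators, hence everything; a partial
  -- fraction of `y` itself then results from multiplying `y` into 1.
  Stable : 𝒪 (suc m) → Set
  Stable y = ∀ {x} → PartialFraction x → PartialFraction (y * x)

  stable : ∀ {y} → (∀ a k → PartialFraction (y * (ι a * t zero ^ k))) →
           (∀ a q k → PartialFraction (y * (ι a * pole q ^ suc k))) → Stable y
  stable P F (polynomial a k) = P a k
  stable P F (fraction a q k) = F a q k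
  stable P F (add x x′)       = resp (≈-sym (distribˡ _ _ _)) (add (stable P F x) (stable P F x′))
  stable P F (resp e x)       = resp (*-congˡ e) (stable P F x)

  stable-resp : ∀ {y y′} → y ≈ y′ → Stable y → Stable y′
  stable-resp e S x = resp (*-congʳ e) (S x)

  stable-ι : ∀ b → Stable (ι b)
  stable-ι b = stable (λ a k → resp (*-assoc _ _ _) (polynomial (b * a) k))
                      (λ a q k → resp (*-assoc _ _ _) (fraction (b * a) q k))

  stable-* : ∀ {y z} → Stable y → Stable z → Stable (y * z)
  stable-* S S′ x = resp (≈-sym (*-assoc _ _ _)) (S (S′ x))

  stable-neg : ∀ {y} → Stable y → Stable (- y)
  stable-neg {y} S = stable-resp (solve 1 (λ y → :- con 1ℚ :* y := :- y) ≈-refl y) (stable-* (stable-ι (- const 1ℚ)) S)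

  pole-power : ∀ a q k → PartialFraction (ι a * pole q ^ k)
  pole-power a q zero    = polynomial a 0
  pole-power a q (suc k) = fraction a q k

  -- t / (t - q) = 1 + q / (t - q) trades the factor t for a lower pole order.
  stable-t : Stable (t zero)
  stable-t = stable
    (λ a k → resp (solve 3 (λ a t x → a :* (t :* x) := t :* (a :* x)) ≈-refl (ι a) (t zero) (t zero ^ k)) (polynomial a (suc k)))
    (λ a q k → resp (≈-sym (begin
      t zero * (ι a * (pole q * pole q ^ k))
        ≈⟨ solve 4 (λ t a d x → t :* (a :* (d :* x)) := a :* x :* (t :* d)) ≈-refl (t zero) (ι a) (pole q) (pole q ^ k) ⟩
      ι a * pole q ^ k * (t zero * pole q)
        ≈⟨ *-congˡ (t*pole q) ⟩
      ι a * pole q ^ k * (1𝒪 + ι (val q) * pole q)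
        ≈⟨ solve 4 (λ a x v d → a :* x :* (con 1ℚ :+ v :* d) := a :* x :+ (a :* v) :* (d :* x)) ≈-refl
             (ι a) (pole q ^ k) (ι (val q)) (pole q) ⟩
      ι a * pole q ^ k + (ι a * ι (val q)) * pole q ^ suc k ∎))
      (add (pole-power a q k) (fraction (a * val q) q k)))

  stable-pole : ∀ q → Stable (pole q)
  stable-pole q = stable polynomials fractions
    where
    base : ∀ a → PartialFraction (pole q * (ι a * 1𝒪))
    base a = resp (solve 2 (λ a d → a :* (d :* con 1ℚ) := d :* (a :* con 1ℚ)) ≈-refl (ι a) (pole q)) (fraction a q 0)

    polynomials : ∀ a k → PartialFraction (pole q * (ι a * t zero ^ k))
    polynomials a zero    = base a
    polynomials a (suc k) = resp (≈-sym (begin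
      pole q * (ι a * (t zero * x))
        ≈⟨ solve 4 (λ d a t x → d :* (a :* (t :* x)) := a :* x :* (t :* d)) ≈-refl (pole q) (ι a) (t zero) x ⟩
      ι a * x * (t zero * pole q)
        ≈⟨ *-congˡ (t*pole q) ⟩
      ι a * x * (1𝒪 + ι (val q) * pole q)
        ≈⟨ solve 4 (λ a x v d → a :* x :* (con 1ℚ :+ v :* d) := a :* x :+ v :* (d :* (a :* x))) ≈-refl
             (ι a) x (ι (val q)) (pole q) ⟩
      ι a * x + ι (val q) * (pole q * (ι a * x)) ∎))
      (add (polynomial a k) (stable-ι (val q) (polynomials a k)))
      where
      x : 𝒪 (suc m)
      x = t zero ^ k

    -- Each use of `pole*pole` splits off a pure power of `pole r`; in the other term `pole q`
    -- survives next to one factor `pole r` fewer.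
    distinct : ∀ {r} → q ≢ r → ∀ a k → PartialFraction (pole q * (ι a * pole r ^ k))
    distinct q≢r a zero        = base a
    distinct {r} q≢r a (suc k) = resp (≈-sym (begin
      pole q * (ι a * (pole r * x))
        ≈⟨ solve 4 (λ d a e x → d :* (a :* (e :* x)) := a :* x :* (d :* e)) ≈-refl (pole q) (ι a) (pole r) x ⟩
      ι a * x * (pole q * pole r)
        ≈⟨ *-congˡ (pole*pole q≢r) ⟩
      ι a * x * (w * (pole r + - pole q))
        ≈⟨ solve 5 (λ a x w d e → a :* x :* (w :* (e :+ :- d)) := w :* (a :* (e :* x)) :+ (:- w) :* (d :* (a :* x))) ≈-refl
             (ι a) x w (pole q) (pole r) ⟩
      w * (ι a * pole r ^ suc k) + - w * (pole q * (ι a * x)) ∎))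
      (add (stable-ι (recip q r) (fraction a r k)) (stable-ι (- recip q r) (distinct q≢r a k)))
      where
      x w : 𝒪 (suc m)
      x = pole r ^ k
      w = ι (recip q r)

    fractions : ∀ a r k → PartialFraction (pole q * (ι a * pole r ^ suc k))
    fractions a r k with q ≟ᴾ r
    ... | yes refl = resp (solve 3 (λ a d x → a :* (d :* x) := d :* (a :* x)) ≈-refl (ι a) (pole q) (pole q ^ suc k))
                       (fraction a q (suc k))
    ... | no q≢r   = distinct q≢r a (suc k)

  stable-inv : ∀ {p q} → OldOrNew p → OldOrNew q → .(p≢q : p ≢ q) → Stable (inv p q p≢q)
  stable-inv (old p) (old q) p≢q = stable-ι (inv p q (p≢q ∘ cong ↑))
  stable-inv (old p) new     p≢q = stable-pole p
  stable-inv new     (old q) p≢q = stable-resp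
    (≈-trans (-‿cong (reflexive (sym (pole-recip q))))
      (≈-trans (≈-sym (recip-antisym (↑ q) (𝒕 zero))) (reflexive (recip-≢ p≢q))))
    (stable-neg (stable-pole q))
  stable-inv new     new     p≢q = ⊥-elim-irr (p≢q refl)

  every-stable : ∀ y → Stable y
  every-stable (const q)     = stable-ι (const q)
  every-stable (t zero)      = stable-t
  every-stable (t (suc i))   = stable-ι (t i)
  every-stable (y + z)       = λ x → resp (≈-sym (distribʳ _ _ _)) (add (every-stable y x) (every-stable z x))
  every-stable (y * z)       = stable-* (every-stable y) (every-stable z)
  every-stable (- y)         = stable-neg (every-stable y)
  every-stable (inv p q p≢q) = stable-inv (oldOrNew p) (oldOrNew q) p≢q

  partialFraction : ∀ x → PartialFraction x
  partialFraction x = resp (≈-trans (*-congˡ (*-identityˡ _)) (*-identityʳ x)) (every-stable x (polynomial (const 1ℚ) 0))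

-- Derivatives and primitives of partial fractions.

∂-val-↑ : ∀ {m} (p : Point m) → ∂-val zero (↑ p) ≡ const 0ℚ
∂-val-↑ 𝟎     = refl
∂-val-↑ 𝟏     = refl
∂-val-↑ (𝒕 i) = refl

∂-ι-new : ∀ {m} (x : 𝒪 m) → ∂ zero (ι x) ≈ const 0ℚ
∂-ι-new {m} = go
  where
  open 𝒪-Ring (suc m)
  go : ∀ x → ∂ zero (ι x) ≈ 0𝒪
  go (const q)   = ≈-refl
  go (t i)       = ≈-refl
  go (x + y)     = ≈-trans (+-cong (go x) (go y)) (+-identityˡ _)
  go (x * y)     = ≈-trans (+-cong (*-congʳ (go x)) (*-congˡ (go y)))
    (solve 2 (λ x y → con 0ℚ :* y :+ x :* con 0ℚ := con 0ℚ) ≈-refl (ι x) (ι y))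
  go (- x)       = ≈-trans (-‿cong (go x)) -0#≈0#
  go (inv p q p≢q) rewrite ∂-val-↑ p | ∂-val-↑ q =
    solve 1 (λ x → :- ((con 0ℚ :+ :- con 0ℚ) :* (x :* x)) := con 0ℚ) ≈-refl (ι (inv p q p≢q))

∂-val-ι : ∀ {m} (i : Fin m) p → ∂-val (suc i) (↑ p) ≡ ι (∂-val i p)
∂-val-ι i 𝟎     = refl
∂-val-ι i 𝟏     = refl
∂-val-ι i (𝒕 j) with does (i ≟ᶠ j)
... | true  = refl
... | false = refl

∂-ι-old : ∀ {m} i (x : 𝒪 m) → ∂ (suc i) (ι x) ≡ ι (∂ i x)
∂-ι-old i (const q)   = refl
∂-ι-old i (t j)       = ∂-val-ι i (𝒕 j)
∂-ι-old i (x + y)     = cong₂ _+_ (∂-ι-old i x) (∂-ι-old i y)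
∂-ι-old i (x * y)     = cong₂ (λ u v → u * ι y + ι x * v) (∂-ι-old i x) (∂-ι-old i y)
∂-ι-old i (- x)       = cong -_ (∂-ι-old i x)
∂-ι-old i (inv p q p≢q) = cong₂ (λ u v → - ((u + - v) * (ι (inv p q p≢q) * ι (inv p q p≢q)))) (∂-val-ι i q) (∂-val-ι i p)

fromℕ : ℕ → ℚ
fromℕ zero    = 0ℚ
fromℕ (suc k) = 1ℚ ℚ.+ fromℕ k

fromℕ-nonNegative : ∀ k → ℚ.NonNegative (fromℕ k)
fromℕ-nonNegative zero    = _
fromℕ-nonNegative (suc k) = ℚ.nonNeg+nonNeg⇒nonNeg 1ℚ (fromℕ k) {{fromℕ-nonNegative k}}

-- Characteristic zero enters here: integrating t^k and 1 / (t - q)^(k+2) both divide by k + 1.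
fromℕ-suc-invertible : ∀ k → ∃ λ r → fromℕ (suc k) ℚ.* r ≡ 1ℚ
fromℕ-suc-invertible k = ℚ.1/ fromℕ (suc k) , ℚ.*-inverseʳ (fromℕ (suc k))
  where
  instance
    nonZero : ℚ.NonZero (fromℕ (suc k))
    nonZero = ℚ.pos⇒nonZero (fromℕ (suc k)) {{ℚ.pos+nonNeg⇒pos 1ℚ (fromℕ k) {{fromℕ-nonNegative k}}}}

module Derivatives (m : ℕ) where

  open 𝒪-Ring (suc m)

  -- Here `e` stands for the derivative of t - q: it is 1 for the variable t and minus the
  -- derivative of q for the others, so one computation serves both.
  ∂-pole-power : ∀ i {q e} → ∂ i (pole q) ≈ - (e * (pole q * pole q)) →
                 ∀ k → ∂ i (pole q ^ k) ≈ const (fromℕ k) * (- e) * pole q ^ suc k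
  ∂-pole-power i {q} {e} h zero    = solve 2 (λ e x → con 0ℚ := con 0ℚ :* (:- e) :* (x :* con 1ℚ)) ≈-refl e (pole q)
  ∂-pole-power i {q} {e} h (suc k) = begin
    ∂ i D * x + D * ∂ i x
      ≈⟨ +-cong (*-congʳ h) (*-congˡ (∂-pole-power i h k)) ⟩
    - (e * (D * D)) * x + D * (const (fromℕ k) * (- e) * (D * x))
      ≈⟨ solve 4 (λ e d x c → :- (e :* (d :* d)) :* x :+ d :* (c :* (:- e) :* (d :* x))
                   := (con 1ℚ :+ c) :* (:- e) :* (d :* (d :* x))) ≈-refl e D x (const (fromℕ k)) ⟩
    (1𝒪 + const (fromℕ k)) * (- e) * (D * (D * x))
      ≈⟨ *-congʳ (*-congʳ (const-+ 1ℚ (fromℕ k))) ⟨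
    const (fromℕ (suc k)) * (- e) * (D * (D * x)) ∎
    where
    D x : 𝒪 (suc m)
    D = pole q
    x = D ^ k

  ∂₀-pole-power : ∀ q k → ∂ zero (pole q ^ k) ≈ const (fromℕ k) * (- 1𝒪) * pole q ^ suc k
  ∂₀-pole-power q = ∂-pole-power zero (-‿cong (*-congʳ (begin
    1𝒪 + - ∂-val zero (↑ q)   ≈⟨ +-congˡ (-‿cong (reflexive (∂-val-↑ q))) ⟩
    1𝒪 + - 0𝒪                 ≈⟨ solve 0 (con 1ℚ :+ :- con 0ℚ := con 1ℚ) ≈-refl ⟩
    1𝒪                        ∎)))

  ∂ᵢ-pole-power : ∀ i q k → ∂ (suc i) (pole q ^ k) ≈ ι (const (fromℕ k) * ∂-val i q) * pole q ^ suc k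
  ∂ᵢ-pole-power i q k = ≈-trans (∂-pole-power (suc i) ≈-refl k) (*-congʳ (*-congˡ (begin
    - (0𝒪 + - ∂-val (suc i) (↑ q))
      ≈⟨ solve 1 (λ x → :- (con 0ℚ :+ :- x) := x) ≈-refl (∂-val (suc i) (↑ q)) ⟩
    ∂-val (suc i) (↑ q)              ≈⟨ reflexive (∂-val-ι i q) ⟩
    ι (∂-val i q)                    ∎)))

  ∂₀-t-power : ∀ k → ∂ zero (t zero ^ suc k) ≈ const (fromℕ (suc k)) * t zero ^ k
  ∂₀-t-power zero    = solve 1 (λ t → con 1ℚ :* con 1ℚ :+ t :* con 0ℚ := (con 1ℚ) :* con 1ℚ) ≈-refl (t zero)
  ∂₀-t-power (suc k) = begin
    1𝒪 * (t zero * x) + t zero * ∂ zero (t zero * x)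
      ≈⟨ +-congˡ (*-congˡ (∂₀-t-power k)) ⟩
    1𝒪 * (t zero * x) + t zero * (const (fromℕ (suc k)) * x)
      ≈⟨ solve 3 (λ t x c → con 1ℚ :* (t :* x) :+ t :* (c :* x) := (con 1ℚ :+ c) :* (t :* x)) ≈-refl
           (t zero) x (const (fromℕ (suc k))) ⟩
    (1𝒪 + const (fromℕ (suc k))) * (t zero * x)
      ≈⟨ *-congʳ (const-+ 1ℚ (fromℕ (suc k))) ⟨
    const (fromℕ (suc (suc k))) * (t zero * x) ∎
    where
    x : 𝒪 (suc m)
    x = t zero ^ k

  ∂ᵢ-t-power : ∀ i k → ∂ (suc i) (t zero ^ k) ≈ 0𝒪
  ∂ᵢ-t-power i zero    = ≈-refl
  ∂ᵢ-t-power i (suc k) = begin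
    0𝒪 * t zero ^ k + t zero * ∂ (suc i) (t zero ^ k)   ≈⟨ +-congˡ (*-congˡ (∂ᵢ-t-power i k)) ⟩
    0𝒪 * t zero ^ k + t zero * 0𝒪
      ≈⟨ solve 2 (λ t x → con 0ℚ :* x :+ t :* con 0ℚ := con 0ℚ) ≈-refl (t zero) (t zero ^ k) ⟩
    0𝒪                                                  ∎

  ∂₀-ι* : ∀ a x → ∂ zero (ι a * x) ≈ ι a * ∂ zero x
  ∂₀-ι* a x = ≈-trans (+-congʳ (≈-trans (*-congʳ (∂-ι-new a)) (zeroˡ x))) (+-identityˡ _)

  const-cancel : ∀ k x → const (fromℕ (suc k)) * (const (proj₁ (fromℕ-suc-invertible k)) * x) ≈ x
  const-cancel k x = begin
    const (fromℕ (suc k)) * (const r * x)   ≈⟨ *-assoc _ _ x ⟨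
    const (fromℕ (suc k)) * const r * x     ≈⟨ *-congʳ (const-* (fromℕ (suc k)) r) ⟨
    const (fromℕ (suc k) ℚ.* r) * x         ≈⟨ *-congʳ (reflexive (cong const (proj₂ (fromℕ-suc-invertible k)))) ⟩
    1𝒪 * x                                  ≈⟨ *-identityˡ x ⟩
    x                                       ∎
    where
    r : ℚ
    r = proj₁ (fromℕ-suc-invertible k)

  polynomial-exact : ∀ a k → ∃ λ y → ι a * t zero ^ k ≈ ∂ zero y
  polynomial-exact a k = ι (const c⁻¹ * a) * t zero ^ suc k , ≈-sym (begin
    ∂ zero (ι (const c⁻¹ * a) * t zero ^ suc k)                ≈⟨ ∂₀-ι* _ _ ⟩
    const c⁻¹ * ι a * ∂ zero (t zero ^ suc k)                  ≈⟨ *-congˡ (∂₀-t-power k) ⟩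
    const c⁻¹ * ι a * (const (fromℕ (suc k)) * t zero ^ k)
      ≈⟨ solve 4 (λ d a c x → d :* a :* (c :* x) := c :* (d :* (a :* x))) ≈-refl
           (const c⁻¹) (ι a) (const (fromℕ (suc k))) (t zero ^ k) ⟩
    const (fromℕ (suc k)) * (const c⁻¹ * (ι a * t zero ^ k))   ≈⟨ const-cancel k _ ⟩
    ι a * t zero ^ k                                           ∎)
    where
    c⁻¹ : ℚ
    c⁻¹ = proj₁ (fromℕ-suc-invertible k)

  -- The exponent starts at 2: simple poles are the only partial fractions left without a primitive,
  -- and they are what residues detect.
  fraction-exact : ∀ a q k → ∃ λ y → ι a * pole q ^ suc (suc k) ≈ ∂ zero y
  fraction-exact a q k = ι (- (const c⁻¹ * a)) * pole q ^ suc k , ≈-sym (begin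
    ∂ zero (ι (- (const c⁻¹ * a)) * pole q ^ suc k)            ≈⟨ ∂₀-ι* _ _ ⟩
    - (const c⁻¹ * ι a) * ∂ zero (pole q ^ suc k)              ≈⟨ *-congˡ (∂₀-pole-power q (suc k)) ⟩
    - (const c⁻¹ * ι a) * (const (fromℕ (suc k)) * - 1𝒪 * x)
      ≈⟨ solve 4 (λ d a c x → :- (d :* a) :* (c :* (:- con 1ℚ) :* x) := c :* (d :* (a :* x))) ≈-refl
           (const c⁻¹) (ι a) (const (fromℕ (suc k))) x ⟩
    const (fromℕ (suc k)) * (const c⁻¹ * (ι a * x))            ≈⟨ const-cancel k _ ⟩
    ι a * x                                                    ∎)
    where
    c⁻¹ : ℚ
    c⁻¹ = proj₁ (fromℕ-suc-invertible k)
    x : 𝒪 (suc m)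
    x = pole q ^ suc (suc k)

-- Residues of partial fractions and of derivatives.

module ResidueCalculus {m : ℕ} (p : Point m) where

  open 𝒪-Ring m
  open LaurentSeries m
  open Residue p
  open PartialFractions m using (PartialFraction; polynomial; fraction; add; resp; partialFraction)
  open Derivatives m
  private module R⁺ = 𝒪-Ring (suc m)

  power : 𝒪 (suc m) → ℕ → Laurent
  power y k = act (y R⁺.^ k) 1ᴸ

  act-pole : ∀ q u → act (pole q) u ≡ 1/t-.apply q u
  act-pole q u = cong (λ o → actInv o new u) (oldOrNew-↑ q)

  1-regular : ∀ y → Regular (power y 0)
  1-regular y k = zeroʳ 1𝒪

  residue-t-power : ∀ k → residue (t zero R⁺.^ k) ≈ 0𝒪
  residue-t-power k = go k 0
    where
    -- All polar coefficients are treated at once, since multiplication by t = ε + p brings in the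
    -- neighbouring one.
    go : ∀ k → Regular (power (t zero) k)
    go zero    j = 1-regular (t zero) j
    go (suc k) j = ≈-trans (+-cong (go k (suc j)) (*-congˡ (go k j)))
      (solve 1 (λ x → con 0ℚ :+ x :* con 0ℚ := con 0ℚ) ≈-refl (val p))

  -- With vanishing right-hand sides, the equation for the polar coefficients of the quotient is
  -- exactly the relation of `geometric⇒regular`.
  1/t--regular : ∀ {q} → p ≢ q → ∀ {u} → Regular u → Regular (1/t-.apply q u)
  1/t--regular {q} p≢q {u} r = geometric⇒regular (recip-inverse p≢q) v λ k → begin
    coeff v -[1+ suc k ]
      ≈⟨ solve 3 (λ x c y → x := (x :+ (:- c) :* y) :+ c :* y) ≈-refl (coeff v -[1+ suc k ]) c (coeff v -[1+ k ]) ⟩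
    (coeff v -[1+ suc k ] + (- c) * coeff v -[1+ k ]) + c * coeff v -[1+ k ]
      ≈⟨ +-congʳ (≈-trans (1/t-.inverseʳ q u at -[1+ k ]) (r k)) ⟩
    0𝒪 + c * coeff v -[1+ k ]
      ≈⟨ +-identityˡ _ ⟩
    c * coeff v -[1+ k ] ∎
    where
    v : Laurent
    v = 1/t-.apply q u
    c : 𝒪 m
    c = val q + - val p

  residue-pole-≢ : ∀ {q} → p ≢ q → ∀ k → residue (pole q R⁺.^ k) ≈ 0𝒪
  residue-pole-≢ {q} p≢q k = go k 0
    where
    go : ∀ k → Regular (power (pole q) k)
    go zero    = 1-regular (pole q)
    go (suc k) = subst Regular (sym (act-pole q _)) (1/t--regular p≢q (go k))

  -- At the point p itself the operator is division by ε. This is read off from `inverseʳ`, as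
  -- `inverse p` does not compute for a variable `p`.
  pole-shifts : ∀ u i → coeff (act (pole p) u) (prev i) ≈ coeff u i
  pole-shifts u i = ≈-trans (reflexive (cong (λ v → coeff v (prev i)) (act-pole p u))) (begin
    coeff v (prev i)
      ≈⟨ solve 3 (λ x c y → x := x :+ (:- (c :+ :- c)) :* y) ≈-refl (coeff v (prev i)) (val p) (coeff v i) ⟩
    coeff v (prev i) + (- (val p + - val p)) * coeff v i   ≈⟨ 1/t-.inverseʳ p u at i ⟩
    coeff u i                                              ∎)
    where
    v : Laurent
    v = 1/t-.apply p u

  residue-pole : residue (pole p R⁺.^ 1) ≈ 1𝒪
  residue-pole = ≈-trans (pole-shifts _ (+ 0)) (*-identityˡ 1𝒪)

  residue-pole-power : ∀ q k → residue (pole q R⁺.^ suc (suc k)) ≈ 0𝒪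
  residue-pole-power q k with p ≟ᴾ q
  ... | no p≢q   = residue-pole-≢ p≢q (suc (suc k))
  ... | yes refl = ≈-trans (pole-shifts _ (+ 0)) (≈-trans (pole-shifts _ (+ 1)) (go k 0))
    where
    -- Two shifts have moved the residue of ε^(-k-2) to the coefficient of ε in ε^(-k), a series
    -- without positive powers.
    go : ∀ k j → coeff (power (pole p) k) (+ suc j) ≈ 0𝒪
    go zero    j = zeroʳ 1𝒪
    go (suc k) j = ≈-trans (pole-shifts _ (+ suc (suc j))) (go k (suc j))

  residue-polynomial : ∀ a k → residue (ι a * t zero R⁺.^ k) ≈ 0𝒪
  residue-polynomial a k = ≈-trans (residue-* a (t zero R⁺.^ k)) (≈-trans (*-congˡ (residue-t-power k)) (zeroʳ a))

  residue-fraction : ∀ a q k → residue (ι a * pole q R⁺.^ suc (suc k)) ≈ 0𝒪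
  residue-fraction a q k = ≈-trans (residue-* a (pole q R⁺.^ suc (suc k))) (≈-trans (*-congˡ (residue-pole-power q k)) (zeroʳ a))

  residue-ι*pole-≢ : ∀ a {q} → p ≢ q → residue (ι a * pole q R⁺.^ 1) ≈ 0𝒪
  residue-ι*pole-≢ a {q} p≢q = ≈-trans (residue-* a (pole q R⁺.^ 1)) (≈-trans (*-congˡ (residue-pole-≢ p≢q 1)) (zeroʳ a))

  residue-ι*pole : ∀ a → residue (ι a * pole p R⁺.^ 1) ≈ a
  residue-ι*pole a = ≈-trans (residue-* a (pole p R⁺.^ 1)) (≈-trans (*-congˡ residue-pole) (*-identityʳ a))

  -- Being rational, these residues are killed by every `∂ i`, which `residue-∂ᵢ` relies on.
  residue-pole-constant : ∀ q k → ∃ λ c → residue (pole q R⁺.^ suc k) ≈ const c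
  residue-pole-constant q (suc k) = 0ℚ , residue-pole-power q k
  residue-pole-constant q zero with p ≟ᴾ q
  ... | no p≢q   = 0ℚ , residue-pole-≢ p≢q 1
  ... | yes refl = 1ℚ , residue-pole

  -- Differentiation in t keeps polynomials polynomial and raises every pole order, so no simple
  -- pole can arise.
  residue-∂₀ : ∀ x → residue (∂ zero x) ≈ 0𝒪
  residue-∂₀ x = go (partialFraction x)
    where
    go : ∀ {x} → PartialFraction x → residue (∂ zero x) ≈ 0𝒪
    go (polynomial a zero)    = ≈-trans (residue-cong (∂₀-ι* a (const 1ℚ)))
      (≈-trans (residue-* a (const 0ℚ)) (≈-trans (*-congˡ {a} (zeroˡ 0𝒪)) (zeroʳ a)))
    go (polynomial a (suc k)) = begin
      residue (∂ zero (ι a * t zero R⁺.^ suc k))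
        ≈⟨ residue-cong (≈-trans (∂₀-ι* a (t zero R⁺.^ suc k)) (R⁺.*-congˡ {ι a} (∂₀-t-power k))) ⟩
      residue (ι a * (const n * t zero R⁺.^ k))
        ≈⟨ residue-cong (*-assoc (ι a) (const n) (t zero R⁺.^ k)) ⟨
      residue (ι (a * const n) * t zero R⁺.^ k)
        ≈⟨ residue-polynomial (a * const n) k ⟩
      0𝒪 ∎
      where
      n : ℚ
      n = fromℕ (suc k)
    go (fraction a q k)       = begin
      residue (∂ zero (ι a * pole q R⁺.^ suc k))
        ≈⟨ residue-cong (≈-trans (∂₀-ι* a (pole q R⁺.^ suc k)) (R⁺.*-congˡ {ι a} (∂₀-pole-power q (suc k)))) ⟩
      residue (ι a * (const n * (- const 1ℚ) * pole q R⁺.^ suc (suc k)))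
        ≈⟨ residue-cong (*-assoc (ι a) (const n * (- const 1ℚ)) (pole q R⁺.^ suc (suc k))) ⟨
      residue (ι (a * (const n * (- 1𝒪))) * pole q R⁺.^ suc (suc k))
        ≈⟨ residue-fraction (a * (const n * (- 1𝒪))) q k ⟩
      0𝒪 ∎
      where
      n : ℚ
      n = fromℕ (suc k)
    go (add x y)              = ≈-trans (+-cong (go x) (go y)) (+-identityˡ _)
    go (resp e x)             = ≈-trans (residue-cong (∂-cong zero (≈-sym e))) (go x)

  -- For a fraction, differentiating the power of the pole leaves order at least two and no residue;
  -- only the derivative of its coefficient counts. Together with `residue-∂₀` this makes residues
  -- well defined on cohomology.
  residue-∂ᵢ : ∀ i x → residue (∂ (suc i) x) ≈ ∂ i (residue x)
  residue-∂ᵢ i x = go (partialFraction x)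
    where
    go : ∀ {x} → PartialFraction x → residue (∂ (suc i) x) ≈ ∂ i (residue x)
    go (polynomial a k) = begin
      residue (∂ (suc i) (ι a) * X + ι a * ∂ (suc i) X)
        ≈⟨ residue-cong (R⁺.+-congˡ {∂ (suc i) (ι a) * X} (R⁺.*-congˡ {ι a} (∂ᵢ-t-power i k))) ⟩
      residue (∂ (suc i) (ι a) * X + ι a * const 0ℚ)
        ≡⟨ cong (λ y → residue (y * X + ι a * const 0ℚ)) (∂-ι-old i a) ⟩
      residue (ι (∂ i a) * X) + residue (ι a * const 0ℚ)
        ≈⟨ +-cong (residue-polynomial (∂ i a) k) (≈-trans (residue-* a (const 0ℚ)) (≈-trans (*-congˡ {a} (zeroˡ 0𝒪)) (zeroʳ a))) ⟩
      0𝒪 + 0𝒪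
        ≈⟨ +-identityˡ 0𝒪 ⟩
      ∂ i 0𝒪
        ≈⟨ ∂-cong i (residue-polynomial a k) ⟨
      ∂ i (residue (ι a * X)) ∎
      where
      X : 𝒪 (suc m)
      X = t zero R⁺.^ k
    go (fraction a q k) = begin
      residue (∂ (suc i) (ι a) * X + ι a * ∂ (suc i) X)
        ≈⟨ residue-cong (R⁺.+-congˡ {∂ (suc i) (ι a) * X}
             (≈-trans (R⁺.*-congˡ {ι a} (∂ᵢ-pole-power i q (suc k))) (≈-sym (*-assoc (ι a) (ι b) (pole q * X))))) ⟩
      residue (∂ (suc i) (ι a) * X + ι (a * b) * (pole q * X))
        ≡⟨ cong (λ y → residue (y * X + ι (a * b) * (pole q * X))) (∂-ι-old i a) ⟩
      residue (ι (∂ i a) * X) + residue (ι (a * b) * (pole q * X))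
        ≈⟨ +-cong (≈-trans (residue-* (∂ i a) X) (*-congˡ c-eq)) (residue-fraction (a * b) q k) ⟩
      ∂ i a * const c + 0𝒪
        ≈⟨ +-congˡ (zeroʳ a) ⟨
      ∂ i (a * const c)
        ≈⟨ ∂-cong i (≈-trans (residue-* a X) (*-congˡ c-eq)) ⟨
      ∂ i (residue (ι a * X)) ∎
      where
      X : 𝒪 (suc m)
      X = pole q R⁺.^ suc k
      b : 𝒪 m
      b = const (fromℕ (suc k)) * ∂-val i q
      c : ℚ
      c = proj₁ (residue-pole-constant q k)
      c-eq : residue X ≈ const c
      c-eq = proj₂ (residue-pole-constant q k)
    go (add x y)  = +-cong (go x) (go y)
    go (resp e x) = ≈-trans (residue-cong (∂-cong (suc i) (≈-sym e))) (≈-trans (go x) (∂-cong i (residue-cong e)))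

-- Closed functionals and their expansion by residues.

module PointSum (M : CommutativeMonoid 0ℓ 0ℓ) where

  open CommutativeMonoid M using (Carrier; _∙_; ε; identityˡ; identityʳ; ∙-cong; ∙-congˡ)
    renaming (_≈_ to _≈ₘ_; trans to transₘ)
  open CommutativeMonoidSum M using (sum; sum-cong-≋; ∑-distrib-+; sum-remove; sum-replicate-zero)
  open CommutativeSemigroupProperties (CommutativeMonoid.commutativeSemigroup M) using (interchange)

  ∑-zero : ∀ {k} {h : Fin k → Carrier} → (∀ i → h i ≈ₘ ε) → sum h ≈ₘ ε
  ∑-zero {k} z = transₘ (sum-cong-≋ z) (sum-replicate-zero k)

  ∑-single : ∀ {k} {h : Fin k → Carrier} i → (∀ j → j ≢ i → h j ≈ₘ ε) → sum h ≈ₘ h i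
  ∑-single {suc k} {h} i z = transₘ (sum-remove h)
    (transₘ (∙-congˡ (∑-zero λ j → z (punchIn i j) (punchInᵢ≢i i j))) (identityʳ (h i)))

  ∑ᴾ : ∀ {m} → (Point m → Carrier) → Carrier
  ∑ᴾ h = h 𝟎 ∙ (h 𝟏 ∙ sum (h ∘ 𝒕))

  ∑ᴾ-cong : ∀ {m} {h h′ : Point m → Carrier} → (∀ p → h p ≈ₘ h′ p) → ∑ᴾ h ≈ₘ ∑ᴾ h′
  ∑ᴾ-cong e = ∙-cong (e 𝟎) (∙-cong (e 𝟏) (sum-cong-≋ (e ∘ 𝒕)))

  ∑ᴾ-distrib : ∀ {m} (h h′ : Point m → Carrier) → ∑ᴾ (λ p → h p ∙ h′ p) ≈ₘ ∑ᴾ h ∙ ∑ᴾ h′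
  ∑ᴾ-distrib h h′ = transₘ (∙-congˡ (transₘ (∙-congˡ (∑-distrib-+ (h ∘ 𝒕) (h′ ∘ 𝒕))) (interchange _ _ _ _)))
    (interchange _ _ _ _)

  ∑ᴾ-zero : ∀ {m} {h : Point m → Carrier} → (∀ p → h p ≈ₘ ε) → ∑ᴾ h ≈ₘ ε
  ∑ᴾ-zero z = transₘ (∙-cong (z 𝟎) (∙-cong (z 𝟏) (∑-zero (z ∘ 𝒕)))) (transₘ (identityˡ _) (identityˡ ε))

  ∑ᴾ-single : ∀ {m} {h : Point m → Carrier} q → (∀ p → p ≢ q → h p ≈ₘ ε) → ∑ᴾ h ≈ₘ h q
  ∑ᴾ-single 𝟎     z = transₘ (∙-congˡ (transₘ (∙-cong (z 𝟏 λ ()) (∑-zero λ i → z (𝒕 i) λ ())) (identityˡ ε))) (identityʳ _)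
  ∑ᴾ-single 𝟏     z = transₘ (∙-cong (z 𝟎 λ ()) (transₘ (∙-congˡ (∑-zero λ i → z (𝒕 i) λ ())) (identityʳ _))) (identityˡ _)
  ∑ᴾ-single (𝒕 i) z = transₘ (∙-cong (z 𝟎 λ ()) (transₘ (∙-cong (z 𝟏 λ ())
    (∑-single i λ j j≢i → z (𝒕 j) λ { refl → j≢i refl })) (identityˡ _))) (identityˡ _)

module VectorSpace (V : ℚ-VectorSpace) where

  open LeftModule V public
  open PointSum +ᴹ-commutativeMonoid public
  open GroupProperties +ᴹ-group public using () renaming (∙-cancelʳ to +ᴹ-cancelʳ; inverseˡ-unique to +ᴹ-inverseˡ-unique)
  open CommutativeMonoidSum +ᴹ-commutativeMonoid public using (sum)
  open CommutativeSemigroupProperties (CommutativeMonoid.commutativeSemigroup +ᴹ-commutativeMonoid) public using (interchange)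

  *-∑ : ∀ q {k} (h : Fin k → Carrierᴹ) → q *ₗ sum h ≈ᴹ sum (λ i → q *ₗ h i)
  *-∑ q {zero}  h = *ₗ-zeroʳ q
  *-∑ q {suc k} h = ≈ᴹ-trans (*ₗ-distribˡ q _ _) (+ᴹ-congˡ (*-∑ q (h ∘ suc)))

  *-∑ᴾ : ∀ q {m} (h : Point m → Carrierᴹ) → q *ₗ ∑ᴾ h ≈ᴹ ∑ᴾ (λ p → q *ₗ h p)
  *-∑ᴾ q h = ≈ᴹ-trans (*ₗ-distribˡ q _ _) (+ᴹ-congˡ (≈ᴹ-trans (*ₗ-distribˡ q _ _) (+ᴹ-congˡ (*-∑ q (h ∘ 𝒕)))))

-- A linear functional on top-degree forms that vanishes on the exact ones.
record ClosedFunctional (m : ℕ) (V : ℚ-VectorSpace) : Set where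
  open VectorSpace V
  open 𝒪-Ring m using (0𝒪; zeroˡ)
  field
    apply  : 𝒪 m → Carrierᴹ
    cong-≈ : ∀ {x y} → x ≈ y → apply x ≈ᴹ apply y
    homo-+ : ∀ x y → apply (x + y) ≈ᴹ apply x +ᴹ apply y
    homo-* : ∀ q x → apply (const q * x) ≈ᴹ q *ₗ apply x
    homo-∂ : ∀ i x → apply (∂ i x) ≈ᴹ 0ᴹ

  homo-0 : apply 0𝒪 ≈ᴹ 0ᴹ
  homo-0 = ≈ᴹ-trans (cong-≈ (≈-sym (zeroˡ 0𝒪))) (≈ᴹ-trans (homo-* 0ℚ 0𝒪) (*ₗ-zeroˡ _))

  homo-neg : ∀ x → apply (- x) ≈ᴹ -ᴹ apply x
  homo-neg x = +ᴹ-inverseˡ-unique _ _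
    (≈ᴹ-trans (≈ᴹ-sym (homo-+ (- x) x)) (≈ᴹ-trans (cong-≈ (-‿inverseˡ x)) homo-0))

open ClosedFunctional

module _ {m : ℕ} {V : ℚ-VectorSpace} where

  open VectorSpace V
  open 𝒪-Ring (suc m)
  open PartialFractions m using (PartialFraction; polynomial; fraction; add; resp; partialFraction)
  open Derivatives m using (polynomial-exact; fraction-exact)
  open Residue using (residue; residue-cong; residue-*)
  open ResidueCalculus using (residue-polynomial; residue-fraction; residue-ι*pole; residue-ι*pole-≢; residue-∂₀; residue-∂ᵢ)

  residue-at : Point m → ClosedFunctional m V → ClosedFunctional (suc m) V
  residue-at p c = record
    { apply  = λ x → apply c (residue p x)
    ; cong-≈ = λ e → cong-≈ c (residue-cong p e)
    ; homo-+ = λ x y → homo-+ c _ _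
    ; homo-* = λ q x → ≈ᴹ-trans (cong-≈ c (residue-* p (const q) x)) (homo-* c q _)
    ; homo-∂ = λ { zero x    → ≈ᴹ-trans (cong-≈ c (residue-∂₀ p x)) (homo-0 c)
                 ; (suc i) x → ≈ᴹ-trans (cong-≈ c (residue-∂ᵢ p i x)) (homo-∂ c i (residue p x)) }
    }

  sum-of : (Point m → ClosedFunctional (suc m) V) → ClosedFunctional (suc m) V
  sum-of c = record
    { apply  = λ x → ∑ᴾ λ p → apply (c p) x
    ; cong-≈ = λ e → ∑ᴾ-cong λ p → cong-≈ (c p) e
    ; homo-+ = λ x y → ≈ᴹ-trans (∑ᴾ-cong λ p → homo-+ (c p) x y) (∑ᴾ-distrib (λ p → apply (c p) x) (λ p → apply (c p) y))
    ; homo-* = λ q x → ≈ᴹ-trans (∑ᴾ-cong λ p → homo-* (c p) q x) (≈ᴹ-sym (*-∑ᴾ q (λ p → apply (c p) x)))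
    ; homo-∂ = λ i x → ∑ᴾ-zero λ p → homo-∂ (c p) i x
    }

  -- If p is the variable differentiated, the pole moves with it and a double pole appears, but that
  -- term has a primitive in t. Multiplication by 1 / (t - p) therefore respects exactness, as
  -- `times-pole` requires.
  ∂ᵢ-ι*pole : ∀ i x p → ∃ λ y → ∂ (suc i) (ι x * pole p) ≈ ι (∂ i x) * pole p + ∂ zero y
  ∂ᵢ-ι*pole i x p = proj₁ exact , (begin
    ∂ (suc i) (ι x) * pole p + ι x * ∂ (suc i) (pole p)
      ≈⟨ +-cong (*-congʳ (reflexive (∂-ι-old i x))) (*-congˡ (-‿cong (*-congʳ (+-congˡ (-‿cong (reflexive (∂-val-ι i p))))))) ⟩
    ι (∂ i x) * pole p + ι x * - ((const 0ℚ + - e) * (pole p * pole p))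
      ≈⟨ +-congˡ (solve 3 (λ x e d → x :* :- ((con 0ℚ :+ :- e) :* (d :* d)) := (x :* e) :* (d :* (d :* con 1ℚ))) ≈-refl (ι x) e (pole p)) ⟩
    ι (∂ i x) * pole p + ι (x * ∂-val i p) * pole p ^ 2
      ≈⟨ +-congˡ (proj₂ exact) ⟩
    ι (∂ i x) * pole p + ∂ zero (proj₁ exact) ∎)
    where
    e : 𝒪 (suc m)
    e = ι (∂-val i p)
    exact : ∃ λ y → ι (x * ∂-val i p) * pole p ^ 2 ≈ ∂ zero y
    exact = fraction-exact (x * ∂-val i p) p 0

  times-pole : Point m → ClosedFunctional (suc m) V → ClosedFunctional m V
  times-pole p c = record
    { apply  = λ x → apply c (ι x * pole p)
    ; cong-≈ = λ e → cong-≈ c (*-congʳ (ι-cong e))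
    ; homo-+ = λ x y → ≈ᴹ-trans (cong-≈ c (distribʳ _ _ _)) (homo-+ c _ _)
    ; homo-* = λ q x → ≈ᴹ-trans (cong-≈ c (*-assoc _ _ _)) (homo-* c q _)
    ; homo-∂ = λ i x → let y , e = ∂ᵢ-ι*pole i x p in
        ≈ᴹ-trans (≈ᴹ-sym (+ᴹ-identityʳ _)) (≈ᴹ-trans (+ᴹ-congˡ (≈ᴹ-sym (homo-∂ c zero y)))
          (≈ᴹ-trans (≈ᴹ-sym (homo-+ c _ _)) (≈ᴹ-trans (cong-≈ c (≈-sym e)) (homo-∂ c (suc i) (ι x * pole p)))))
    }

  -- Partial fractions other than simple poles are derivatives in t and have no residues, so both
  -- sides vanish on them; on a simple pole at q only the summand at q survives, and it returns the
  -- pole.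
  residue-expansion : ∀ (c : ClosedFunctional (suc m) V) x →
                      apply c x ≈ᴹ ∑ᴾ λ p → apply (times-pole p c) (residue p x)
  residue-expansion c x = go (partialFraction x)
    where
    part : 𝒪 (suc m) → Point m → Carrierᴹ
    part x p = apply (times-pole p c) (residue p x)

    vanish : ∀ {x} p → residue p x ≈ const 0ℚ → part x p ≈ᴹ 0ᴹ
    vanish p e = ≈ᴹ-trans (cong-≈ (times-pole p c) e) (homo-0 (times-pole p c))

    exact : ∀ {x} → (∃ λ y → x ≈ ∂ zero y) → (∀ p → residue p x ≈ const 0ℚ) → apply c x ≈ᴹ ∑ᴾ (part x)
    exact {x} (y , e) z = ≈ᴹ-trans (≈ᴹ-trans (cong-≈ c e) (homo-∂ c zero y))
      (≈ᴹ-sym (∑ᴾ-zero λ p → vanish {x} p (z p)))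

    go : ∀ {x} → PartialFraction x → apply c x ≈ᴹ ∑ᴾ (part x)
    go (polynomial a k)         = exact (polynomial-exact a k) λ p → residue-polynomial p a k
    go (fraction a q (suc k))   = exact (fraction-exact a q k) λ p → residue-fraction p a q k
    go (fraction a q zero)      = ≈ᴹ-sym (≈ᴹ-trans
      (∑ᴾ-single {h = part (ι a * pole q ^ 1)} q λ p p≢q → vanish {ι a * pole q ^ 1} p (residue-ι*pole-≢ p a p≢q))
      (cong-≈ c (*-cong (ι-cong (residue-ι*pole q a)) (≈-sym (*-identityʳ (pole q))))))
    go (add {x} {y} s s′)       = ≈ᴹ-trans (homo-+ c x y) (≈ᴹ-trans (+ᴹ-cong (go s) (go s′))
      (≈ᴹ-sym (≈ᴹ-trans
        (∑ᴾ-cong {h = part (x + y)} {λ p → part x p +ᴹ part y p} λ p → homo-+ (times-pole p c) (residue p x) (residue p y))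
        (∑ᴾ-distrib (part x) (part y)))))
    go (resp {x} {y} e s)       = ≈ᴹ-trans (cong-≈ c (≈-sym e)) (≈ᴹ-trans (go s)
      (∑ᴾ-cong {h = part x} {part y} λ p → cong-≈ (times-pole p c) (residue-cong p e)))

-- Inserting t into cell forms.

-- The first letter is a separate argument, so that insertions and shuffles can recurse behind it;
-- `recip` spares a proof that neighbours differ.
cellProduct : ∀ {m} → Point m → List (Point m) → 𝒪 m
cellProduct a []      = const 1ℚ
cellProduct a (b ∷ w) = recip a b * cellProduct b w

ι-cellProduct : ∀ {m} (a : Point m) w → ι (cellProduct a w) ≡ cellProduct (↑ a) (map ↑ w)
ι-cellProduct a []      = refl
ι-cellProduct a (b ∷ w) = cong₂ _*_ (ι-recip a b) (ι-cellProduct b w)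

lastFrom : ∀ {A : Set} → A → List A → A
lastFrom a []      = a
lastFrom a (b ∷ w) = lastFrom b w

lastFrom-∈ : ∀ {A : Set} (a : A) w → lastFrom a w ∈ a ∷ w
lastFrom-∈ a []      = here refl
lastFrom-∈ a (b ∷ w) = there (lastFrom-∈ b w)

-- Sums over the insertions of 𝒕 zero into a word w of old points preceded by a
-- point a: over all of them, and over those that come after the letter p.
module Insertion (M : CommutativeMonoid 0ℓ 0ℓ) where

  open CommutativeMonoid M using (Carrier; _∙_; ε; identityʳ; ∙-cong; ∙-congˡ)
    renaming (_≈_ to _≈ₘ_; refl to reflₘ; trans to transₘ; reflexive to reflexiveₘ)

  insertAll : ∀ {m} → (List (Point (suc m)) → Carrier) → List (Point m) → Carrier
  insertAll g []      = g (𝒕 zero ∷ [])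
  insertAll g (b ∷ w) = g (𝒕 zero ∷ ↑ b ∷ map ↑ w) ∙ insertAll (g ∘ (↑ b ∷_)) w

  insertAfter : ∀ {m} → (List (Point (suc m)) → Carrier) → Point m → Point m → List (Point m) → Carrier
  insertAfter g p a w with p ≟ᴾ a | w
  ... | yes _ | w      = insertAll g w
  ... | no _  | []     = ε
  ... | no _  | b ∷ w′ = insertAfter (g ∘ (↑ b ∷_)) p b w′

  insertAfter-here : ∀ {m} g (a : Point m) w → insertAfter g a a w ≡ insertAll g w
  insertAfter-here g a w with a ≟ᴾ a
  ... | yes _  = refl
  ... | no a≢a = contradiction refl a≢a

  insertAfter-skip : ∀ {m} g {p a b : Point m} w → p ≢ a →
                     insertAfter g p a (b ∷ w) ≡ insertAfter (g ∘ (↑ b ∷_)) p b w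
  insertAfter-skip g {p} {a} w p≢a with p ≟ᴾ a
  ... | yes p≡a = contradiction p≡a p≢a
  ... | no _    = refl

  insertAll-cong : ∀ {m} {g g′ : List (Point (suc m)) → Carrier} w →
                   (∀ u v → u ++ v ≡ w → g (map ↑ u ++ 𝒕 zero ∷ map ↑ v) ≈ₘ g′ (map ↑ u ++ 𝒕 zero ∷ map ↑ v)) →
                   insertAll g w ≈ₘ insertAll g′ w
  insertAll-cong []      e = e [] [] refl
  insertAll-cong (b ∷ w) e = ∙-cong (e [] (b ∷ w) refl) (insertAll-cong w λ u v q → e (b ∷ u) v (cong (b ∷_) q))

  insertAfter-cong : ∀ {m} {g g′ : List (Point (suc m)) → Carrier} p a w →
                     (∀ u v → u ++ v ≡ w → g (map ↑ u ++ 𝒕 zero ∷ map ↑ v) ≈ₘ g′ (map ↑ u ++ 𝒕 zero ∷ map ↑ v)) →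
                     insertAfter g p a w ≈ₘ insertAfter g′ p a w
  insertAfter-cong p a w e with p ≟ᴾ a | w
  ... | yes _ | w      = insertAll-cong w e
  ... | no _  | []     = reflₘ
  ... | no _  | b ∷ w′ = insertAfter-cong p b w′ λ u v q → e (b ∷ u) v (cong (b ∷_) q)

  next : ∀ {m} → (Point m → Carrier) → List (Point m) → Carrier
  next h []      = ε
  next h (b ∷ _) = h b

  -- The insertions after the last letter of u, minus those after the first one
  -- of v.
  insert-between : ∀ {m} g (a : Point m) u v → Unique (a ∷ u ++ v) →
                   g (map ↑ u ++ 𝒕 zero ∷ map ↑ v) ∙ next (λ b → insertAfter g b a (u ++ v)) v
                     ≈ₘ insertAfter g (lastFrom a u) a (u ++ v)
  insert-between g a [] []      un = transₘ (identityʳ _) (reflexiveₘ (sym (insertAfter-here g a [])))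
  insert-between g a [] (b ∷ v) ((a≢b ∷ _) ∷ _) = transₘ
    (∙-congˡ (reflexiveₘ (trans (insertAfter-skip g v (a≢b ∘ sym)) (insertAfter-here _ b v))))
    (reflexiveₘ (sym (insertAfter-here g a (b ∷ v))))
  insert-between g a (c ∷ u) [] (a∉ ∷ un) = transₘ (insert-between (g ∘ (↑ c ∷_)) c u [] un)
    (reflexiveₘ (sym (insertAfter-skip g (u ++ []) (All.lookup a∉ (∈-++⁺ˡ (lastFrom-∈ c u)) ∘ sym))))
  insert-between g a (c ∷ u) (b ∷ v) (a∉ ∷ un) = transₘ
    (∙-congˡ (reflexiveₘ (insertAfter-skip g (u ++ b ∷ v) (All.lookup a∉ (there (∈-++⁺ʳ u (here refl))) ∘ sym))))
    (transₘ (insert-between (g ∘ (↑ c ∷_)) c u (b ∷ v) un)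
    (reflexiveₘ (sym (insertAfter-skip g (u ++ b ∷ v) (All.lookup a∉ (∈-++⁺ˡ (lastFrom-∈ c u)) ∘ sym)))))

module _ {m : ℕ} where

  open 𝒪-Ring (suc m)
  open Insertion +-commutativeMonoid

  -- The terms combine by 1/((t-a)(b-t)) + 1/((b-a)(t-b)) = 1/((t-a)(b-a)), an instance of
  -- `recip-shuffle`. The factor `k` collects the differences already passed on the way into the
  -- word.
  insertAll-cellProduct : ∀ g k a w → Unique (a ∷ w) → (∀ x → g x ≈ k * cellProduct (↑ a) x) →
                          insertAll g w ≈ k * (ι (cellProduct a w) * pole a)
  insertAll-cellProduct g k a [] un e = ≈-trans (e _)
    (*-congˡ (≈-trans (*-comm _ _) (*-congˡ (reflexive (pole-recip a)))))
  insertAll-cellProduct g k a (b ∷ w) ((a≢b ∷ _) ∷ un) e = begin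
    g (𝒕 zero ∷ ↑ b ∷ map ↑ w) + insertAll (g ∘ (↑ b ∷_)) w
      ≈⟨ +-cong (e _) (insertAll-cellProduct (g ∘ (↑ b ∷_)) (k * ab) b w un λ x → ≈-trans (e _) (≈-sym (*-assoc _ _ _))) ⟩
    k * (at * (tb * cellProduct (↑ b) (map ↑ w))) + k * ab * (y * pole b)
      ≈⟨ +-cong (*-congˡ (*-congˡ (*-congˡ (reflexive (sym (ι-cellProduct b w)))))) (*-congˡ (*-congˡ (reflexive (sym (pole-recip b))))) ⟩
    k * (at * (tb * y)) + k * ab * (y * bt)
      ≈⟨ solve 6 (λ k at tb y ab bt → k :* (at :* (tb :* y)) :+ k :* ab :* (y :* bt) := k :* ((at :* tb :+ ab :* bt) :* y))
           ≈-refl k at tb y ab bt ⟩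
    k * ((at * tb + ab * bt) * y)
      ≈⟨ *-congˡ (*-congʳ (recip-shuffle (↑≢𝒕₀ a) (a≢b ∘ ↑-injective) (↑≢𝒕₀ b ∘ sym))) ⟨
    k * (at * ab * y)
      ≈⟨ *-congˡ (solve 3 (λ at ab y → at :* ab :* y := ab :* y :* at) ≈-refl at ab y) ⟩
    k * (ab * y * at)
      ≈⟨ *-congˡ (*-cong (*-congʳ (reflexive (sym (ι-recip a b)))) (reflexive (pole-recip a))) ⟩
    k * (ι (cellProduct a (b ∷ w)) * pole a) ∎
    where
    y ab at bt tb : 𝒪 (suc m)
    y  = ι (cellProduct b w)
    ab = recip (↑ a) (↑ b)
    at = recip (↑ a) (𝒕 zero)
    bt = recip (↑ b) (𝒕 zero)
    tb = recip (𝒕 zero) (↑ b)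

  insertAfter-cellProduct′ : ∀ g k p a w → Unique (a ∷ w) → p ∈ a ∷ w → (∀ x → g x ≈ k * cellProduct (↑ a) x) →
                             insertAfter g p a w ≈ k * (ι (cellProduct a w) * pole p)
  insertAfter-cellProduct′ g k p a w un p∈ e with p ≟ᴾ a | w | un | p∈
  ... | yes refl | w      | un     | _        = insertAll-cellProduct g k a w un e
  ... | no p≢a   | w      | _      | here p≡a = contradiction p≡a p≢a
  ... | no p≢a   | b ∷ w′ | _ ∷ un | there p∈ = begin
    insertAfter (g ∘ (↑ b ∷_)) p b w′
      ≈⟨ insertAfter-cellProduct′ (g ∘ (↑ b ∷_)) (k * ab) p b w′ un p∈ (λ x → ≈-trans (e _) (≈-sym (*-assoc _ _ _))) ⟩
    k * ab * (ι (cellProduct b w′) * pole p)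
      ≈⟨ solve 4 (λ k ab y d → k :* ab :* (y :* d) := k :* (ab :* y :* d)) ≈-refl k ab (ι (cellProduct b w′)) (pole p) ⟩
    k * (ab * ι (cellProduct b w′) * pole p)
      ≈⟨ *-congˡ (*-congʳ (*-congʳ (reflexive (sym (ι-recip a b))))) ⟩
    k * (ι (cellProduct a (b ∷ w′)) * pole p) ∎
    where
    ab : 𝒪 (suc m)
    ab = recip (↑ a) (↑ b)

  insertAfter-cellProduct : ∀ p a w → Unique (a ∷ w) → p ∈ a ∷ w →
                            insertAfter (cellProduct (↑ a)) p a w ≈ ι (cellProduct a w) * pole p
  insertAfter-cellProduct p a w un p∈ = ≈-trans
    (insertAfter-cellProduct′ _ 1𝒪 p a w un p∈ λ x → ≈-sym (*-identityˡ _)) (*-identityˡ _)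

-- Words that use every point other than 0 once.

nonzeroPoints : ∀ m → List (Point m)
nonzeroPoints m = 𝟏 ∷ map 𝒕 (allFin m)

Complete : ∀ {m} → List (Point m) → Set
Complete {m} w = w ↭ nonzeroPoints m

nonzeroPoints-suc : ∀ m → 𝒕 zero ∷ map ↑ (nonzeroPoints m) ↭ nonzeroPoints (suc m)
nonzeroPoints-suc m = ↭-trans (swap (𝒕 zero) 𝟏 ↭-refl) (↭-reflexive (cong (λ w → 𝟏 ∷ 𝒕 zero ∷ w) (begin
  map ↑ (map 𝒕 (allFin m))        ≡⟨ List.map-∘ (allFin m) ⟨
  map (𝒕 ∘ suc) (allFin m)        ≡⟨ List.map-∘ (allFin m) ⟩
  map 𝒕 (map suc (allFin m))      ≡⟨ cong (map 𝒕) (List.map-tabulate id suc) ⟩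
  map 𝒕 (tabulate suc)            ∎)))
  where open ≡-Reasoning

complete-insert : ∀ {m} (u v : List (Point m)) → Complete (u ++ v) → Complete (map ↑ u ++ 𝒕 zero ∷ map ↑ v)
complete-insert u v c = ↭-trans (shift (𝒕 zero) (map ↑ u) (map ↑ v))
  (↭-trans (prep (𝒕 zero) (↭-trans (↭-reflexive (sym (List.map-++ ↑ u v))) (↭-map⁺ ↑ c))) (nonzeroPoints-suc _))

map-++⁻ : ∀ {A B : Set} (f : A → B) {x} y {z} → y ++ z ≡ map f x →
          ∃₂ λ u v → y ≡ map f u × z ≡ map f v × x ≡ u ++ v
map-++⁻ f {x}     []      e = [] , x , refl , e , refl
map-++⁻ f {a ∷ x} (b ∷ y) e with List.∷-injective e
... | refl , e′ with map-++⁻ f y e′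
...   | u , v , refl , refl , refl = a ∷ u , v , refl , refl , refl

-- Deleting `𝒕 zero` inverts `complete-insert`, so an induction on `m` reaches every complete word.
complete-split : ∀ {m} {w : List (Point (suc m))} → Complete w →
                 ∃₂ λ u v → w ≡ map ↑ u ++ 𝒕 zero ∷ map ↑ v × Complete (u ++ v)
complete-split {m} {w} c with ∈-∃++ (∈-resp-↭ (↭-sym c) (there (here refl)))
... | y , z , refl with ↭-map-inv ↑ (↭-sym (drop-∷ (↭-trans (↭-sym (shift (𝒕 zero) y z)) (↭-trans c (↭-sym (nonzeroPoints-suc m))))))
...   | x , y++z≡↑x , x↭ with map-++⁻ ↑ y y++z≡↑x
...     | u , v , refl , refl , refl = u , v , refl , ↭-sym x↭

complete-∈ : ∀ {m} {w : List (Point m)} → Complete w → ∀ p → p ∈ 𝟎 ∷ w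
complete-∈ c 𝟎     = here refl
complete-∈ c 𝟏     = there (∈-resp-↭ (↭-sym c) (here refl))
complete-∈ c (𝒕 i) = there (∈-resp-↭ (↭-sym c) (there (∈-map⁺ 𝒕 (∈-allFin i))))

Unique-resp-↭ : ∀ {A : Set} {x y : List A} → x ↭ y → Unique x → Unique y
Unique-resp-↭ x↭y = ↭ₛ.Unique-resp-↭ (≡-setoid _) (↭⇒↭ₛ x↭y)

complete-unique : ∀ {m} {w : List (Point m)} → Complete w → Unique (𝟎 ∷ w)
complete-unique {m} c = Unique-resp-↭ (prep 𝟎 (↭-sym c))
  (((λ ()) ∷ All.tabulate (∉𝒕 λ ())) ∷ (All.tabulate (∉𝒕 λ ()) ∷ Unique-map⁺ (λ { refl → refl }) (allFin⁺ m)))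
  where
  ∉𝒕 : ∀ {p q} → (∀ {i} → p ≢ 𝒕 i) → q ∈ map 𝒕 (allFin m) → p ≢ q
  ∉𝒕 p≢ q∈ refl with ∈-map⁻ 𝒕 q∈
  ... | _ , _ , e = p≢ e

-- The base case: functions on a point are rational numbers.

evaluate : 𝒪 0 → ℚ
evaluate (const q)   = q
evaluate (x + y)     = evaluate x ℚ.+ evaluate y
evaluate (x * y)     = evaluate x ℚ.* evaluate y
evaluate (- x)       = ℚ.- evaluate x
evaluate (inv 𝟎 𝟏 _) = 1ℚ
evaluate (inv 𝟏 𝟎 _) = ℚ.- 1ℚ
-- Defaults, for equal points are excluded by `inv`.
evaluate (inv 𝟎 𝟎 _) = 0ℚ
evaluate (inv 𝟏 𝟏 _) = 0ℚ

evaluate-cong : ∀ {x y} → x ≈ y → evaluate x ≡ evaluate y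
evaluate-cong ≈-refl            = refl
evaluate-cong (≈-sym e)         = sym (evaluate-cong e)
evaluate-cong (≈-trans e e′)    = trans (evaluate-cong e) (evaluate-cong e′)
evaluate-cong (+-cong e e′)     = cong₂ ℚ._+_ (evaluate-cong e) (evaluate-cong e′)
evaluate-cong (*-cong e e′)     = cong₂ ℚ._*_ (evaluate-cong e) (evaluate-cong e′)
evaluate-cong (-‿cong e)        = cong ℚ.-_ (evaluate-cong e)
evaluate-cong (+-assoc x y z)   = ℚ.+-assoc (evaluate x) (evaluate y) (evaluate z)
evaluate-cong (+-comm x y)      = ℚ.+-comm (evaluate x) (evaluate y)
evaluate-cong (+-identityˡ x)   = ℚ.+-identityˡ (evaluate x)
evaluate-cong (-‿inverseˡ x)    = ℚ.+-inverseˡ (evaluate x)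
evaluate-cong (*-assoc x y z)   = ℚ.*-assoc (evaluate x) (evaluate y) (evaluate z)
evaluate-cong (*-comm x y)      = ℚ.*-comm (evaluate x) (evaluate y)
evaluate-cong (*-identityˡ x)   = ℚ.*-identityˡ (evaluate x)
evaluate-cong (distribˡ x y z)  = ℚ.*-distribˡ-+ (evaluate x) (evaluate y) (evaluate z)
evaluate-cong (const-+ q r)     = refl
evaluate-cong (const-* q r)     = refl
evaluate-cong (inv-inverse 𝟎 𝟎 p≢p) = ⊥-elim-irr (p≢p refl)
evaluate-cong (inv-inverse 𝟎 𝟏 _)   = refl
evaluate-cong (inv-inverse 𝟏 𝟎 _)   = refl
evaluate-cong (inv-inverse 𝟏 𝟏 p≢p) = ⊥-elim-irr (p≢p refl)

evaluate-const : ∀ x → x ≈ const (evaluate x)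
evaluate-const (const q)   = ≈-refl
evaluate-const (x + y)     = ≈-trans (+-cong (evaluate-const x) (evaluate-const y)) (≈-sym (const-+ _ _))
evaluate-const (x * y)     = ≈-trans (*-cong (evaluate-const x) (evaluate-const y)) (≈-sym (const-* _ _))
evaluate-const (- x)       = ≈-trans (-‿cong (evaluate-const x)) (≈-sym (const-- _))
  where open 𝒪-Ring 0
evaluate-const (inv 𝟎 𝟎 p≢p) = ⊥-elim-irr (p≢p refl)
evaluate-const (inv 𝟏 𝟏 p≢p) = ⊥-elim-irr (p≢p refl)
evaluate-const (inv 𝟎 𝟏 p≢q) = begin
  x                                ≈⟨ solve 1 (λ x → x := (con 1ℚ :+ :- con 0ℚ) :* x) ≈-refl x ⟩
  (const 1ℚ + - const 0ℚ) * x      ≈⟨ inv-inverse 𝟎 𝟏 p≢q ⟩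
  const 1ℚ                         ∎
  where
  open 𝒪-Ring 0
  x : 𝒪 0
  x = inv 𝟎 𝟏 p≢q
evaluate-const (inv 𝟏 𝟎 p≢q) = begin
  x                                    ≈⟨ solve 1 (λ x → x := :- ((con 0ℚ :+ :- con 1ℚ) :* x)) ≈-refl x ⟩
  - ((const 0ℚ + - const 1ℚ) * x)      ≈⟨ -‿cong (inv-inverse 𝟏 𝟎 p≢q) ⟩
  - const 1ℚ                           ≈⟨ const-- 1ℚ ⟨
  const (ℚ.- 1ℚ)                       ∎
  where
  open 𝒪-Ring 0
  x : 𝒪 0
  x = inv 𝟏 𝟎 p≢q

-- Interpolation by closed functionals.

module _ {V : ℚ-VectorSpace} where

  open VectorSpace V
  open Insertion
  private module Vᴵ = Insertion +ᴹ-commutativeMonoid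

  -- interpolate-cell and interpolate-unique show that cell forms are a basis.
  interpolate : ∀ m → (List (Point m) → Carrierᴹ) → ClosedFunctional m V
  interpolate zero    g = record
    -- The only complete word is `𝟏 ∷ []`, with cell function 1 / (1 - 0) = 1.
    { apply  = λ x → evaluate x *ₗ g (𝟏 ∷ [])
    ; cong-≈ = λ e → *ₗ-congʳ (evaluate-cong e)
    ; homo-+ = λ x y → *ₗ-distribʳ _ _ _
    ; homo-* = λ q x → *ₗ-assoc q _ _
    ; homo-∂ = λ ()
    }
  -- The values `g` force `insertAfter g p 𝟎 w` on the cell form of `w` divided by t - p, and
  -- `residue-expansion` then leaves no other choice.
  interpolate (suc m) g = sum-of λ p → residue-at p (interpolate m (Vᴵ.insertAfter g p 𝟎))

  insertAfter-homo : ∀ {m k} (c : ClosedFunctional k V) (g : List (Point (suc m)) → 𝒪 k) p a w →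
                     apply c (insertAfter (𝒪-Ring.+-commutativeMonoid k) g p a w) ≈ᴹ Vᴵ.insertAfter (apply c ∘ g) p a w
  insertAfter-homo c g p a w with p ≟ᴾ a | w
  ... | no _  | []     = homo-0 c
  ... | no _  | b ∷ w′ = insertAfter-homo c (g ∘ (↑ b ∷_)) p b w′
  ... | yes _ | w      = insertAll-homo g w
    where
    insertAll-homo : ∀ g w → apply c (insertAll (𝒪-Ring.+-commutativeMonoid _) g w) ≈ᴹ Vᴵ.insertAll (apply c ∘ g) w
    insertAll-homo g []      = ≈ᴹ-refl
    insertAll-homo g (b ∷ w) = ≈ᴹ-trans (homo-+ c _ _) (+ᴹ-congˡ (insertAll-homo (g ∘ (↑ b ∷_)) w))

  -- The functionals `times-pole p c` determine `c` and are themselves known by induction. As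
  -- `closed-functionals-agree` records, this is the spanning property of cell forms.
  interpolate-unique : ∀ {m} g (c : ClosedFunctional m V) → (∀ w → Complete w → g w ≈ᴹ apply c (cellProduct 𝟎 w)) →
                       ∀ x → apply (interpolate m g) x ≈ᴹ apply c x
  interpolate-unique {zero} g c e x = ≈ᴹ-trans (*ₗ-congˡ (e _ ↭-refl))
    (≈ᴹ-trans (≈ᴹ-sym (homo-* c _ _)) (cong-≈ c (begin
      const (evaluate x) * (inv 𝟎 𝟏 _ * const 1ℚ)   ≈⟨ *-congˡ (*-congʳ (evaluate-const (inv 𝟎 𝟏 λ ()))) ⟩
      const (evaluate x) * (const 1ℚ * const 1ℚ)
        ≈⟨ solve 1 (λ x → x :* (con 1ℚ :* con 1ℚ) := x) ≈-refl (const (evaluate x)) ⟩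
      const (evaluate x)                            ≈⟨ evaluate-const x ⟨
      x                                             ∎)))
    where open 𝒪-Ring 0
  interpolate-unique {suc m} g c e x = ≈ᴹ-trans
    (∑ᴾ-cong λ p → interpolate-unique (Vᴵ.insertAfter g p 𝟎) (times-pole p c) (insertions p) (Residue.residue p x))
    (≈ᴹ-sym (residue-expansion c x))
    where
    insertions : ∀ p w → Complete w → Vᴵ.insertAfter g p 𝟎 w ≈ᴹ apply (times-pole p c) (cellProduct 𝟎 w)
    insertions p w complete = ≈ᴹ-trans
      (Vᴵ.insertAfter-cong p 𝟎 w λ { u v refl → e _ (complete-insert u v complete) })
      (≈ᴹ-trans (≈ᴹ-sym (insertAfter-homo c (cellProduct 𝟎) p 𝟎 w))
        (cong-≈ c (insertAfter-cellProduct p 𝟎 w (complete-unique complete) (complete-∈ complete p))))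

  closed-functionals-agree : ∀ {m} (c c′ : ClosedFunctional m V) →
                             (∀ w → Complete w → apply c (cellProduct 𝟎 w) ≈ᴹ apply c′ (cellProduct 𝟎 w)) →
                             ∀ x → apply c x ≈ᴹ apply c′ x
  closed-functionals-agree c c′ e x = ≈ᴹ-trans
    (≈ᴹ-sym (interpolate-unique (apply c ∘ cellProduct 𝟎) c (λ _ _ → ≈ᴹ-refl) x))
    (interpolate-unique (apply c ∘ cellProduct 𝟎) c′ e x)

  interpolate-ι*pole : ∀ {m} g y (q : Point m) →
                       apply (interpolate (suc m) g) (ι y * pole q) ≈ᴹ apply (interpolate m (Vᴵ.insertAfter g q 𝟎)) y
  interpolate-ι*pole {m} g y q = ≈ᴹ-trans (cong-≈ (interpolate (suc m) g) {ι y * pole q} {x} (*-congˡ (≈-sym (*-identityʳ (pole q)))))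
    (≈ᴹ-trans (∑ᴾ-single {h = λ p → apply (c p) (Residue.residue p x)} q λ p p≢q →
        ≈ᴹ-trans (cong-≈ (c p) (ResidueCalculus.residue-ι*pole-≢ p y p≢q)) (homo-0 (c p)))
      (cong-≈ (c q) (ResidueCalculus.residue-ι*pole q y)))
    where
    open 𝒪-Ring (suc m)
    c : Point m → ClosedFunctional m V
    c p = interpolate m (Vᴵ.insertAfter g p 𝟎)
    x : 𝒪 (suc m)
    x = ι y * pole q ^ 1

  -- This is the independence of cell forms. By `insert-between`, one insertion of t is a sum of
  -- insertions minus, unless t comes last, another such sum; each is a cell form divided by some t
  -- - q, where `Φ` is known by induction. The same telescoping in `V` yields `g w`.
  interpolate-cell : ∀ {m} g {w} → Complete w → apply (interpolate m g) (cellProduct 𝟎 w) ≈ᴹ g w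
  interpolate-cell {zero} g complete with ↭-singleton-inv complete
  ... | refl = *ₗ-identityˡ _
  interpolate-cell {suc m} g complete with complete-split complete
  ... | u , v , refl , complete′ = +ᴹ-cancelʳ _ _ _ (≈ᴹ-trans (+ᴹ-congˡ (≈ᴹ-sym (next-values v)))
      (≈ᴹ-trans (≈ᴹ-sym (homo-+ Φ (cellProduct 𝟎 (map ↑ u ++ 𝒕 zero ∷ map ↑ v)) (𝒪ᴵ.next after v)))
      (≈ᴹ-trans (cong-≈ Φ (𝒪ᴵ.insert-between (cellProduct 𝟎) 𝟎 u v (complete-unique complete′)))
      (≈ᴹ-trans (values (lastFrom 𝟎 u)) (≈ᴹ-sym (Vᴵ.insert-between g 𝟎 u v (complete-unique complete′)))))))
    where
    module 𝒪ᴵ = Insertion (𝒪-Ring.+-commutativeMonoid (suc m))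
    Φ : ClosedFunctional (suc m) V
    Φ = interpolate (suc m) g

    after : Point m → 𝒪 (suc m)
    after q = 𝒪ᴵ.insertAfter (cellProduct 𝟎) q 𝟎 (u ++ v)

    values : ∀ q → apply Φ (after q) ≈ᴹ Vᴵ.insertAfter g q 𝟎 (u ++ v)
    values q = ≈ᴹ-trans
      (cong-≈ Φ (insertAfter-cellProduct q 𝟎 (u ++ v) (complete-unique complete′) (complete-∈ complete′ q)))
      (≈ᴹ-trans (interpolate-ι*pole g (cellProduct 𝟎 (u ++ v)) q) (interpolate-cell (Vᴵ.insertAfter g q 𝟎) complete′))

    next-values : ∀ x → apply Φ (𝒪ᴵ.next after x) ≈ᴹ
                  Vᴵ.next (λ b → Vᴵ.insertAfter g b 𝟎 (u ++ v)) x
    next-values []      = homo-0 Φ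
    next-values (b ∷ _) = values b

-- Top cohomology as functions modulo derivatives.

module TopForms (m : ℕ) where

  open 𝒪-Ring m
  open PointSum +-commutativeMonoid
  open CommutativeMonoidSum +-commutativeMonoid using (sum)

  -- The signs in `d` are absorbed into the differentiated function, so a functional that vanishes
  -- on all derivatives vanishes on exact top forms.
  sign·∂ : ∀ b i z → ∃ λ z′ → (- 1𝒪) ^ b * ∂ i z ≈ ∂ i z′
  sign·∂ zero    i z = z , *-identityˡ _
  sign·∂ (suc b) i z with sign·∂ b i z
  ... | z′ , e = - z′ , ≈-trans
    (solve 2 (λ s x → (:- con 1ℚ) :* s :* x := :- (s :* x)) ≈-refl ((- 1𝒪) ^ b) (∂ i z)) (-‿cong e)

  ∂-as-sign·∂ : ∀ b i z → ∃ λ z′ → (- 1𝒪) ^ b * ∂ i z′ ≈ ∂ i z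
  ∂-as-sign·∂ zero    i z = z , *-identityˡ _
  ∂-as-sign·∂ (suc b) i z with ∂-as-sign·∂ b i z
  ... | z′ , e = - z′ , ≈-trans
    (solve 2 (λ s x → (:- con 1ℚ) :* s :* :- x := s :* x) ≈-refl ((- 1𝒪) ^ b) (∂ i z′)) e

  term-∈ : ∀ η {s i} → lookup s i ≡ true → term η s i ≡ (- 1𝒪) ^ below s i * ∂ i (η (s - i))
  term-∈ η {s} {i} i∈s rewrite i∈s = refl

  term-⊤ : ∀ η i → term η ⊤ i ≡ (- 1𝒪) ^ below ⊤ i * ∂ i (η (⊤ - i))
  term-⊤ η i = term-∈ η {⊤} {i} (lookup-replicate i true)

  ClosedFunctional-exact : ∀ {V} (c : ClosedFunctional m V) {x} η → x ≈ d η ⊤ →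
                           LeftModule._≈ᴹ_ V (apply c x) (LeftModule.0ᴹ V)
  ClosedFunctional-exact {V} c η e = ≈ᴹ-trans (cong-≈ c e) (homo-sum λ i →
      let z , q = sign·∂ (below ⊤ i) i (η (⊤ - i)) in
      ≈ᴹ-trans (cong-≈ c (≈-trans (reflexive (term-⊤ η i)) q)) (homo-∂ c i z))
    where
    open VectorSpace V hiding (sum)
    homo-sum : ∀ {k} {h : Fin k → 𝒪 m} → (∀ i → apply c (h i) ≈ᴹ 0ᴹ) → apply c (sum h) ≈ᴹ 0ᴹ
    homo-sum {zero}  z = homo-0 c
    homo-sum {suc k} z = ≈ᴹ-trans (homo-+ c _ _) (≈ᴹ-trans (+ᴹ-cong (z zero) (homo-sum (z ∘ suc))) (+ᴹ-identityˡ 0ᴹ))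

  ∣⊤-i∣ : ∀ {k} (i : Fin k) → suc ∣ ⊤ - i ∣ ≡ k
  ∣⊤-i∣ {suc k} zero    = cong suc (trans (cong ∣_∣ (p─⊥≡p (⊤ {k}))) (∣⊤∣≡n k))
  ∣⊤-i∣ {suc k} (suc i) = cong suc (∣⊤-i∣ i)

  ⊤-injective : ∀ {k} {i j : Fin k} → ⊤ - i ≡ ⊤ - j → i ≡ j
  ⊤-injective {i = i} {j} e with i ≟ᶠ j
  ... | yes i≡j = i≡j
  -- Otherwise `i` lies in `⊤ - j`, which is `⊤ - i`, and removing it a second time would lower the
  -- size.
  ... | no i≢j  = contradiction (cong ∣_∣ (p─q─q≡p─q ⊤ ⁅ i ⁆))
    (ℕ.<⇒≢ (x∈p⇒∣p-x∣<∣p∣ (subst (i ∈ˢ_) (sym e) (x∈p∧x≢y⇒x∈p-y ∈⊤ i≢j))))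

  s-j≡⊤-i : ∀ {k} {s : Subset k} {i j : Fin k} → lookup s j ≡ true → s - j ≡ ⊤ - i → s ≡ ⊤
  s-j≡⊤-i {k} {s} {i} {j} j∈s e = ∣p∣≡n⇒p≡⊤ (ℕ.≤-antisym (∣p∣≤n s)
    (subst (_≤ ∣ s ∣) (trans (cong (suc ∘ ∣_∣) e) (∣⊤-i∣ i)) (x∈p⇒∣p-x∣<∣p∣ (lookup⇒[]= j s j∈s))))

  volume-⊤ : ∀ x → volume x ⊤ ≡ x
  volume-⊤ x = cong (λ b → if b then x else 0𝒪) (dec-true (∣ ⊤ {m} ∣ ℕ.≟ m) (∣⊤∣≡n m))

  volume-≢⊤ : ∀ x {s} → s ≢ ⊤ → volume x s ≡ 0𝒪
  volume-≢⊤ x {s} s≢⊤ = volume-off x s (s≢⊤ ∘ ∣p∣≡n⇒p≡⊤)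

  _≟ˢ_ : DecidableEquality (Subset m)
  _≟ˢ_ = ≡-dec _≟ᵇ_

  -- The primitive is x times the product of the remaining dt_j, corrected by the sign that `d`
  -- attaches to dt_i.
  topForm-∂-exact : ∀ i x → topForm (∂ i x) ∼ 0ᶜ
  topForm-∂-exact i x = η , degree , λ s → ≈-trans (≈-trans (+-congˡ -0#≈0#) (+-identityʳ _)) (η-primitive s)
    where
    z : ∃ λ x′ → (- 1𝒪) ^ below ⊤ i * ∂ i x′ ≈ ∂ i x
    z = ∂-as-sign·∂ (below ⊤ i) i x
    η : Form m
    η s = if does (s ≟ˢ (⊤ - i)) then proj₁ z else 0𝒪
    η-on : η (⊤ - i) ≡ proj₁ z
    η-on = cong (λ b → if b then proj₁ z else 0𝒪) (dec-true ((⊤ - i) ≟ˢ (⊤ - i)) refl)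
    η-off : ∀ {s} → s ≢ ⊤ - i → η s ≡ 0𝒪
    η-off {s} n = cong (λ b → if b then proj₁ z else 0𝒪) (dec-false (s ≟ˢ (⊤ - i)) n)
    degree : ∀ s → suc ∣ s ∣ ≢ m → η s ≈ 0𝒪
    degree s n = reflexive (η-off {s} λ { refl → n (∣⊤-i∣ i) })
    η-primitive : ∀ s → volume (∂ i x) s ≈ d η s
    η-primitive s with s ≟ˢ ⊤
    ... | no s≢⊤   = ≈-trans (reflexive (volume-≢⊤ (∂ i x) s≢⊤)) (≈-sym (d-vanish η s λ j j∈s →
      η-off {s - j} (s≢⊤ ∘ s-j≡⊤-i {s = s} {i} {j} j∈s)))
    ... | yes refl = begin
      volume (∂ i x) ⊤                          ≡⟨ volume-⊤ (∂ i x) ⟩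
      ∂ i x                                     ≈⟨ proj₂ z ⟨
      (- 1𝒪) ^ below ⊤ i * ∂ i (proj₁ z)        ≡⟨ cong (λ y → (- 1𝒪) ^ below ⊤ i * ∂ i y) η-on ⟨
      (- 1𝒪) ^ below ⊤ i * ∂ i (η (⊤ - i))      ≡⟨ term-⊤ η i ⟨
      term η ⊤ i                                ≈⟨ ∑-single {h = term η ⊤} i other ⟨
      d η ⊤                                     ∎
      where
      other : ∀ j → j ≢ i → term η ⊤ j ≈ 0𝒪
      other j j≢i = term-vanish η ⊤ j λ _ → η-off {⊤ - j} (j≢i ∘ ⊤-injective)

  -- The universal closed functional: by `ClosedFunctional-∼` every other one factors through it.
  topClass : ClosedFunctional m (cohomology {m} m)
  topClass = record
    { apply  = topForm
    ; cong-≈ = topForm-cong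
    ; homo-+ = λ x y → ≋⇒∼ (topForm (x + y)) (topForm x +ᶜ topForm y) (volume-+ x y)
    ; homo-* = λ q x → ≋⇒∼ (topForm (const q * x)) (q *ᶜ topForm x) (volume-* q x)
    ; homo-∂ = topForm-∂-exact
    }
    where
    volume-+ : ∀ (x y : 𝒪 m) → volume (x + y) ≋ volume x +ᶠ volume y
    volume-+ x y s with does (∣ s ∣ ℕ.≟ m)
    ... | true  = ≈-refl
    ... | false = ≈-sym (+-identityˡ 0𝒪)
    volume-* : ∀ q (x : 𝒪 m) → volume (const q * x) ≋ q *ᶠ volume x
    volume-* q x s with does (∣ s ∣ ℕ.≟ m)
    ... | true  = ≈-refl
    ... | false = ≈-sym (zeroʳ (const q))

  topCoefficient : Cocycle {m} m → 𝒪 m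
  topCoefficient ω = Cocycle.form ω ⊤

  topCoefficient-injective : ∀ ω ω′ → topCoefficient ω ≈ topCoefficient ω′ → ω ∼ ω′
  topCoefficient-injective ω ω′ e = ≋⇒∼ ω ω′ pointwise
    where
    pointwise : Cocycle.form ω ≋ Cocycle.form ω′
    pointwise s with s ≟ˢ ⊤
    ... | yes refl = e
    ... | no s≢⊤   = ≈-trans (Cocycle.degree ω s (s≢⊤ ∘ ∣p∣≡n⇒p≡⊤)) (≈-sym (Cocycle.degree ω′ s (s≢⊤ ∘ ∣p∣≡n⇒p≡⊤)))

  ClosedFunctional-∼ : ∀ {V} (c : ClosedFunctional m V) ω ω′ → ω ∼ ω′ →
                       LeftModule._≈ᴹ_ V (apply c (topCoefficient ω)) (apply c (topCoefficient ω′))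
  ClosedFunctional-∼ {V} c ω ω′ (η , _ , e) = ≈ᴹ-trans
    (+ᴹ-inverseˡ-unique _ _ (≈ᴹ-trans (+ᴹ-congˡ (≈ᴹ-sym (homo-neg c _)))
      (≈ᴹ-trans (≈ᴹ-sym (homo-+ c _ _)) (ClosedFunctional-exact c η (e ⊤)))))
    (GroupProperties.⁻¹-involutive +ᴹ-group _)
    where
    open VectorSpace V

-- From marked points back to letters and words.

ρ⁻¹ : ∀ {m} → Point m → Fin (suc (suc m))
ρ⁻¹     𝟎     = zero
ρ⁻¹ {m} 𝟏     = suc (Fin.fromℕ m)
ρ⁻¹     (𝒕 i) = suc (inject₁ i)

ρ-ρ⁻¹ : ∀ {m} (p : Point m) → ρ (ρ⁻¹ p) ≡ p
ρ-ρ⁻¹     𝟎     = refl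
ρ-ρ⁻¹ {m} 𝟏     rewrite view-fromℕ m = refl
ρ-ρ⁻¹     (𝒕 i) rewrite view-inject₁ i = refl

ρ⁻¹-ρ : ∀ {m} (i : Fin (suc (suc m))) → ρ⁻¹ (ρ i) ≡ i
ρ⁻¹-ρ i = ρ-injective (ρ-ρ⁻¹ (ρ i))

map-ρ-ρ⁻¹ : ∀ {m} (w : List (Point m)) → map ρ (map ρ⁻¹ w) ≡ w
map-ρ-ρ⁻¹ w = trans (sym (List.map-∘ w)) (trans (List.map-cong ρ-ρ⁻¹ w) (List.map-id w))

map-ρ⁻¹-ρ : ∀ {m} (w : List (Fin (suc (suc m)))) → map ρ⁻¹ (map ρ w) ≡ w
map-ρ⁻¹-ρ w = trans (sym (List.map-∘ w)) (trans (List.map-cong ρ⁻¹-ρ w) (List.map-id w))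

allFin-suc : ∀ m → allFin (suc m) ≡ zero ∷ map suc (allFin m)
allFin-suc m = cong (zero ∷_) (sym (List.map-tabulate id suc))

allFin-top : ∀ m → Fin.fromℕ m ∷ map inject₁ (allFin m) ↭ allFin (suc m)
allFin-top zero    = ↭-refl
allFin-top (suc m) = ↭-trans (↭-reflexive (cong (λ w → Fin.fromℕ (suc m) ∷ map inject₁ w) (allFin-suc m)))
  (↭-trans (swap _ _ (↭-reflexive (trans (sym (List.map-∘ (allFin m))) (List.map-∘ (allFin m)))))
  (↭-trans (prep zero (↭-map⁺ suc (allFin-top m))) (↭-reflexive (sym (allFin-suc (suc m))))))

points↭allFin : ∀ m → zero ∷ map ρ⁻¹ (nonzeroPoints m) ↭ allFin (suc (suc m))
points↭allFin m = ↭-trans (prep zero (↭-trans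
    (↭-reflexive (cong (suc (Fin.fromℕ m) ∷_) (trans (sym (List.map-∘ (allFin m))) (List.map-∘ (allFin m)))))
    (↭-map⁺ suc (allFin-top m))))
  (↭-reflexive (sym (allFin-suc (suc m))))

complete⇒↭allFin : ∀ {m} {w : List (Point m)} → Complete w → zero ∷ map ρ⁻¹ w ↭ allFin (suc (suc m))
complete⇒↭allFin {m} c = ↭-trans (prep zero (↭-map⁺ ρ⁻¹ c)) (points↭allFin m)

↭allFin⇒complete : ∀ {m} {w : List (Fin (suc (suc m)))} → zero ∷ w ↭ allFin (suc (suc m)) → Complete (map ρ w)
↭allFin⇒complete {m} {w} c = ↭-trans (↭-map⁺ ρ (drop-∷ (↭-trans c (↭-sym (points↭allFin m)))))
  (↭-reflexive (map-ρ-ρ⁻¹ (nonzeroPoints m)))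

-- Interpolation asks for values on all lists; deciding completeness allows `word` to be total.
_↭?_ : ∀ {n} (x y : List (Fin n)) → Dec (x ↭ y)
[] ↭? []      = yes ↭-refl
[] ↭? (b ∷ y) = no λ p → ¬x∷xs↭[] (↭-sym p)
(a ∷ x) ↭? y with DecMembership._∈?_ _≟ᶠ_ a y
... | no a∉y = no λ p → a∉y (∈-resp-↭ p (here refl))
... | yes a∈y with ∈-∃++ a∈y
...   | u , v , refl with x ↭? (u ++ v)
...     | yes p = yes (↭-trans (prep a p) (↭-sym (shift a u v)))
...     | no ¬p = no λ p → ¬p (drop-∷ (↭-trans p (shift a u v)))

module Words (n : ℕ) where

  open Free (CyclicOrdering n) using (basis; 0#; basis-cong; ≈-trans; ≈-sym) renaming (_≈_ to _≈′_)
  open LeftModule (𝒫 n) using (Carrierᴹ)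

  -- (w , d), and 0 if w does not have each letter exactly once.
  word : List (Fin n) → Carrierᴹ
  word w with w ↭? allFin n
  ... | yes p = basis (close ⟨ w , p ⟩)
  ... | no _  = 0#

  word-complete : ∀ {w} (p : w ↭ allFin n) → word w ≈′ basis (close ⟨ w , p ⟩)
  word-complete {w} p with w ↭? allFin n
  ... | yes p′ = basis-cong ([] , _ , refl , sym (List.++-identityʳ _))
  ... | no ¬p  = contradiction p ¬p

  word-incomplete : ∀ {w} → ¬ (w ↭ allFin n) → word w ≡ 0#
  word-incomplete {w} ¬p with w ↭? allFin n
  ... | yes p = contradiction p ¬p
  ... | no _  = refl

  basis-word : ∀ c → basis c ≈′ word (Word.letters (open-at-d c))
  basis-word c = ≈-trans (basis-cong (close-open c)) (≈-sym (word-complete (Word.complete (open-at-d c))))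

-- Shuffle relations between cell functions.

module ListSum (M : CommutativeMonoid 0ℓ 0ℓ) where

  open CommutativeMonoid M using (Carrier; _∙_; ε; assoc; identityˡ; ∙-cong; ∙-congˡ)
    renaming (_≈_ to _≈ₘ_; sym to symₘ; trans to transₘ)

  ∑ᴸ : ∀ {A : Set} → (A → Carrier) → List A → Carrier
  ∑ᴸ g []       = ε
  ∑ᴸ g (x ∷ xs) = g x ∙ ∑ᴸ g xs

  ∑ᴸ-++ : ∀ {A : Set} (g : A → Carrier) xs ys → ∑ᴸ g (xs ++ ys) ≈ₘ ∑ᴸ g xs ∙ ∑ᴸ g ys
  ∑ᴸ-++ g []       ys = symₘ (identityˡ _)
  ∑ᴸ-++ g (x ∷ xs) ys = transₘ (∙-congˡ (∑ᴸ-++ g xs ys)) (symₘ (assoc _ _ _))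

  ∑ᴸ-map : ∀ {A B : Set} (g : B → Carrier) (h : A → B) xs → ∑ᴸ g (map h xs) ≡ ∑ᴸ (g ∘ h) xs
  ∑ᴸ-map g h []       = refl
  ∑ᴸ-map g h (x ∷ xs) = cong (g (h x) ∙_) (∑ᴸ-map g h xs)

  ∑ᴸ-ш : ∀ {A : Set} (g : List A → Carrier) a x b y →
         ∑ᴸ g ((a ∷ x) ш (b ∷ y)) ≈ₘ ∑ᴸ (g ∘ (a ∷_)) (x ш (b ∷ y)) ∙ ∑ᴸ (g ∘ (b ∷_)) ((a ∷ x) ш y)
  ∑ᴸ-ш g a x b y = transₘ (∑ᴸ-++ g (map (a ∷_) (x ш (b ∷ y))) (map (b ∷_) ((a ∷ x) ш y)))
    (∙-cong (CommutativeMonoid.reflexive M (∑ᴸ-map g (a ∷_) (x ш (b ∷ y))))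
            (CommutativeMonoid.reflexive M (∑ᴸ-map g (b ∷_) ((a ∷ x) ш y))))

module CellWords (m : ℕ) where

  open 𝒪-Ring m
  open ListSum +-commutativeMonoid

  private
    n : ℕ
    n = suc (suc m)

  cell : Fin n → List (Fin n) → 𝒪 m
  cell i w = cellProduct (ρ i) (map ρ w)

  cellWord : List (Fin n) → 𝒪 m
  cellWord []      = 1𝒪
  cellWord (i ∷ w) = cell i w

  cellCoefficient≡cellWord : ∀ {w : List (Fin n)} (l : Linked _≢_ w) → cellCoefficient l ≡ cellWord w
  cellCoefficient≡cellWord []        = refl
  cellCoefficient≡cellWord [-]       = refl
  cellCoefficient≡cellWord (i≢j ∷ l) = cong₂ _*_ (sym (recip-≢ (i≢j ∘ ρ-injective))) (cellCoefficient≡cellWord l)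

  private
    ∷-shuffle : ∀ {a b : Fin n} x y → Unique (a ∷ x ++ b ∷ y) → Unique (b ∷ (a ∷ x) ++ y)
    ∷-shuffle {a} {b} x y = Unique-resp-↭ (shift b (a ∷ x) y)

  -- Behind a common first letter, cell functions turn shuffles into products: the shuffle splits by
  -- its next letter, and `recip-shuffle` recombines the two halves. As for insertions, `k` carries
  -- the factors already passed.
  cell-shuffle : ∀ g k i x y → Unique (i ∷ x ++ y) → (∀ w → g w ≈ k * cell i w) →
                 ∑ᴸ g (x ш y) ≈ k * (cell i x * cell i y)
  cell-shuffle g k i [] y un e = begin
    g y + 0𝒪                      ≈⟨ +-identityʳ _ ⟩
    g y                           ≈⟨ e y ⟩
    k * cell i y                  ≈⟨ *-congˡ (*-identityˡ _) ⟨
    k * (1𝒪 * cell i y)           ∎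
  cell-shuffle g k i (a ∷ x) [] un e = begin
    g (a ∷ x) + 0𝒪                ≈⟨ +-identityʳ _ ⟩
    g (a ∷ x)                     ≈⟨ e (a ∷ x) ⟩
    k * cell i (a ∷ x)            ≈⟨ *-congˡ (*-identityʳ _) ⟨
    k * (cell i (a ∷ x) * 1𝒪)     ∎
  cell-shuffle g k i (a ∷ x) (b ∷ y) un@(i∉ ∷ un′@(a∉ ∷ _)) e = begin
    ∑ᴸ g ((a ∷ x) ш (b ∷ y))
      ≈⟨ ∑ᴸ-ш g a x b y ⟩
    ∑ᴸ (g ∘ (a ∷_)) (x ш (b ∷ y)) + ∑ᴸ (g ∘ (b ∷_)) ((a ∷ x) ш y)
      ≈⟨ +-cong (cell-shuffle (g ∘ (a ∷_)) (k * ia) a x (b ∷ y) un′ λ w → ≈-trans (e _) (≈-sym (*-assoc _ _ _)))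
                (cell-shuffle (g ∘ (b ∷_)) (k * ib) b (a ∷ x) y (∷-shuffle x y un′) λ w → ≈-trans (e _) (≈-sym (*-assoc _ _ _))) ⟩
    k * ia * (X * (ab * Y)) + k * ib * (ba * X * Y)
      ≈⟨ solve 7 (λ k ia ib ab ba X Y → k :* ia :* (X :* (ab :* Y)) :+ k :* ib :* (ba :* X :* Y)
                   := k :* ((ia :* ab :+ ib :* ba) :* (X :* Y))) ≈-refl k ia ib ab ba X Y ⟩
    k * ((ia * ab + ib * ba) * (X * Y))
      ≈⟨ *-congˡ (*-congʳ (recip-shuffle (All.lookup i∉ (here refl) ∘ ρ-injective) (All.lookup i∉ (there b∈) ∘ ρ-injective)
                                         (All.lookup a∉ b∈ ∘ ρ-injective))) ⟨
    k * (ia * ib * (X * Y))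
      ≈⟨ *-congˡ (solve 4 (λ ia ib X Y → ia :* ib :* (X :* Y) := ia :* X :* (ib :* Y)) ≈-refl ia ib X Y) ⟩
    k * (ia * X * (ib * Y)) ∎
    where
    b∈ : b ∈ x ++ b ∷ y
    b∈ = ∈-++⁺ʳ x (here refl)
    ia ib ab ba X Y : 𝒪 m
    ia = recip (ρ i) (ρ a)
    ib = recip (ρ i) (ρ b)
    ab = recip (ρ a) (ρ b)
    ba = recip (ρ b) (ρ a)
    X = cell a x
    Y = cell b y

  -- By `cell-shuffle`, the words beginning with a and those beginning with b contribute the same
  -- product with the factors 1 / (b - a) and 1 / (a - b).
  cellWord-shuffle : ∀ a x b y → Unique (a ∷ x ++ b ∷ y) → ∑ᴸ cellWord ((a ∷ x) ш (b ∷ y)) ≈ 0𝒪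
  cellWord-shuffle a x b y un = begin
    ∑ᴸ cellWord ((a ∷ x) ш (b ∷ y))
      ≈⟨ ∑ᴸ-ш cellWord a x b y ⟩
    ∑ᴸ (cell a) (x ш (b ∷ y)) + ∑ᴸ (cell b) ((a ∷ x) ш y)
      ≈⟨ +-cong (cell-shuffle (cell a) 1𝒪 a x (b ∷ y) un λ w → ≈-sym (*-identityˡ _))
                (cell-shuffle (cell b) 1𝒪 b (a ∷ x) y (∷-shuffle x y un) λ w → ≈-sym (*-identityˡ _)) ⟩
    1𝒪 * (X * (ab * Y)) + 1𝒪 * (ba * X * Y)
      ≈⟨ +-congˡ (*-congˡ (*-congʳ (*-congʳ (recip-antisym (ρ a) (ρ b))))) ⟩
    1𝒪 * (X * (ab * Y)) + 1𝒪 * ((- ab) * X * Y)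
      ≈⟨ solve 3 (λ ab X Y → con 1ℚ :* (X :* (ab :* Y)) :+ con 1ℚ :* ((:- ab) :* X :* Y) := con 0ℚ) ≈-refl ab X Y ⟩
    0𝒪 ∎
    where
    ab ba X Y : 𝒪 m
    ab = recip (ρ a) (ρ b)
    ba = recip (ρ b) (ρ a)
    X = cell a x
    Y = cell b y

-- The cell-form map, its section and its kernel.

module CellFormMap (m : ℕ) where

  private
    n : ℕ
    n = suc (suc m)

  open 𝒪-Ring m using (reflexive; 0𝒪)
  open TopForms m
  open Words n
  open CellWords m
  open VectorSpace (𝒫 n)
  open Free (CyclicOrdering n) using (basis)
  open ListSum +ᴹ-commutativeMonoid
  private
    module 𝒪Sum = ListSum (𝒪-Ring.+-commutativeMonoid m)
    module H = LeftModule (H n m)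

  f-cong : ∀ {x y} → x ≈ᴹ y → f n x H.≈ᴹ f n y
  f-cong = Free.LinearExtension.extend-cong (CyclicOrdering n) (H n m) cellForm
    λ {c} {c′} → cellForm-cong {n} {c} {c′}

  coefficient : Carrierᴹ → 𝒪 m
  coefficient z = topCoefficient (f n z)

  coefficient-word : ∀ {w} → w ↭ allFin n → coefficient (word w) ≈ cellWord w
  coefficient-word {w} p with w ↭? allFin n
  ... | no ¬p = contradiction p ¬p
  ... | yes p′ = reflexive (trans (volume-⊤ _)
    (trans (cellCoefficient≡cellWord (linked (open-at-d (close ⟨ w , p′ ⟩)))) (cong cellWord (open-close ⟨ w , p′ ⟩))))

  value : List (Point m) → Carrierᴹ
  value w = word (zero ∷ map ρ⁻¹ w)

  -- The section of `f`, obtained by prescribing on each cell form the word that it comes from.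
  Φ : ClosedFunctional m (𝒫 n)
  Φ = interpolate m value

  f∘Φ : ClosedFunctional m (H n m)
  f∘Φ = record
    { apply  = λ x → f n (apply Φ x)
    ; cong-≈ = λ e → f-cong (cong-≈ Φ e)
    ; homo-+ = λ x y → f-cong (homo-+ Φ x y)
    ; homo-* = λ q x → f-cong (homo-* Φ q x)
    ; homo-∂ = λ i x → f-cong (homo-∂ Φ i x)
    }

  f∘Φ-cell : ∀ {w} → Complete w → topForm (cellProduct 𝟎 w) ∼ f n (apply Φ (cellProduct 𝟎 w))
  f∘Φ-cell {w} c = H.≈ᴹ-trans {topForm (cellProduct 𝟎 w)} {f n z} {f n (apply Φ (cellProduct 𝟎 w))}
    (topCoefficient-injective (topForm (cellProduct 𝟎 w)) (f n z) (begin
      volume (cellProduct 𝟎 w) ⊤                 ≡⟨ volume-⊤ _ ⟩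
      cellProduct 𝟎 w                            ≡⟨ cong (cellProduct 𝟎) (map-ρ-ρ⁻¹ w) ⟨
      cellWord (zero ∷ map ρ⁻¹ w)                ≈⟨ coefficient-word (complete⇒↭allFin c) ⟨
      coefficient z                              ∎))
    (f-cong (≈ᴹ-sym (interpolate-cell {𝒫 n} value c)))
    where
    open 𝒪-Ring m using (begin_; step-≈-⟨; step-≡-⟩; step-≡-⟨; _∎)
    z : Carrierᴹ
    z = value w

  -- Both sides are closed functionals, so agreement on the cell forms of words beginning with 0
  -- suffices.
  f∘Φ≈topClass : ∀ x → f n (apply Φ x) ∼ topForm x
  f∘Φ≈topClass = closed-functionals-agree f∘Φ topClass λ w c →
    H.≈ᴹ-sym {topForm (cellProduct 𝟎 w)} {f n (apply Φ (cellProduct 𝟎 w))} (f∘Φ-cell c)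

  f-surjective : Surjective _≈ᴹ_ H._≈ᴹ_ (f n)
  f-surjective ω = apply Φ x , λ {z} z≈ →
    H.≈ᴹ-trans {f n z} {f n (apply Φ x)} {ω} (f-cong z≈)
      (H.≈ᴹ-trans {f n (apply Φ x)} {topForm x} {ω} (f∘Φ≈topClass x)
        (topCoefficient-injective (topForm x) ω (reflexive (volume-⊤ x))))
    where
    x : 𝒪 m
    x = topCoefficient ω

  ker-from-coefficient : ∀ z → coefficient z ≈ 0𝒪 → ker-f n z
  ker-from-coefficient z e = topCoefficient-injective (f n z) 0ᶜ e

  sum-mapWith∈ : ∀ ws (h : ∀ {w} → w ∈ ws → w ↭ allFin n) →
                 Free.sum (CyclicOrdering n) (mapWith∈ ws λ w∈ → basis (close ⟨ _ , h w∈ ⟩)) ≈ᴹ ∑ᴸ word ws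
  sum-mapWith∈ []       h = ≈ᴹ-refl
  sum-mapWith∈ (w ∷ ws) h = +ᴹ-cong (≈ᴹ-sym (word-complete (h (here refl)))) (sum-mapWith∈ ws (h ∘ there))

  coefficient-∑ : ∀ ws → (∀ {w} → w ∈ ws → w ↭ allFin n) → coefficient (∑ᴸ word ws) ≈ 𝒪Sum.∑ᴸ cellWord ws
  coefficient-∑ []       h = ≈-refl
  coefficient-∑ (w ∷ ws) h = +-cong (coefficient-word (h (here refl))) (coefficient-∑ ws (h ∘ there))

  shuffle≈∑ : ∀ x y p → shuffle x y p ≈ᴹ ∑ᴸ word (x ш y)
  shuffle≈∑ x y p = sum-mapWith∈ (x ш y) λ w∈ → ↭-trans (ш-↭ x y w∈) p

  shuffle-in-kernel : ∀ {z} → IsShuffle z → ker-f n z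
  shuffle-in-kernel (isShuffle {[]} {_} A≢[] _ _) = contradiction refl A≢[]
  shuffle-in-kernel (isShuffle {_ ∷ _} {[]} _ B≢[] _) = contradiction refl B≢[]
  shuffle-in-kernel (isShuffle {a ∷ x} {b ∷ y} _ _ p) = H.≈ᴹ-trans {f n (shuffle (a ∷ x) (b ∷ y) p)} {f n z} {0ᶜ}
    (f-cong (shuffle≈∑ (a ∷ x) (b ∷ y) p))
    (ker-from-coefficient z (≈-trans
      (coefficient-∑ ((a ∷ x) ш (b ∷ y)) λ w∈ → ↭-trans (ш-↭ (a ∷ x) (b ∷ y) w∈) p)
      (cellWord-shuffle a x b y (Unique-resp-↭ (↭-sym p) (allFin⁺ n)))))
    where
    z : Carrierᴹ
    z = ∑ᴸ word ((a ∷ x) ш (b ∷ y))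

  I⊆ker : ∀ {z} → I n z → ker-f n z
  I⊆ker (⊆span s)            = shuffle-in-kernel s
  I⊆ker 0∈                   = H.≈ᴹ-refl {0ᶜ}
  I⊆ker (+∈ {x} {y} s s′)    = H.≈ᴹ-trans {f n x +ᶜ f n y} {0ᶜ +ᶜ 0ᶜ} {0ᶜ}
    (H.+ᴹ-cong {f n x} {0ᶜ} {f n y} {0ᶜ} (I⊆ker s) (I⊆ker s′)) (H.+ᴹ-identityˡ 0ᶜ)
  I⊆ker (*∈ q {x} s)         = H.≈ᴹ-trans {q *ᶜ f n x} {q *ᶜ 0ᶜ} {0ᶜ}
    (H.*ₗ-congˡ {q} {f n x} {0ᶜ} (I⊆ker s)) (H.*ₗ-zeroʳ q)
  I⊆ker (≈∈ {x} {y} e s)     = H.≈ᴹ-trans {f n y} {f n x} {0ᶜ} (f-cong (≈ᴹ-sym e)) (I⊆ker s)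

  ψ : Carrierᴹ → Carrierᴹ
  ψ z = apply Φ (coefficient z)

  ψ-cong : ∀ {x y} → x ≈ᴹ y → ψ x ≈ᴹ ψ y
  ψ-cong {x} {y} e = ClosedFunctional-∼ Φ (f n x) (f n y) (f-cong e)

  ψ-ker : ∀ z → ker-f n z → ψ z ≈ᴹ 0ᴹ
  ψ-ker z e = ≈ᴹ-trans (ClosedFunctional-∼ Φ (f n z) 0ᶜ e) (homo-0 Φ)

  ψ-word : ∀ w → zero ∷ w ↭ allFin n → ψ (word (zero ∷ w)) ≈ᴹ word (zero ∷ w)
  ψ-word w p = ≈ᴹ-trans (cong-≈ Φ (coefficient-word p)) (≈ᴹ-trans (interpolate-cell {𝒫 n} value (↭allFin⇒complete p))
    (≈ᴹ-reflexive (cong (λ w → word (zero ∷ w)) (map-ρ⁻¹-ρ w))))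

  -- ψ is the identity modulo I: it is so on words beginning with the letter 1,
  -- which generate 𝒫 modulo shuffles.
  Fixed : Carrierᴹ → Set
  Fixed z = I n (ψ z +ᴹ -ᴹ z)

  fixed : ∀ {z} → ψ z ≈ᴹ z → Fixed z
  fixed {z} e = ≈∈ (≈ᴹ-sym (≈ᴹ-trans (+ᴹ-congʳ e) (-ᴹ‿inverseʳ z))) 0∈

  Fixed-resp : ∀ {x y} → x ≈ᴹ y → Fixed x → Fixed y
  Fixed-resp e = ≈∈ (+ᴹ-cong (ψ-cong e) (-ᴹ‿cong e))

  Fixed-+ : ∀ {x y} → Fixed x → Fixed y → Fixed (x +ᴹ y)
  Fixed-+ {x} {y} p q = ≈∈ (≈ᴹ-trans (interchange _ _ _ _)
    (+ᴹ-cong (≈ᴹ-sym (homo-+ Φ _ _)) (≈ᴹ-sym (*ₗ-distribˡ _ x y)))) (+∈ p q)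

  Fixed-* : ∀ q {x} → Fixed x → Fixed (q *ₗ x)
  Fixed-* q {x} p = ≈∈ (≈ᴹ-trans (*ₗ-distribˡ q _ _) (+ᴹ-cong (≈ᴹ-sym (homo-* Φ q _))
    (≈ᴹ-trans (≈ᴹ-sym (*ₗ-assoc q _ x)) (≈ᴹ-trans (*ₗ-congʳ (ℚ.*-comm q _)) (*ₗ-assoc _ q x))))) (*∈ q p)

  Fixed-cancel : ∀ {x y} → Fixed (x +ᴹ y) → Fixed y → Fixed x
  Fixed-cancel {x} {y} p q = Fixed-resp
    (≈ᴹ-trans (+ᴹ-assoc x y _) (≈ᴹ-trans (+ᴹ-congˡ (-ᴹ‿inverseʳ y)) (+ᴹ-identityʳ x))) (Fixed-+ p (Fixed-* (ℚ.- 1ℚ) q))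

  Fixed-0 : Fixed 0ᴹ
  Fixed-0 = fixed (ψ-ker 0ᴹ (I⊆ker 0∈))

  -- `ψ` factors through `f` and thus kills `z`, leaving only `-ᴹ z`, which lies in `I`.
  Fixed-I : ∀ {z} → I n z → Fixed z
  Fixed-I {z} z∈I = ≈∈ (≈ᴹ-sym (≈ᴹ-trans (+ᴹ-congʳ (ψ-ker z (I⊆ker z∈I))) (+ᴹ-identityˡ _))) (*∈ (ℚ.- 1ℚ) z∈I)

  Fixed-∑ : ∀ (g : List (Fin n) → Carrierᴹ) ws → (∀ w → Fixed (g w)) → Fixed (∑ᴸ g ws)
  Fixed-∑ g []       h = Fixed-0
  Fixed-∑ g (w ∷ ws) h = Fixed-+ (h w) (Fixed-∑ g ws h)

  -- In u ш (a ∷ v) the letter a moves to the left in all terms but u ++ a ∷ v.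
  Fixed-leading : ∀ (g : List (Fin n) → Carrierᴹ) u a v →
                  (∀ u′ x → length u′ < length u → Fixed (g (u′ ++ a ∷ x))) →
                  Fixed (∑ᴸ g (u ш (a ∷ v))) → Fixed (g (u ++ a ∷ v))
  Fixed-leading g []      a v h s = Fixed-resp (+ᴹ-identityʳ _) s
  Fixed-leading g (b ∷ u) a v h s = Fixed-leading (g ∘ (b ∷_)) u a v (λ u′ x l → h (b ∷ u′) x (s≤s l))
    -- The half of the shuffle in which `a` comes first is fixed by hypothesis with an empty prefix;
    -- cancelling it leaves the half beginning with `b`.
    (Fixed-cancel (Fixed-resp (∑ᴸ-ш g b u a v) s) (Fixed-∑ (g ∘ (a ∷_)) ((b ∷ u) ш v) λ w → h [] w (s≤s z≤n)))

  Fixed-if-complete : ∀ w → (w ↭ allFin n → Fixed (word w)) → Fixed (word w)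
  Fixed-if-complete w h = go (w ↭? allFin n)
    where
    go : Dec (w ↭ allFin n) → Fixed (word w)
    go (yes p) = h p
    go (no ¬p) = subst Fixed (sym (word-incomplete ¬p)) Fixed-0

  -- Induction on the distance of the letter 1 from the front, bounded by `k`: the shuffle of
  -- `b ∷ u` with `zero ∷ v` is in `I`, and its other terms have that letter further left.
  Fixed-word : ∀ k u v → length u < k → Fixed (word (u ++ zero ∷ v))
  Fixed-word (suc k) []      v _       = Fixed-if-complete (zero ∷ v) λ p → fixed (ψ-word v p)
  Fixed-word (suc k) (b ∷ u) v (s≤s l) = Fixed-if-complete (b ∷ u ++ zero ∷ v) λ p →
    Fixed-leading word (b ∷ u) zero v (λ u′ x l′ → Fixed-word k u′ x (ℕ.<-≤-trans l′ l))
      (Fixed-resp (shuffle≈∑ (b ∷ u) (zero ∷ v) p) (Fixed-I (⊆span (isShuffle {A = b ∷ u} {B = zero ∷ v} (λ ()) (λ ()) p))))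

  every-fixed : ∀ z → Fixed z
  every-fixed (basis c) with ∈-∃++ (∈-resp-↭ (↭-sym (Word.complete (open-at-d c))) (∈-allFin zero))
  ... | u , v , e = Fixed-resp (≈ᴹ-sym (basis-word c))
    (subst (Fixed ∘ word) (sym e) (Fixed-word (suc (length u)) u v ℕ.≤-refl))
  every-fixed Free.0#         = Fixed-0
  every-fixed (x Free.+ y)    = Fixed-+ (every-fixed x) (every-fixed y)
  every-fixed (q Free.* x)    = Fixed-* q (every-fixed x)

  -- On the kernel `ψ z` vanishes, so the element of `I` given by `every-fixed` is `-ᴹ z`.
  ker⊆I : ∀ {z} → ker-f n z → I n z
  ker⊆I {z} e = ≈∈ (≈ᴹ-trans (≈ᴹ-sym (*ₗ-assoc _ _ z)) (*ₗ-identityˡ z))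
    (*∈ (ℚ.- 1ℚ) (≈∈ (≈ᴹ-trans (+ᴹ-congʳ (ψ-ker z e)) (+ᴹ-identityˡ _)) (every-fixed z)))

proposition4p1 : (n : ℕ) → n ≥ 3 →
    Surjective (LeftModule._≈ᴹ_ (𝒫 n)) (LeftModule._≈ᴹ_ (H n (n ∸ 2))) (f n)
    × ker-f n ≐ I n
proposition4p1 (suc zero)    (s≤s ())
proposition4p1 (suc (suc m)) _ = f-surjective , ker⊆I , I⊆ker
  where open CellFormMap m
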